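{- Let $\mathcal{H}=(V,\mathcal{E})$ be a $k$-partite hypergraph (with nonempty hyperedges) and let $b:V\to\mathbb{Z}_{\ge 0}$. The number of perfect $b$-matchings in $\mathcal{H}$ can be computed in $O(\mathrm{poly}(|V|,|\mathcal{E}|,\|b\|_\infty)\,(\|b\|_\infty+1)^{(1-1/k)|V|})$ time and $O(\mathrm{poly}(|V|,|\mathcal{E}|,\|b\|_\infty))$ space.
   Context: A hypergraph $\mathcal{H}=(V,\mathcal{E})$ consists of a finite vertex set $V$ and a finite collection $\mathcal{E}$ of subsets of $V$, called hyperedges. It is $k$-partite if there is a partition of $V$ into $k$ nonempty subsets $S_1,\dots,S_k$ such that each hyperedge contains at most one vertex of each $S_i$. For $b:V\to\mathbb{Z}_{\ge 0}$, a perfect $b$-matching is a function $x:\mathcal{E}\to\mathbb{Z}_{\ge 0}$ with $\sum_{F\in\mathcal{E}:\,v\in F}x(F)=b(v)$ for every $v\in V$; equivalently, a nonnegative integer solution of $Ax=b$, where $A\in\{0,1\}^{V\times\mathcal{E}}$ is the vertex-hyperedge incidence matrix. $\|b\|_\infty=\max_{v\in V}b(v)$. $\mathrm{poly}(\cdot)$ denotes some fixed polynomial in the listed quantities, independent of the input. -}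

module Defs where

open import Data.Bool using (if_then_else_)
open import Data.Fin using (Fin; zero; suc)
open import Data.Fin.Subset using (Subset; _∈_; _∩_; ∣_∣; Nonempty)
open import Data.Fin.Subset.Properties using (_∈?_)
open import Data.List as List using (List; []; _∷_; _++_)
open import Data.Nat using (ℕ; zero; suc; _+_; _*_; _∸_; _^_; _/_; _≤_; _⊔_; NonZero)
import Data.Nat.ListAction as ListAction
open import Data.Nat.Logarithm using (⌈log₂_⌉)
open import Data.Product using (Σ-syntax; _×_; ∃-syntax)
open import Data.Vec as Vec using (Vec; lookup; tabulate; toList)
open import Relation.Binary.PropositionalEquality using (_≡_)
open import Relation.Nullary using (does)

record Hypergraph : Set where
  field
    order : ℕ
    size  : ℕ
    edges : Vec (Subset order) size

open Hypergraph public

EdgesNonempty : Hypergraph → Set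
EdgesNonempty H = ∀ (j : Fin (size H)) → Nonempty (lookup (edges H) j)

record KPartite (k : ℕ) (H : Hypergraph) : Set where
  field
    part : Fin k → Subset (order H)
    nonempty : ∀ i → Nonempty (part i)
    covering : ∀ v → ∃[ i ] v ∈ part i
    disjoint : ∀ {i j v} → v ∈ part i → v ∈ part j → i ≡ j
    atMostOne : ∀ (j : Fin (size H)) i → ∣ lookup (edges H) j ∩ part i ∣ ≤ 1

-- The v-th coordinate of A x, for A the vertex-hyperedge incidence matrix.
load : (H : Hypergraph) → Vec ℕ (size H) → Fin (order H) → ℕ
load H x v =
  Vec.sum (Vec.zipWith (λ F xF → if does (v ∈? F) then xF else 0) (edges H) x)

-- Stated as an equality of vectors (rather than pointwise), so that the
-- elements of this type correspond to the functions x without needing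
-- function extensionality for the proof component.
PerfectMatching : (H : Hypergraph) → Vec ℕ (order H) → Set
PerfectMatching H b = Σ[ x ∈ Vec ℕ (size H) ] tabulate (load H x) ≡ b

‖_‖∞ : ∀ {n} → Vec ℕ n → ℕ
‖ b ‖∞ = Vec.foldr′ _⊔_ 0 b

infixl 6 _:+_
infixl 7 _:*_

data Poly (v : ℕ) : Set where
  con  : ℕ → Poly v
  var  : Fin v → Poly v
  _:+_ : Poly v → Poly v → Poly v
  _:*_ : Poly v → Poly v → Poly v

⟦_⟧ : ∀ {v} → Poly v → Vec ℕ v → ℕ
⟦ con c  ⟧ ρ = c
⟦ var i  ⟧ ρ = lookup ρ i
⟦ p :+ q ⟧ ρ = ⟦ p ⟧ ρ + ⟦ q ⟧ ρ
⟦ p :* q ⟧ ρ = ⟦ p ⟧ ρ * ⟦ q ⟧ ρ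

-- Model of computation: a random access machine with structured control
-- flow and bit-length ("logarithmic") cost.  A program uses a fixed number w
-- of arrays of natural numbers; cells that were never written hold 0.

Store : ℕ → Set
Store w = Vec (List ℕ) w

bits : ℕ → ℕ
bits n = ⌈log₂ suc n ⌉

peek : List ℕ → ℕ → ℕ
peek []       _       = 0
peek (x ∷ _)  zero    = x
peek (_ ∷ xs) (suc i) = peek xs i

-- Writing past the end of an array fills the gap with zeros.
poke : List ℕ → ℕ → ℕ → List ℕ
poke []       zero    y = y ∷ []
poke []       (suc i) y = 0 ∷ poke [] i y
poke (_ ∷ xs) zero    y = y ∷ xs
poke (x ∷ xs) (suc i) y = x ∷ poke xs i y

-- Every cell up to the highest address written is charged, including
-- the cells of the input.
space : ∀ {w} → Store w → ℕ
space σ = Vec.sum (Vec.map (λ a → ListAction.sum (List.map (λ x → 1 + bits x) a)) σ)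

data Op : Set where
  add sub mul div : Op

-- Subtraction is truncated and division by zero yields 0.
apply : Op → ℕ → ℕ → ℕ
apply add x y       = x + y
apply sub x y       = x ∸ y
apply mul x y       = x * y
apply div x zero    = 0
apply div x (suc y) = x / suc y

data Expr (w : ℕ) : Set where
  lit  : ℕ → Expr w
  _[_] : Fin w → Expr w → Expr w
  op   : Op → Expr w → Expr w → Expr w

eval : ∀ {w} → Expr w → Store w → ℕ
eval (lit n)     σ = n
eval (a [ e ])   σ = peek (lookup σ a) (eval e σ)
eval (op o e e′) σ = apply o (eval e σ) (eval e′ σ)

-- Arithmetic is charged as schoolbook multiplication.  The value of an
-- expression never has more bits than its cost.
cost : ∀ {w} → Expr w → Store w → ℕ
cost (lit n)     σ = 1 + bits n
cost (a [ e ])   σ = 1 + cost e σ + bits (eval (a [ e ]) σ)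
cost (op o e e′) σ = cost e σ + cost e′ σ + (1 + bits (eval e σ)) * (1 + bits (eval e′ σ))

infix  5 _[_]≔_
infixr 4 _⨾_

data Cmd (w : ℕ) : Set where
  skip   : Cmd w
  _[_]≔_ : Fin w → Expr w → Expr w → Cmd w
  _⨾_    : Cmd w → Cmd w → Cmd w
  branch : Expr w → Cmd w → Cmd w → Cmd w
  while  : Expr w → Cmd w → Cmd w

-- Run c σ τ t s: started in store σ, the command c terminates in store τ
-- after time t with peak space s.  The working space needed to evaluate an
-- expression is charged at its cost.  A guard holds when it is nonzero.
data Run {w : ℕ} : Cmd w → Store w → Store w → ℕ → ℕ → Set where

  skip : ∀ {σ} → Run skip σ σ 1 (space σ)

  assign : ∀ {σ a i e} →
    let c = cost i σ + cost e σ
        τ = Vec.updateAt σ a (λ xs → poke xs (eval i σ) (eval e σ))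
    in Run (a [ i ]≔ e) σ τ (1 + c) ((space σ + c) ⊔ space τ)

  seq : ∀ {c c′ σ τ υ t t′ s s′} →
    Run c σ τ t s → Run c′ τ υ t′ s′ →
    Run (c ⨾ c′) σ υ (t + t′) (s ⊔ s′)

  branch-true : ∀ {e c c′ σ τ t s} →
    NonZero (eval e σ) → Run c σ τ t s →
    Run (branch e c c′) σ τ (1 + cost e σ + t) ((space σ + cost e σ) ⊔ s)

  branch-false : ∀ {e c c′ σ τ t s} →
    eval e σ ≡ 0 → Run c′ σ τ t s →
    Run (branch e c c′) σ τ (1 + cost e σ + t) ((space σ + cost e σ) ⊔ s)

  while-true : ∀ {e c σ τ υ t t′ s s′} →
    NonZero (eval e σ) → Run c σ τ t s → Run (while e c) τ υ t′ s′ →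
    Run (while e c) σ υ (1 + cost e σ + t + t′) ((space σ + cost e σ) ⊔ s ⊔ s′)

  while-false : ∀ {e c σ} →
    eval e σ ≡ 0 →
    Run (while e c) σ σ (1 + cost e σ) (space σ + cost e σ)

record Program : Set where
  field
    scratch : ℕ
    code    : Cmd (suc scratch)

-- Array 0 holds the input at the start and, in its first cell, the output at
-- the end; the other arrays are empty at the start.
Computes : Program → (input : List ℕ) (output time space : ℕ) → Set
Computes P input output t s =
  Σ[ τ ∈ Store (suc scratch) ]
    Run code (input Vec.∷ Vec.replicate scratch []) τ t s
    × peek (lookup τ zero) 0 ≡ output
  where open Program P

-- |V|, |E|, the values of b, and the incidence matrix one hyperedge at a time.
-- A k-partition is not part of the input.
encode : (H : Hypergraph) → Vec ℕ (order H) → List ℕ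
encode H b =
  order H ∷ size H ∷ toList b
    ++ List.concatMap (λ F → List.map (λ v → if does (v ∈? F) then 1 else 0)
                                      (List.allFin (order H)))
                      (toList (edges H))

-- t ≤ p · B ^ ((1 − 1/k) · n) for k ≥ 1, where the exponent is in general not
-- an integer: both sides are raised to the k-th power.
_≤_·_^[1-1/_]_ : (t p B k n : ℕ) → Set
t ≤ p · B ^[1-1/ k ] n = t ^ k ≤ p ^ k * B ^ ((k ∸ 1) * n)

{-# OPTIONS --safe #-}
module Submission where

-- Let B = ‖b‖∞ + 1.  If C is a set of vertices such that every hyperedge has at
-- most one vertex outside C, the matchings are counted by a Ryser-type formula
-- with B^|C| summands: with w_b(a) = (-1)^(b-a) C(b,a), so that Σ_a w_b(a) a^l
-- is 0 for l < b and b! for l = b, and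
--   p = Σ_{z : V → [0,B)} Π_v w_{b(v)}(z_v) Π_F Σ_{j<B} (Π_{v∈F} t z_v)^j,
-- expanding the product over F gives a sum over x : E → [0,B) of
-- Π_v t^(A x)_v Σ_a w_{b(v)}(a) a^(A x)_v, which vanishes when A x < b at some
-- vertex, is the constant D = Π_v t^b(v) b(v)! when A x = b, and is otherwise a
-- multiple of t^(Σb+1).  So N = (p mod t^(Σb+1)) / D for large t.  For fixed
-- values of z on C, the sum over the other vertices factors, since no hyperedge
-- involves two of them; all arithmetic is done modulo a power of two.
-- Such a C is a vertex cover of the graph in which two vertices are adjacent
-- when they share a hyperedge, and the complement of the largest part of a
-- k-partition is one with at most (1-1/k)|V| vertices.  A bounded search tree
-- (branch on the two ends of an uncovered pair) finds one of at most that size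
-- in 2^|C| attempts, without knowing k; when ‖b‖∞ = 0 any C will do.

open import Defs
open import Data.Bool using (Bool; true; false; if_then_else_; T; _∧_; not)
import Data.Bool.Properties as 𝔹ₚ
open import Data.Empty using (⊥-elim)
open import Data.Fin using (Fin; zero; suc; toℕ; fromℕ<)
open import Data.Fin.Properties using (+↔⊎; toℕ<n; toℕ-injective; toℕ-fromℕ<)
open import Data.Fin.Subset using (Subset; ∣_∣; _∩_) renaming (_∈_ to _∈ˢ_)
open import Data.Fin.Subset.Properties using (_∈?_; x∈p∩q⁺)
open import Data.Integer using (ℤ; -[1+_]; 0ℤ; 1ℤ; -1ℤ)
  renaming ( +_ to infix 9 ⁺_; _+_ to infixl 6 _⊕_; _*_ to infixl 7 _⊗_; _-_ to infixl 6 _⊖_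
           ; -_ to infix 8 ⊝_; _^_ to infixr 8 _↑_)
import Data.Integer.Properties as ℤₚ
import Data.Integer.Tactic.RingSolver as ℤ-solver
open import Data.List as List using (List; []; _∷_; length)
open import Data.List.Properties using (length-++; length-map; length-tabulate)
open import Data.List.Relation.Unary.All as All using (All; []; _∷_)
import Data.List.Relation.Unary.All.Properties as Allₚ
open import Data.Nat
open import Data.Nat.Divisibility using (divides)
open import Data.Nat.DivMod using
  ( m/n≤m; m%n<n; m≡m%n+[m/n]*n; m/n*n≤m; m/n/o≡m/[n*o]; m<n⇒m%n≡m; m<n⇒m/n≡0; [m+n]%n≡m%n; m/n≡1+[m∸n]/n; n/1≡n
  ; m*n/n≡m; [m+kn]%n≡m%n; 0/n≡0; +-distrib-/; +-distrib-/-∣ʳ; +-distrib-/-∣ˡ; m*n%n≡0; m<n*o⇒m/o<n)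
open import Data.Nat.Induction using (<-rec)
import Data.Nat.ListAction as ListAction
open import Data.Nat.Logarithm
open import Data.Nat.Properties
open import Data.Nat.Tactic.RingSolver using (solve-∀)
open import Data.Product using (Σ; _×_; _,_; proj₁; proj₂; Σ-syntax; ∃-syntax)
open import Data.Sum using (_⊎_; inj₁; inj₂)
open import Data.Sum.Function.Propositional using (_⊎-↔_)
open import Data.Unit using (tt)
open import Data.Vec as Vec using (Vec; []; _∷_; lookup; here; there; toList)
open import Data.Vec.Properties using (lookup-map; lookup∘tabulate; tabulate∘lookup; tabulate-∘; tabulate-cong; length-toList)
open import Function using (_∘_; Equivalence; mk↔ₛ′)
open import Function.Bundles using (_↔_)
open import Function.Properties.Inverse using (↔-trans; ↔-sym)
open import Relation.Binary.Definitions using (tri<; tri≈; tri>)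
open import Relation.Binary.PropositionalEquality hiding ([_])
open import Relation.Nullary using (yes; no; contradiction; does; ¬?; _×-dec_)
open import Relation.Nullary.Decidable using (dec-true)

-- Binary length

-- Finite differences annihilate only the loads that fall short of b somewhere. The tag t exists for
-- the others: a load that is nowhere short but exceeds b somewhere has a larger total, and is
-- recognised by its power of t. Both t and the modulus Q are powers of two so that t^(Σb+1) divides
-- Q, and a reduction modulo Q loses nothing that matters. The modulus answers to the cost model:
-- costs depend on bit lengths, and the machine has no negative numbers, so Q - 1 takes the place of
-- -1. Residues cannot be divided, compared or used as exponents; for quantities treated in this way
-- Q is so large that the reduction does nothing. Neither k nor a partition is known to the program,
-- and the search must be paid for as well. Each chosen vertex consumes one bit of a code s, so a
-- code yields at most log₂ s vertices; trying 1, 2, 3, ... makes the first success small without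
-- any comparison, and 2 ≤ B for nonzero b keeps the number of codes within the order of B^|C|. Time
-- and space polynomials are computed by recursion on the program text; their side conditions are
-- Boolean checks decided by evaluation.

n≤2^⌈log₂n⌉ : ∀ n → n ≤ 2 ^ ⌈log₂ n ⌉
n≤2^⌈log₂n⌉ = <-rec (λ n → n ≤ 2 ^ ⌈log₂ n ⌉) step
  where
  step : ∀ n → (∀ {m} → m < n → m ≤ 2 ^ ⌈log₂ m ⌉) → n ≤ 2 ^ ⌈log₂ n ⌉
  step zero          _   = z≤n
  step (suc zero)    _   = s≤s z≤n
  step (suc (suc n)) rec = begin
    suc (suc n)                        ≡⟨ cong (λ x → suc (suc x)) (⌊n/2⌋+⌈n/2⌉≡n n) ⟨
    suc (suc (⌊ n /2⌋ + ⌈ n /2⌉))      ≤⟨ s≤s (s≤s (+-monoˡ-≤ ⌈ n /2⌉ (⌊n/2⌋≤⌈n/2⌉ n))) ⟩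
    suc (suc (⌈ n /2⌉ + ⌈ n /2⌉))      ≡⟨ regroup ⌈ n /2⌉ ⟩
    2 * suc ⌈ n /2⌉                    ≤⟨ *-monoʳ-≤ 2 (rec {suc ⌈ n /2⌉} (⌈n/2⌉<n n)) ⟩
    2 * 2 ^ ⌈log₂ suc ⌈ n /2⌉ ⌉        ≡⟨ cong (2 ^_) (sym log-step) ⟩
    2 ^ ⌈log₂ suc (suc n) ⌉            ∎
    where
    open ≤-Reasoning
    regroup : ∀ m → suc (suc (m + m)) ≡ 2 * suc m
    regroup = solve-∀
    log-step : ⌈log₂ suc (suc n) ⌉ ≡ suc ⌈log₂ suc ⌈ n /2⌉ ⌉
    log-step rewrite ⌈log₂⌈n/2⌉⌉≡⌈log₂n⌉∸1 (suc (suc n)) = refl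

n<2^n : ∀ n → n < 2 ^ n
n<2^n zero    = s≤s z≤n
n<2^n (suc n) = ≤-trans (+-mono-≤ (m^n>0 2 n) (n<2^n n)) (+-monoʳ-≤ (2 ^ n) (m≤m+n (2 ^ n) 0))

n<2^bits : ∀ n → n < 2 ^ bits n
n<2^bits n = n≤2^⌈log₂n⌉ (suc n)

bits-≤ : ∀ {n m} → n < 2 ^ m → bits n ≤ m
bits-≤ {n} {m} n<2^m = subst (bits n ≤_) (⌈log₂2^n⌉≡n m) (⌈log₂⌉-mono-≤ n<2^m)

bits-mono : ∀ {m n} → m ≤ n → bits m ≤ bits n
bits-mono m≤n = ⌈log₂⌉-mono-≤ (s≤s m≤n)

bits-* : ∀ m n → bits (m * n) ≤ bits m + bits n
bits-* m n = bits-≤ {m * n} (subst (m * n <_) (sym (^-distribˡ-+-* 2 (bits m) (bits n)))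
  (*-mono-< (n<2^bits m) (n<2^bits n)))

bits-+ : ∀ m n → bits (m + n) ≤ 1 + (bits m + bits n)
bits-+ m n = bits-≤ {m + n} (begin-strict
  m + n                               <⟨ +-mono-< (n<2^bits m) (n<2^bits n) ⟩
  2 ^ bits m + 2 ^ bits n             ≤⟨ +-mono-≤ (^-monoʳ-≤ 2 (m≤m+n (bits m) (bits n)))
                                                  (^-monoʳ-≤ 2 (m≤n+m (bits n) (bits m))) ⟩
  2 ^ (bits m + bits n) + 2 ^ (bits m + bits n) ≡⟨ cong (2 ^ (bits m + bits n) +_) (+-identityʳ _) ⟨
  2 ^ (1 + (bits m + bits n))         ∎)
  where open ≤-Reasoning

-- Array cells

peek-poke-same : ∀ R i y → peek (poke R i y) i ≡ y
peek-poke-same []      zero    y = refl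
peek-poke-same []      (suc i) y = peek-poke-same [] i y
peek-poke-same (x ∷ R) zero    y = refl
peek-poke-same (x ∷ R) (suc i) y = peek-poke-same R i y

-- The cells with which `poke` fills a gap hold 0, and 0 is also what `peek` returned there before.
peek-poke-other : ∀ R i j y → j ≢ i → peek (poke R i y) j ≡ peek R j
peek-poke-other []      zero    zero    y j≢i = contradiction refl j≢i
peek-poke-other []      zero    (suc j) y j≢i = refl
peek-poke-other []      (suc i) zero    y j≢i = refl
peek-poke-other []      (suc i) (suc j) y j≢i = peek-poke-other [] i j y (j≢i ∘ cong suc)
peek-poke-other (x ∷ R) zero    zero    y j≢i = contradiction refl j≢i
peek-poke-other (x ∷ R) zero    (suc j) y j≢i = refl
peek-poke-other (x ∷ R) (suc i) zero    y j≢i = refl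
peek-poke-other (x ∷ R) (suc i) (suc j) y j≢i = peek-poke-other R i j y (j≢i ∘ cong suc)

peek-poke-all : ∀ (P : ℕ → Set) R i y → P y → (∀ j → P (peek R j)) → ∀ j → P (peek (poke R i y) j)
peek-poke-all P R i y py pR j with j ≟ i
... | yes refl = subst P (sym (peek-poke-same R i y)) py
... | no j≢i   = subst P (sym (peek-poke-other R i j y j≢i)) (pR j)

length-poke : ∀ R i y {L} → length R ≤ L → i < L → length (poke R i y) ≤ L
length-poke []      zero    y       _         i<L       = i<L
length-poke []      (suc i) y       _         (s≤s i<L) = s≤s (length-poke [] i y z≤n i<L)
length-poke (x ∷ R) zero    y       R≤L       _         = R≤L
length-poke (x ∷ R) (suc i) y       (s≤s R≤L) (s≤s i<L) = s≤s (length-poke R i y R≤L i<L)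

cells≤ : ∀ R M → (∀ i → peek R i < 2 ^ M) →
         ListAction.sum (List.map (λ x → 1 + bits x) R) ≤ length R * (1 + M)
cells≤ []      M small = z≤n
cells≤ (x ∷ R) M small = +-mono-≤ (s≤s (bits-≤ {x} (small 0))) (cells≤ R M (small ∘ suc))

-- mod x 0 = x.
mod : ℕ → ℕ → ℕ
mod x y = x ∸ apply div x y * y

mod-% : ∀ x y .{{_ : NonZero y}} → mod x y ≡ x % y
mod-% x y@(suc _) = trans (cong (_∸ x / y * y) (m≡m%n+[m/n]*n x y)) (m+n∸n≡m (x % y) (x / y * y))

mod-< : ∀ x y .{{_ : NonZero y}} → mod x y < y
mod-< x y = subst (_< y) (sym (mod-% x y)) (m%n<n x y)

mod-≤ : ∀ x y → mod x y ≤ x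
mod-≤ x y = m∸n≤m x (apply div x y * y)

apply-div-≤ : ∀ x y → apply div x y ≤ x
apply-div-≤ x zero    = z≤n
apply-div-≤ x (suc y) = m/n≤m x (suc y)

-- Lets `costP` bound the bit lengths of operands by their costs, so that intermediate values of an
-- expression need no bounds of their own; only the cells that are read do.
bits≤cost : ∀ {w} (e : Expr w) σ → bits (eval e σ) ≤ cost e σ
bits≤cost (lit n)       σ = n≤1+n _
bits≤cost (a [ e ])     σ = m≤n+m _ (1 + cost e σ)
bits≤cost (op o e e′) σ = ≤-trans (lemma o (eval e σ) (eval e′ σ)) (m≤n+m _ (cost e σ + cost e′ σ))
  where
  product : ∀ x y → 1 + (x + y) ≤ (1 + x) * (1 + y)
  product x y = subst (1 + (x + y) ≤_) (expand x y) (m≤m+n (1 + (x + y)) (x * y))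
    where
    expand : ∀ x y → 1 + (x + y) + x * y ≡ (1 + x) * (1 + y)
    expand = solve-∀
  left : ∀ x y → x ≤ (1 + x) * (1 + y)
  left x y = ≤-trans (≤-trans (m≤m+n x y) (n≤1+n _)) (product x y)
  lemma : ∀ o x y → bits (apply o x y) ≤ (1 + bits x) * (1 + bits y)
  lemma add x y = ≤-trans (bits-+ x y) (product (bits x) (bits y))
  lemma sub x y = ≤-trans (bits-mono (m∸n≤m x y)) (left (bits x) (bits y))
  lemma mul x y = ≤-trans (bits-* x y) (≤-trans (n≤1+n _) (product (bits x) (bits y)))
  lemma div x y = ≤-trans (bits-mono (apply-div-≤ x y)) (left (bits x) (bits y))

-- A language of bounded iterations, compiled to the machine

-- Variables are register addresses.  With d registers in use, the value of e
-- is in register d during the evaluation of e′ in `bind e e′` (and also in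
-- `bin o e e′` and `rem e e′`), and the body of `iter k a e` finds its
-- accumulator in register d and its loop index in register 1 + d.  The
-- accumulator is reduced modulo register 0 after every iteration, so that all
-- values have polynomially many bits.
data Tm : Set where
  lit  : ℕ → Tm
  var  : ℕ → Tm
  inp  : Tm → Tm
  bin  : Op → Tm → Tm → Tm
  rem  : Tm → Tm → Tm
  bind : Tm → Tm → Tm
  iter : Fin 5 → Tm → Tm → Tm

counter : Fin 5 → ℕ
counter k = suc (toℕ k)

loop : (Q : ℕ) → ℕ → ℕ → (ℕ → ℕ → ℕ) → ℕ
loop Q zero    a f = mod a Q
loop Q (suc n) a f = mod (f n (loop Q n a f)) Q

loop-< : ∀ {Q} n a f .{{_ : NonZero Q}} → loop Q n a f < Q
loop-< {Q} zero    a f = mod-< a Q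
loop-< {Q} (suc n) a f = mod-< (f n (loop Q n a f)) Q

module Semantics (I : List ℕ) (κ : Fin 5 → ℕ) (Q : ℕ) where

  ⟪_⟫ : Tm → ℕ → List ℕ → ℕ
  ⟪ lit n      ⟫ d ρ = n
  ⟪ var l      ⟫ d ρ = peek ρ l
  ⟪ inp e      ⟫ d ρ = peek I (⟪ e ⟫ d ρ)
  ⟪ bin o e e′ ⟫ d ρ = apply o (⟪ e ⟫ d ρ) (⟪ e′ ⟫ (suc d) (poke ρ d (⟪ e ⟫ d ρ)))
  ⟪ rem e e′   ⟫ d ρ = mod (⟪ e ⟫ d ρ) (⟪ e′ ⟫ (suc d) (poke ρ d (⟪ e ⟫ d ρ)))
  ⟪ bind e e′  ⟫ d ρ = ⟪ e′ ⟫ (suc d) (poke ρ d (⟪ e ⟫ d ρ))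
  ⟪ iter k a e ⟫ d ρ = loop Q (κ k) (⟪ a ⟫ d ρ)
    (λ i x → ⟪ e ⟫ (2 + d) (poke (poke ρ d x) (suc d) i))

reg : ℕ → Expr 2
reg l = suc zero [ lit l ]

set : ℕ → Expr 2 → Cmd 2
set l e = suc zero [ lit l ]≔ e

modE : Expr 2 → Expr 2 → Expr 2
modE e e′ = op sub e (op mul (op div e e′) e′)

counting : Fin 5 → ℕ → Expr 2
counting k d = op sub (reg (counter k)) (reg (suc d))

-- The value of e ends up in register d; higher registers are clobbered.
compile : ℕ → Tm → Cmd 2
compile d (lit n)      = set d (lit n)
compile d (var l)      = set d (reg l)
compile d (inp e)      = compile d e ⨾ set d (zero [ reg d ])
compile d (bin o e e′) = compile d e ⨾ compile (suc d) e′ ⨾ set d (op o (reg d) (reg (suc d)))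
compile d (rem e e′)   = compile d e ⨾ compile (suc d) e′ ⨾ set d (modE (reg d) (reg (suc d)))
compile d (bind e e′)  = compile d e ⨾ compile (suc d) e′ ⨾ set d (reg (suc d))
compile d (iter k a e) =
  compile d a ⨾ set d (modE (reg d) (reg 0)) ⨾ set (suc d) (lit 0) ⨾
  while (counting k d)
    (compile (2 + d) e ⨾ set d (modE (reg (2 + d)) (reg 0)) ⨾ set (suc d) (op add (reg (suc d)) (lit 1)))

-- Values are at most Q ^ degree when the inputs are at most Q and the variable
-- in register l is at most Q ^ δ l.
degree : ℕ → List ℕ → Tm → ℕ
degree d δ (lit n)        = n
degree d δ (var l)        = peek δ l
degree d δ (inp e)        = 1
degree d δ (bin add e e′) = 1 + (degree d δ e + degree (suc d) (poke δ d (degree d δ e)) e′)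
degree d δ (bin sub e e′) = degree d δ e
degree d δ (bin mul e e′) = degree d δ e + degree (suc d) (poke δ d (degree d δ e)) e′
degree d δ (bin div e e′) = degree d δ e
degree d δ (rem e e′)     = degree d δ e
degree d δ (bind e e′)    = degree (suc d) (poke δ d (degree d δ e)) e′
degree d δ (iter k a e)   = 1

-- `EP` is the binary logarithm of the modulus Q and `cntP` bounds the loop counts, as polynomials
-- in the three parameters; `D` bounds the degrees of all values and `L` the register numbers.
-- Nothing here depends on the input, so one polynomial serves for all inputs.
module Static (EP : Poly 3) (cntP : Fin 5 → Poly 3) (D L : ℕ) where

  -- Bit length of a cell: `D` factors Q, and one more bit because a value may equal Q ^ D.
  MP : Poly 3
  MP = con 1 :+ EP :* con D

  costP : Expr 2 → Poly 3
  costP (lit n)     = con (1 + bits n)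
  costP (a [ e ])   = con 1 :+ costP e :+ MP
  costP (op o e e′) = costP e :+ costP e′ :+ (con 1 :+ costP e) :* (con 1 :+ costP e′)

  setP : ℕ → Expr 2 → Poly 3
  setP l e = con 1 :+ (costP (lit l) :+ costP e)

  timeP : ℕ → Tm → Poly 3
  timeP d (lit n)      = setP d (lit n)
  timeP d (var l)      = setP d (reg l)
  timeP d (inp e)      = timeP d e :+ setP d (zero [ reg d ])
  timeP d (bin o e e′) = timeP d e :+ (timeP (suc d) e′ :+ setP d (op o (reg d) (reg (suc d))))
  timeP d (rem e e′)   = timeP d e :+ (timeP (suc d) e′ :+ setP d (modE (reg d) (reg (suc d))))
  timeP d (bind e e′)  = timeP d e :+ (timeP (suc d) e′ :+ setP d (reg (suc d)))
  timeP d (iter k a e) =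
    timeP d a :+ (setP d (modE (reg d) (reg 0)) :+ (setP (suc d) (lit 0) :+
    (con 1 :+ cntP k) :* (con 1 :+ costP (counting k d) :+
      (timeP (2 + d) e :+ (setP d (modE (reg (2 + d)) (reg 0)) :+ setP (suc d) (op add (reg (suc d)) (lit 1)))))))

  -- The test on `suc d` is there because operators and loops write that register besides register
  -- `d`.
  fits : ℕ → List ℕ → Tm → Bool
  fits d δ e = (degree d δ e ≤ᵇ D) ∧ (suc d <ᵇ L)

  -- On a closed term `T (valid …)` computes to the unit type, so that `tt` proves it. A variable
  -- must lie below `d`, since only these registers are preserved. A loop body is checked with
  -- degree 1 for accumulator and index, both being at most Q.
  valid : ℕ → List ℕ → Tm → Bool
  valid d δ (lit n)        = fits d δ (lit n)
  valid d δ (var l)        = fits d δ (var l) ∧ (l <ᵇ d)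
  valid d δ (inp e)        = fits d δ (inp e) ∧ valid d δ e
  valid d δ (bin o e e′)   = fits d δ (bin o e e′) ∧ (valid d δ e ∧ valid (suc d) (poke δ d (degree d δ e)) e′)
  valid d δ (rem e e′)     = fits d δ (rem e e′) ∧ (valid d δ e ∧ valid (suc d) (poke δ d (degree d δ e)) e′)
  valid d δ (bind e e′)    = fits d δ (bind e e′) ∧ (valid d δ e ∧ valid (suc d) (poke δ d (degree d δ e)) e′)
  valid d δ (iter k a e)   = fits d δ (iter k a e) ∧ (valid d δ a ∧ valid (2 + d) (poke (poke δ d 1) (suc d) 1) e)

  -- Execution of compiled terms within the static bounds

  module Dynamic (I : List ℕ) (π : Vec ℕ 3) (κ : Fin 5 → ℕ)
                 (κ-small : ∀ k → κ k ≤ ⟦ cntP k ⟧ π)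
                 (κ≤Q : ∀ k → κ k ≤ 2 ^ ⟦ EP ⟧ π)
                 (I≤Q : ∀ i → peek I i ≤ 2 ^ ⟦ EP ⟧ π)
                 (E≥1 : 1 ≤ ⟦ EP ⟧ π) (D≥1 : 1 ≤ D) where

    M : ℕ
    M = ⟦ MP ⟧ π

    Q : ℕ
    Q = 2 ^ ⟦ EP ⟧ π

    instance
      Q≢0 : NonZero Q
      Q≢0 = m^n≢0 2 (⟦ EP ⟧ π)

    open Semantics I κ Q public

    ≤Q^D⇒<2^M : ∀ {x n} → x ≤ Q ^ n → n ≤ D → x < 2 ^ M
    ≤Q^D⇒<2^M {x} {n} x≤ n≤D = begin-strict
      x                           ≤⟨ x≤ ⟩
      Q ^ n                       ≤⟨ ^-monoʳ-≤ Q n≤D ⟩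
      Q ^ D                       ≡⟨ ^-*-assoc 2 (⟦ EP ⟧ π) D ⟩
      2 ^ (⟦ EP ⟧ π * D)          <⟨ ^-monoʳ-< 2 (s≤s (s≤s z≤n)) (n<1+n (⟦ EP ⟧ π * D)) ⟩
      2 ^ M                       ∎
      where open ≤-Reasoning

    ≤Q⇒<2^M : ∀ {x} → x ≤ Q → x < 2 ^ M
    ≤Q⇒<2^M {x} x≤Q = ≤Q^D⇒<2^M {n = 1} (subst (x ≤_) (sym (^-identityʳ Q)) x≤Q) D≥1

    ⟨_⟩ : List ℕ → Store 2
    ⟨ R ⟩ = I ∷ R ∷ []

    record Good (R : List ℕ) : Set where
      constructor good
      field
        short : length R ≤ L
        small : ∀ i → peek R i < 2 ^ M
    open Good public

    space₀ : ℕ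
    space₀ = (length I + L) * (1 + M)

    space≤ : ∀ {R} → Good R → space ⟨ R ⟩ ≤ space₀
    space≤ {R} g = begin
      space ⟨ R ⟩                                    ≡⟨ cong (cells I +_) (+-identityʳ (cells R)) ⟩
      cells I + cells R                              ≤⟨ +-mono-≤ (cells≤ I M (λ i → ≤Q⇒<2^M (I≤Q i)))
                                                                 (cells≤ R M (small g)) ⟩
      length I * (1 + M) + length R * (1 + M)        ≤⟨ +-monoʳ-≤ (length I * (1 + M)) (*-monoˡ-≤ (1 + M) (short g)) ⟩
      length I * (1 + M) + L * (1 + M)               ≡⟨ *-distribʳ-+ (1 + M) (length I) L ⟨
      space₀                                         ∎
      where
      open ≤-Reasoning
      cells : List ℕ → ℕ
      cells = λ a → ListAction.sum (List.map (λ x → 1 + bits x) a)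

    cost≤ : ∀ {R} → Good R → ∀ e → cost e ⟨ R ⟩ ≤ ⟦ costP e ⟧ π
    cost≤ g (lit n)     = ≤-refl
    cost≤ {R} g (a [ e ]) = +-mono-≤ (s≤s (cost≤ g e)) (bits-≤ {eval (a [ e ]) ⟨ R ⟩} (cell a))
      where
      cell : ∀ a → peek (lookup ⟨ R ⟩ a) (eval e ⟨ R ⟩) < 2 ^ M
      cell zero       = ≤Q⇒<2^M (I≤Q _)
      cell (suc zero) = small g _
    cost≤ {R} g (op o e e′) = +-mono-≤ (+-mono-≤ (cost≤ g e) (cost≤ g e′))
      (*-mono-≤ (s≤s (≤-trans (bits≤cost e ⟨ R ⟩) (cost≤ g e)))
                (s≤s (≤-trans (bits≤cost e′ ⟨ R ⟩) (cost≤ g e′))))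

    -- Peak space is a maximum, but its excess over `space₀`, the bound for all good stores, is
    -- allowed to add up under composition. The same polynomial can then serve for the time and for
    -- the excess space of a compiled term.
    Exec : Cmd 2 → List ℕ → List ℕ → (t s : ℕ) → Set
    Exec c R R′ t s = Σ[ t′ ∈ ℕ ] Σ[ s′ ∈ ℕ ]
      Run c ⟨ R ⟩ ⟨ R′ ⟩ t′ s′ × t′ ≤ t × s′ ≤ space₀ + s

    exec-set : ∀ {R l} e → Good R → l < L → eval e ⟨ R ⟩ < 2 ^ M →
               let R′ = poke R l (eval e ⟨ R ⟩)
               in Exec (set l e) R R′ (⟦ setP l e ⟧ π) (⟦ setP l e ⟧ π) × Good R′
    exec-set {R} {l} e g l<L v< =
      (_ , _ , assign , s≤s cost-both
             , ⊔-lub (≤-trans (+-mono-≤ (space≤ g) cost-both) (+-monoʳ-≤ space₀ (n≤1+n _)))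
                     (≤-trans (space≤ g′) (m≤m+n space₀ _)))
      , g′
      where
      cost-both = +-mono-≤ (cost≤ g (lit l)) (cost≤ g e)
      g′ : Good (poke R l (eval e ⟨ R ⟩))
      g′ = good (length-poke R l _ (short g) l<L)
                (peek-poke-all (_< 2 ^ M) R l _ v< (small g))

    exec-⨾ : ∀ {c c′ R R′ R″ t t′ s s′} → Exec c R R′ t s → Exec c′ R′ R″ t′ s′ →
             Exec (c ⨾ c′) R R″ (t + t′) (s + s′)
    exec-⨾ {s = s} {s′} (_ , _ , run , t≤ , s≤) (_ , _ , run′ , t≤′ , s≤′) =
      _ , _ , seq run run′ , +-mono-≤ t≤ t≤′
        , ⊔-lub (≤-trans s≤ (+-monoʳ-≤ space₀ (m≤m+n s s′)))
                (≤-trans s≤′ (+-monoʳ-≤ space₀ (m≤n+m s′ s)))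

    -- Each pass starts again from a good store, so only the time is multiplied by the number of
    -- passes. This is why exponentially many passes are compatible with polynomial space.
    exec-while : ∀ (Inv : ℕ → List ℕ → Set) g c N tb sb →
      (∀ {i R} → Inv i R → Good R) →
      (∀ {i R} → i < N → Inv i R → NonZero (eval g ⟨ R ⟩) × Σ[ R′ ∈ _ ] Exec c R R′ tb sb × Inv (suc i) R′) →
      (∀ {R} → Inv N R → eval g ⟨ R ⟩ ≡ 0) →
      ∀ {R} → Inv 0 R →
      Σ[ R′ ∈ _ ] Exec (while g c) R R′ (suc N * (1 + ⟦ costP g ⟧ π + tb)) (1 + ⟦ costP g ⟧ π + sb) × Inv N R′
    exec-while Inv g c N tb sb inv-good body done inv = go N 0 refl inv
      where
      cg = ⟦ costP g ⟧ π
      go : ∀ j i → i + j ≡ N → ∀ {R} → Inv i R →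
           Σ[ R′ ∈ _ ] Exec (while g c) R R′ (suc j * (1 + cg + tb)) (1 + cg + sb) × Inv N R′
      go zero i i+0≡N {R} inv with trans (sym (+-identityʳ i)) i+0≡N
      ... | refl = R , (_ , _ , while-false (done inv)
                       , ≤-trans (s≤s (cost≤ (inv-good inv) g)) (≤-trans (m≤m+n (1 + cg) tb) (m≤m+n (1 + cg + tb) 0))
                       , +-mono-≤ (space≤ (inv-good inv))
                           (≤-trans (cost≤ (inv-good inv) g) (≤-trans (n≤1+n cg) (m≤m+n (1 + cg) sb))))
                     , inv
      go (suc j) i i+j≡N {R} inv
        with body (subst (i <_) i+j≡N (m<m+n i (s≤s z≤n))) inv
      ... | nz , R′ , (t , s , run , t≤ , s≤) , inv′
        with go j (suc i) (trans (sym (+-suc i j)) i+j≡N) inv′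
      ... | R″ , (t′ , s′ , run′ , t≤′ , s≤′) , inv″ =
        R″ , (_ , _ , while-true nz run run′
             , +-mono-≤ (+-mono-≤ (s≤s (cost≤ (inv-good inv) g)) t≤) t≤′
             , ⊔-lub (⊔-lub
                 (+-mono-≤ (space≤ (inv-good inv))
                   (≤-trans (cost≤ (inv-good inv) g) (≤-trans (n≤1+n cg) (m≤m+n (1 + cg) sb))))
                 (≤-trans s≤ (+-monoʳ-≤ space₀ (m≤n+m sb (1 + cg)))))
                 s≤′)
           , inv″

    -- Registers from `d` on are scratch space, about which nothing is promised.
    record Agree (d : ℕ) (ρ R : List ℕ) : Set where
      constructor agrees
      field at : ∀ l → l < d → peek R l ≡ peek ρ l
    open Agree public

    agree-snoc : ∀ {d ρ R x} → Agree d ρ R → peek R d ≡ x → Agree (suc d) (poke ρ d x) R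
    agree-snoc {d} {ρ} {R} {x} agree Rd≡x .at l l<1+d with l ≟ d
    ... | yes refl = trans Rd≡x (sym (peek-poke-same ρ d x))
    ... | no l≢d   = trans (agree .at l (≤∧≢⇒< (s≤s⁻¹ l<1+d) l≢d)) (sym (peek-poke-other ρ d l x l≢d))

    agree-init : ∀ {d ρ R x} → Agree (suc d) (poke ρ d x) R → Agree d ρ R
    agree-init {d} {ρ} {R} {x} agree .at l l<d =
      trans (agree .at l (m<n⇒m<1+n l<d)) (peek-poke-other ρ d l x (<⇒≢ l<d))

    agree-last : ∀ {d ρ R x} → Agree (suc d) (poke ρ d x) R → peek R d ≡ x
    agree-last {d} {ρ} {R} {x} agree = trans (agree .at d (n<1+n d)) (peek-poke-same ρ d x)

    agree-poke : ∀ {d ρ R x l} → d ≤ l → Agree d ρ R → Agree d ρ (poke R l x)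
    agree-poke {d} {ρ} {R} {x} {l} d≤l agree .at l′ l′<d =
      trans (peek-poke-other R l l′ x (<⇒≢ (<-≤-trans l′<d d≤l))) (agree .at l′ l′<d)

    -- Registers 0 to 5 hold the modulus and the five loop counts; as `d` is at least 6, binding a
    -- variable never overwrites them.
    record Env (d : ℕ) (δ ρ : List ℕ) : Set where
      constructor env
      field
        deep    : 6 ≤ d
        bounded : ∀ l → peek ρ l ≤ Q ^ peek δ l
        modulus : peek ρ 0 ≡ Q
        counts  : ∀ k → peek ρ (counter k) ≡ κ k
    open Env public

    counter<6 : ∀ k → counter k < 6
    counter<6 k = s≤s (toℕ<n k)

    env-poke : ∀ {d δ ρ n x} → x ≤ Q ^ n → Env d δ ρ → Env (suc d) (poke δ d n) (poke ρ d x)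
    env-poke {d} {δ} {ρ} {n} {x} x≤ v = env
      (m≤n⇒m≤1+n (deep v))
      bound
      (trans (peek-poke-other ρ d 0 x (<⇒≢ (≤-trans (s≤s z≤n) (deep v)))) (modulus v))
      (λ k → trans (peek-poke-other ρ d (counter k) x (<⇒≢ (≤-trans (counter<6 k) (deep v)))) (counts v k))
      where
      bound : ∀ l → peek (poke ρ d x) l ≤ Q ^ peek (poke δ d n) l
      bound l with l ≟ d
      ... | yes refl rewrite peek-poke-same ρ d x | peek-poke-same δ d n = x≤
      ... | no l≢d rewrite peek-poke-other ρ d l x l≢d | peek-poke-other δ d l n l≢d = bounded v l

    Q≥2 : 2 ≤ Q
    Q≥2 = ^-monoʳ-≤ 2 E≥1

    -- Justifies the crude degree n of the literal n, which is good enough because all literals of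
    -- the program are tiny.
    n≤Q^n : ∀ n → n ≤ Q ^ n
    n≤Q^n n = ≤-trans (<⇒≤ (n<2^n n)) (^-monoˡ-≤ n Q≥2)

    ≤Q⇒≤Q^1 : ∀ {x} → x ≤ Q → x ≤ Q ^ 1
    ≤Q⇒≤Q^1 {x} = subst (x ≤_) (sym (^-identityʳ Q))

    -- The factor 2 of a sum is absorbed by one more power of Q. A loop has degree 1 whatever its
    -- body does, since its result has been reduced modulo Q; nesting loops therefore does not
    -- enlarge numbers.
    value≤ : ∀ e {d δ ρ} → Env d δ ρ → ⟪ e ⟫ d ρ ≤ Q ^ degree d δ e
    value≤ (lit n)        v = n≤Q^n n
    value≤ (var l)        v = bounded v l
    value≤ (inp e)        v = ≤Q⇒≤Q^1 (I≤Q _)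
    value≤ (bin add e e′) {d} {δ} {ρ} v = begin
      x + y                                     ≤⟨ +-mono-≤ (value≤ e v) (value≤ e′ (env-poke (value≤ e v) v)) ⟩
      Q ^ a + Q ^ b                             ≤⟨ +-mono-≤ (^-monoʳ-≤ Q (m≤m+n a b)) (^-monoʳ-≤ Q (m≤n+m b a)) ⟩
      Q ^ (a + b) + Q ^ (a + b)                 ≡⟨ cong (Q ^ (a + b) +_) (+-identityʳ (Q ^ (a + b))) ⟨
      2 * Q ^ (a + b)                           ≤⟨ *-monoˡ-≤ (Q ^ (a + b)) Q≥2 ⟩
      Q ^ (1 + (a + b))                         ∎
      where
      open ≤-Reasoning
      x = ⟪ e ⟫ d ρ
      y = ⟪ e′ ⟫ (suc d) (poke ρ d x)
      a = degree d δ e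
      b = degree (suc d) (poke δ d a) e′
    value≤ (bin sub e e′) v = ≤-trans (m∸n≤m (⟪ e ⟫ _ _) (⟪ e′ ⟫ _ _)) (value≤ e v)
    value≤ (bin mul e e′) {d} {δ} v =
      subst (_ ≤_) (sym (^-distribˡ-+-* Q (degree d δ e) _))
        (*-mono-≤ (value≤ e v) (value≤ e′ (env-poke (value≤ e v) v)))
    value≤ (bin div e e′) v = ≤-trans (apply-div-≤ (⟪ e ⟫ _ _) (⟪ e′ ⟫ _ _)) (value≤ e v)
    value≤ (rem e e′)     v = ≤-trans (mod-≤ (⟪ e ⟫ _ _) (⟪ e′ ⟫ _ _)) (value≤ e v)
    value≤ (bind e e′)    v = value≤ e′ (env-poke (value≤ e v) v)
    value≤ (iter k a e) {d} {δ} {ρ} v = ≤Q⇒≤Q^1 (<⇒≤ (loop-< (κ k) (⟪ a ⟫ d ρ) _))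

    split : ∀ {a b} → T (a ∧ b) → T a × T b
    split {a} = Equivalence.to (𝔹ₚ.T-∧ {a})

    fits-value : ∀ e {d δ ρ} → T (fits d δ e) → Env d δ ρ → ⟪ e ⟫ d ρ < 2 ^ M
    fits-value e {d} {δ} f v =
      ≤Q^D⇒<2^M (value≤ e v) (≤ᵇ⇒≤ (degree d δ e) D (proj₁ (split f)))

    fits-depth : ∀ e {d δ} → T (fits d δ e) → suc d < L
    fits-depth e {d} {δ} f = <ᵇ⇒< (suc d) L (proj₂ (split {degree d δ e ≤ᵇ D} f))

    record Computed (c : Cmd 2) (t : Poly 3) (d : ℕ) (ρ R : List ℕ) (x : ℕ) : Set where
      constructor computed
      field
        {registers} : List ℕ
        execution   : Exec c R registers (⟦ t ⟧ π) (⟦ t ⟧ π)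
        regular     : Good registers
        outer       : Agree d ρ registers
        result      : peek registers d ≡ x
    open Computed public

    exec-set-top : ∀ {d ρ R x} e → Good R → Agree d ρ R → d < L → x < 2 ^ M → eval e ⟨ R ⟩ ≡ x →
                   Computed (set d e) (setP d e) d ρ R x
    exec-set-top {d} {R = R} e g agree d<L x< value =
      computed (proj₁ done) (proj₂ done) (agree-poke ≤-refl agree) (trans (peek-poke-same R d _) value)
      where done = exec-set e g d<L (subst (_< 2 ^ M) (sym value) x<)

    chain : ∀ {c c′ t t′ d d′ ρ ρ′ R x y} → Computed c t d′ ρ′ R x →
      (∀ {R′} → Good R′ → Agree d′ ρ′ R′ → peek R′ d′ ≡ x → Computed c′ t′ d ρ R′ y) →
      Computed (c ⨾ c′) (t :+ t′) d ρ R y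
    chain first next = computed (exec-⨾ (execution first) (execution second)) (regular second) (outer second) (result second)
      where second = next (regular first) (outer first) (result first)

    module Iteration (k : Fin 5) (e : Tm) {d δ ρ} (v : Env d δ ρ) (1+d<L : suc d < L) (a₀ : ℕ)
      (body : ∀ {ρ′ R} → Env (2 + d) (poke (poke δ d 1) (suc d) 1) ρ′ → Agree (2 + d) ρ′ R → Good R →
              Computed (compile (2 + d) e) (timeP (2 + d) e) (2 + d) ρ′ R (⟪ e ⟫ (2 + d) ρ′)) where

      N = κ k

      f : ℕ → ℕ → ℕ
      f i x = ⟪ e ⟫ (2 + d) (poke (poke ρ d x) (suc d) i)

      accumulated : ℕ → ℕ
      accumulated i = loop Q i a₀ f

      state : ℕ → List ℕ
      state i = poke (poke ρ d (accumulated i)) (suc d) i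

      record Inv (i : ℕ) (R : List ℕ) : Set where
        constructor inv
        field
          inv-good    : Good R
          inv-outer   : Agree d ρ R
          accumulator : peek R d ≡ accumulated i
          index       : peek R (suc d) ≡ i
      open Inv

      inner : ∀ {i R} → Inv i R → Agree (2 + d) (state i) R
      inner h = agree-snoc (agree-snoc (inv-outer h) (accumulator h)) (index h)

      guard : ∀ {i R} → Inv i R → eval (counting k d) ⟨ R ⟩ ≡ N ∸ i
      guard h = cong₂ _∸_ (trans (inv-outer h .at (counter k) (≤-trans (counter<6 k) (deep v))) (counts v k)) (index h)

      reduced : ∀ i → accumulated i < 2 ^ M
      reduced i = ≤Q⇒<2^M (<⇒≤ (loop-< i a₀ f))

      register₀ : ∀ {R} → Agree d ρ R → peek R 0 ≡ Q
      register₀ agree = trans (agree .at 0 (≤-trans (s≤s z≤n) (deep v))) (modulus v)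

      stepC : Cmd 2
      stepC = compile (2 + d) e ⨾ set d (modE (reg (2 + d)) (reg 0)) ⨾ set (suc d) (op add (reg (suc d)) (lit 1))

      stepP : Poly 3
      stepP = timeP (2 + d) e :+ (setP d (modE (reg (2 + d)) (reg 0)) :+ setP (suc d) (op add (reg (suc d)) (lit 1)))

      module Step {i R} (i<N : i < N) (h : Inv i R) where
        env′ : Env (2 + d) (poke (poke δ d 1) (suc d) 1) (state i)
        env′ = env-poke (≤Q⇒≤Q^1 (≤-trans (<⇒≤ i<N) (κ≤Q k))) (env-poke (≤Q⇒≤Q^1 (<⇒≤ (loop-< i a₀ f))) v)

        step₁ : Computed (compile (2 + d) e) (timeP (2 + d) e) (2 + d) (state i) R (f i (accumulated i))
        step₁ = body env′ (inner h) (inv-good h)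

        outer₁ : Agree d ρ (registers step₁)
        outer₁ = agree-init (agree-init (outer step₁))

        step₂ : Computed (set d (modE (reg (2 + d)) (reg 0))) (setP d (modE (reg (2 + d)) (reg 0)))
                         d ρ (registers step₁) (accumulated (suc i))
        step₂ = exec-set-top (modE (reg (2 + d)) (reg 0)) (regular step₁) outer₁ (<⇒≤ 1+d<L) (reduced (suc i))
                  (cong₂ mod (result step₁) (register₀ outer₁))

        next : peek (registers step₂) (suc d) + 1 ≡ suc i
        next = trans (+-comm _ 1) (cong suc (trans (peek-poke-other (registers step₁) d (suc d) _ 1+n≢n) (agree-last (outer step₁))))

        step₃ : Computed (set (suc d) (op add (reg (suc d)) (lit 1))) (setP (suc d) (op add (reg (suc d)) (lit 1)))
                         (suc d) (poke ρ d (accumulated (suc i))) (registers step₂) (suc i)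
        step₃ = exec-set-top (op add (reg (suc d)) (lit 1)) (regular step₂) (agree-snoc (outer step₂) (result step₂))
                  1+d<L (≤Q⇒<2^M (≤-trans i<N (κ≤Q k))) next

        step : NonZero (eval (counting k d) ⟨ R ⟩) × Σ[ R′ ∈ List ℕ ] Exec stepC R R′ (⟦ stepP ⟧ π) (⟦ stepP ⟧ π) × Inv (suc i) R′
        step = subst NonZero (sym (guard h)) (>-nonZero (m<n⇒0<n∸m i<N))
             , registers step₃
             , exec-⨾ (execution step₁) (exec-⨾ (execution step₂) (execution step₃))
             , inv (regular step₃) (agree-init (outer step₃)) (agree-last (outer step₃)) (result step₃)

      iterationP : Poly 3
      iterationP = (con 1 :+ cntP k) :* (con 1 :+ costP (counting k d) :+ stepP)

      iterate : ∀ {R} → Inv 0 R → Computed (while (counting k d) stepC) iterationP d ρ R (accumulated N)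
      iterate h₀ =
        let (R′ , (t , s , run , t≤ , s≤) , h) =
              exec-while Inv (counting k d) stepC N (⟦ stepP ⟧ π) (⟦ stepP ⟧ π) inv-good (λ i<N h → Step.step i<N h)
                (λ h → trans (guard h) (n∸n≡0 N)) h₀
        in computed (t , s , run
                , ≤-trans t≤ (*-monoˡ-≤ (1 + ⟦ costP (counting k d) ⟧ π + ⟦ stepP ⟧ π) (s≤s (κ-small k)))
                , ≤-trans s≤ (+-monoʳ-≤ space₀ (m≤m+n (1 + ⟦ costP (counting k d) ⟧ π + ⟦ stepP ⟧ π) _)))
              (inv-good h) (inv-outer h) (accumulator h)

    exec-compile : ∀ e {d δ ρ R} → T (valid d δ e) → Env d δ ρ → Agree d ρ R → Good R →
                   Computed (compile d e) (timeP d e) d ρ R (⟪ e ⟫ d ρ)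

    -- Operators, remainders and bindings all compute a second value one register above the first;
    -- they differ only in the closing assignment `x`.
    exec-binary : ∀ e e′ (x : Expr 2) {y d δ ρ R} →
      suc d < L → y < 2 ^ M → T (valid d δ e) → T (valid (suc d) (poke δ d (degree d δ e)) e′) →
      Env d δ ρ → Agree d ρ R → Good R →
      (∀ R′ → peek R′ d ≡ ⟪ e ⟫ d ρ → peek R′ (suc d) ≡ ⟪ e′ ⟫ (suc d) (poke ρ d (⟪ e ⟫ d ρ)) → eval x ⟨ R′ ⟩ ≡ y) →
      Computed (compile d e ⨾ compile (suc d) e′ ⨾ set d x) (timeP d e :+ (timeP (suc d) e′ :+ setP d x)) d ρ R y
    exec-binary e e′ x depth y< ok ok′ v agree g value =
      chain (exec-compile e ok v agree g) λ g₁ agree₁ R₁d →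
      chain (exec-compile e′ ok′ (env-poke (value≤ e v) v) (agree-snoc agree₁ R₁d) g₁) λ g₂ agree₂ R₂1+d →
      exec-set-top x g₂ (agree-init agree₂) (<⇒≤ depth) y< (value _ (agree-last agree₂) R₂1+d)

    exec-compile (lit n) {d} {δ} ok v agree g =
      exec-set-top (lit n) g agree (<⇒≤ (fits-depth (lit n) {d} {δ} ok)) (fits-value (lit n) ok v) refl
    exec-compile (var l) {d} {δ} ok v agree g =
      let (fit , l<d) = split {fits d δ (var l)} ok in
      exec-set-top (reg l) g agree (<⇒≤ (fits-depth (var l) {d} {δ} fit)) (fits-value (var l) fit v) (agree .at l (<ᵇ⇒< l d l<d))
    exec-compile (inp e) {d} {δ} ok v agree g =
      let (fit , ok₁) = split {fits d δ (inp e)} ok in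
      chain (exec-compile e ok₁ v agree g) λ g₁ agree₁ R₁d →
      exec-set-top (zero [ reg d ]) g₁ agree₁ (<⇒≤ (fits-depth (inp e) {d} {δ} fit)) (fits-value (inp e) fit v) (cong (peek I) R₁d)
    exec-compile (bin o e e′) {d} {δ} ok v agree g =
      let (fit , ok₁) = split {fits d δ (bin o e e′)} ok
          (ok₂ , ok₃) = split {valid d δ e} ok₁ in
      exec-binary e e′ (op o (reg d) (reg (suc d))) (fits-depth (bin o e e′) {d} {δ} fit)
        (fits-value (bin o e e′) fit v) ok₂ ok₃ v agree g (λ _ → cong₂ (apply o))
    exec-compile (rem e e′) {d} {δ} ok v agree g =
      let (fit , ok₁) = split {fits d δ (rem e e′)} ok
          (ok₂ , ok₃) = split {valid d δ e} ok₁ in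
      exec-binary e e′ (modE (reg d) (reg (suc d))) (fits-depth (rem e e′) {d} {δ} fit)
        (fits-value (rem e e′) fit v) ok₂ ok₃ v agree g (λ _ → cong₂ mod)
    exec-compile (bind e e′) {d} {δ} ok v agree g =
      let (fit , ok₁) = split {fits d δ (bind e e′)} ok
          (ok₂ , ok₃) = split {valid d δ e} ok₁ in
      exec-binary e e′ (reg (suc d)) (fits-depth (bind e e′) {d} {δ} fit)
        (fits-value (bind e e′) fit v) ok₂ ok₃ v agree g (λ _ _ value → value)
    exec-compile (iter k a e) {d} {δ} {ρ} ok v agree g =
      let (fit , ok₁) = split {fits d δ (iter k a e)} ok
          (ok₂ , ok₃) = split {valid d δ a} ok₁
          1+d<L = fits-depth (iter k a e) {d} {δ} fit
          open Iteration k e v 1+d<L (⟪ a ⟫ d ρ) (exec-compile e ok₃) in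
      chain (exec-compile a ok₂ v agree g) λ g₁ agree₁ R₁d →
      chain (exec-set-top (modE (reg d) (reg 0)) g₁ agree₁ (<⇒≤ 1+d<L) (reduced 0) (cong₂ mod R₁d (register₀ agree₁))) λ g₂ agree₂ R₂d →
      chain (exec-set-top (lit 0) g₂ (agree-snoc agree₂ R₂d) 1+d<L (m^n>0 2 M) refl) λ g₃ agree₃ R₃d →
      iterate (inv g₃ (agree-init agree₃) (agree-last agree₃) R₃d)

-- Finite sums and products

∑ : ℕ → (ℕ → ℤ) → ℤ
∑ zero    f = 0ℤ
∑ (suc n) f = f 0 ⊕ ∑ n (f ∘ suc)

∏ : ℕ → (ℕ → ℤ) → ℤ
∏ zero    f = 1ℤ
∏ (suc n) f = f 0 ⊗ ∏ n (f ∘ suc)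

∑-last : ∀ n f → ∑ (suc n) f ≡ ∑ n f ⊕ f n
∑-last zero    f = ℤₚ.+-comm (f 0) 0ℤ
∑-last (suc n) f = trans (cong (f 0 ⊕_) (∑-last n (f ∘ suc))) (sym (ℤₚ.+-assoc (f 0) _ _))

∏-last : ∀ n f → ∏ (suc n) f ≡ ∏ n f ⊗ f n
∏-last zero    f = ℤₚ.*-comm (f 0) 1ℤ
∏-last (suc n) f = trans (cong (f 0 ⊗_) (∏-last n (f ∘ suc))) (sym (ℤₚ.*-assoc (f 0) _ _))

∑-cong : ∀ n {f g} → (∀ i → i < n → f i ≡ g i) → ∑ n f ≡ ∑ n g
∑-cong zero    f≡g = refl
∑-cong (suc n) f≡g = cong₂ _⊕_ (f≡g 0 z<s) (∑-cong n (λ i i<n → f≡g (suc i) (s<s i<n)))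

∏-cong : ∀ n {f g} → (∀ i → i < n → f i ≡ g i) → ∏ n f ≡ ∏ n g
∏-cong zero    f≡g = refl
∏-cong (suc n) f≡g = cong₂ _⊗_ (f≡g 0 z<s) (∏-cong n (λ i i<n → f≡g (suc i) (s<s i<n)))

∑-zero : ∀ n → ∑ n (λ _ → 0ℤ) ≡ 0ℤ
∑-zero zero    = refl
∑-zero (suc n) = trans (ℤₚ.+-identityˡ _) (∑-zero n)

∏-one : ∀ n → ∏ n (λ _ → 1ℤ) ≡ 1ℤ
∏-one zero    = refl
∏-one (suc n) = trans (ℤₚ.*-identityˡ _) (∏-one n)

interchange⊕ : ∀ a b c d → (a ⊕ b) ⊕ (c ⊕ d) ≡ (a ⊕ c) ⊕ (b ⊕ d)
interchange⊕ = ℤ-solver.solve-∀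

interchange⊗ : ∀ a b c d → (a ⊗ b) ⊗ (c ⊗ d) ≡ (a ⊗ c) ⊗ (b ⊗ d)
interchange⊗ = ℤ-solver.solve-∀

∑-⊕ : ∀ n f g → ∑ n (λ i → f i ⊕ g i) ≡ ∑ n f ⊕ ∑ n g
∑-⊕ zero    f g = refl
∑-⊕ (suc n) f g = trans (cong (f 0 ⊕ g 0 ⊕_) (∑-⊕ n (f ∘ suc) (g ∘ suc))) (interchange⊕ (f 0) (g 0) _ _)

∏-⊗ : ∀ n f g → ∏ n (λ i → f i ⊗ g i) ≡ ∏ n f ⊗ ∏ n g
∏-⊗ zero    f g = refl
∏-⊗ (suc n) f g = trans (cong (f 0 ⊗ g 0 ⊗_) (∏-⊗ n (f ∘ suc) (g ∘ suc))) (interchange⊗ (f 0) (g 0) _ _)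

∑-⊗ˡ : ∀ n c f → ∑ n (λ i → c ⊗ f i) ≡ c ⊗ ∑ n f
∑-⊗ˡ zero    c f = sym (ℤₚ.*-zeroʳ c)
∑-⊗ˡ (suc n) c f = trans (cong (c ⊗ f 0 ⊕_) (∑-⊗ˡ n c (f ∘ suc))) (sym (ℤₚ.*-distribˡ-+ c (f 0) _))

∑-⊗ʳ : ∀ n c f → ∑ n (λ i → f i ⊗ c) ≡ ∑ n f ⊗ c
∑-⊗ʳ n c f = trans (∑-cong n (λ i _ → ℤₚ.*-comm (f i) c)) (trans (∑-⊗ˡ n c f) (ℤₚ.*-comm c _))

∑-swap : ∀ m n (f : ℕ → ℕ → ℤ) → ∑ m (λ i → ∑ n (f i)) ≡ ∑ n (λ j → ∑ m (λ i → f i j))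
∑-swap zero    n f = sym (∑-zero n)
∑-swap (suc m) n f = trans (cong (∑ n (f 0) ⊕_) (∑-swap m n (f ∘ suc))) (sym (∑-⊕ n (f 0) _))

∏-swap : ∀ m n (f : ℕ → ℕ → ℤ) → ∏ m (λ i → ∏ n (f i)) ≡ ∏ n (λ j → ∏ m (λ i → f i j))
∏-swap zero    n f = sym (∏-one n)
∏-swap (suc m) n f = trans (cong (∏ n (f 0) ⊗_) (∏-swap m n (f ∘ suc))) (sym (∏-⊗ n (f 0) _))

∑-split : ∀ m n f → ∑ (m + n) f ≡ ∑ m f ⊕ ∑ n (λ i → f (m + i))
∑-split zero    n f = sym (ℤₚ.+-identityˡ _)
∑-split (suc m) n f = trans (cong (f 0 ⊕_) (∑-split m n (f ∘ suc))) (sym (ℤₚ.+-assoc (f 0) _ _))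

∏-zero : ∀ n f i → i < n → f i ≡ 0ℤ → ∏ n f ≡ 0ℤ
∏-zero (suc n) f zero    i<n       fi≡0 = trans (cong (_⊗ ∏ n (f ∘ suc)) fi≡0) refl
∏-zero (suc n) f (suc i) (s≤s i<n) fi≡0 = trans (cong (f 0 ⊗_) (∏-zero n (f ∘ suc) i i<n fi≡0)) (ℤₚ.*-zeroʳ (f 0))

[_]₀₁ : Bool → ℤ
[ true  ]₀₁ = 1ℤ
[ false ]₀₁ = 0ℤ

∑-select : ∀ n (f : ℕ → ℤ) j → j < n → ∑ n (λ i → [ i ≡ᵇ j ]₀₁ ⊗ f i) ≡ f j
∑-select (suc n) f zero    _         = trans (cong₂ _⊕_ (ℤₚ.*-identityˡ (f 0)) (∑-zero n)) (ℤₚ.+-identityʳ (f 0))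
∑-select (suc n) f (suc j) (s≤s j<n) = trans (ℤₚ.+-identityˡ _) (∑-select n (f ∘ suc) j j<n)

-- Sums over all vectors of length n with entries below B

∑ⱽ : ℕ → ℕ → (List ℕ → ℤ) → ℤ
∑ⱽ zero    B f = f []
∑ⱽ (suc n) B f = ∑ B (λ a → ∑ⱽ n B (λ y → f (a ∷ y)))

data Box (B : ℕ) : ℕ → List ℕ → Set where
  []  : Box B 0 []
  _∷_ : ∀ {n a y} → a < B → Box B n y → Box B (suc n) (a ∷ y)

box-peek : ∀ {B n y} → Box B n y → ∀ v → v < n → peek y v < B
box-peek (a<B ∷ _) zero    _         = a<B
box-peek (_ ∷ box) (suc v) (s≤s v<n) = box-peek box v v<n

∑ⱽ-cong : ∀ n B {f g} → (∀ y → Box B n y → f y ≡ g y) → ∑ⱽ n B f ≡ ∑ⱽ n B g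
∑ⱽ-cong zero    B f≡g = f≡g [] []
∑ⱽ-cong (suc n) B f≡g = ∑-cong B (λ a a<B → ∑ⱽ-cong n B (λ y box → f≡g (a ∷ y) (a<B ∷ box)))

∑ⱽ-⊗ˡ : ∀ n B c f → ∑ⱽ n B (λ y → c ⊗ f y) ≡ c ⊗ ∑ⱽ n B f
∑ⱽ-⊗ˡ zero    B c f = refl
∑ⱽ-⊗ˡ (suc n) B c f = trans (∑-cong B (λ a _ → ∑ⱽ-⊗ˡ n B c (λ y → f (a ∷ y)))) (∑-⊗ˡ B c _)

∑ⱽ-⊕ : ∀ n B f g → ∑ⱽ n B (λ y → f y ⊕ g y) ≡ ∑ⱽ n B f ⊕ ∑ⱽ n B g
∑ⱽ-⊕ zero    B f g = refl
∑ⱽ-⊕ (suc n) B f g = trans (∑-cong B (λ a _ → ∑ⱽ-⊕ n B (λ y → f (a ∷ y)) (λ y → g (a ∷ y)))) (∑-⊕ B _ _)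

∑-∑ⱽ-swap : ∀ k n B (f : ℕ → List ℕ → ℤ) → ∑ k (λ i → ∑ⱽ n B (f i)) ≡ ∑ⱽ n B (λ y → ∑ k (λ i → f i y))
∑-∑ⱽ-swap k zero    B f = refl
∑-∑ⱽ-swap k (suc n) B f = trans (∑-swap k B _) (∑-cong B (λ a _ → ∑-∑ⱽ-swap k n B (λ i y → f i (a ∷ y))))

∑ⱽ-swap : ∀ m n B (f : List ℕ → List ℕ → ℤ) → ∑ⱽ m B (λ x → ∑ⱽ n B (f x)) ≡ ∑ⱽ n B (λ y → ∑ⱽ m B (λ x → f x y))
∑ⱽ-swap zero    n B f = refl
∑ⱽ-swap (suc m) n B f = trans (∑-cong B (λ a _ → ∑ⱽ-swap m n B (λ x → f (a ∷ x)))) (∑-∑ⱽ-swap B n B _)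

-- Used in both directions: expanding over the hyperedges creates the sum over x, and contracting
-- over the vertices turns the sum over z into a product of moments.
∏-∑ : ∀ n B (g : ℕ → ℕ → ℤ) → ∏ n (λ v → ∑ B (g v)) ≡ ∑ⱽ n B (λ y → ∏ n (λ v → g v (peek y v)))
∏-∑ zero    B g = refl
∏-∑ (suc n) B g = trans (sym (∑-⊗ʳ B _ (g 0))) (∑-cong B (λ a _ →
  trans (cong (g 0 a ⊗_) (∏-∑ n B (g ∘ suc))) (sym (∑ⱽ-⊗ˡ n B (g 0 a) _))))

-- Signed binomial coefficients: weight b a = (-1)^(b-a) C(b,a), so that
-- Σ_a weight b a f(a) is the b-th finite difference of f at 0.

weight : ℕ → ℕ → ℤ
weight zero    zero    = 1ℤ
weight zero    (suc a) = 0ℤ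
weight (suc b) zero    = ⊝ weight b zero
weight (suc b) (suc a) = weight b a ⊖ weight b (suc a)

weight-> : ∀ b a → b < a → weight b a ≡ 0ℤ
weight-> zero    (suc a) _         = refl
weight-> (suc b) (suc a) (s≤s b<a) rewrite weight-> b a b<a | weight-> b (suc a) (m<n⇒m<1+n b<a) = refl

-- By the recursion for `weight`, the bracket on the right is weight b (a - 1), so this is the
-- absorption identity a C(b+1,a) = (b+1) C(b,a-1), written without a predecessor so that it also
-- makes sense at a = 0.
weight-absorb : ∀ b a → ⁺ a ⊗ weight (suc b) a ≡ ⁺ suc b ⊗ (weight (suc b) a ⊕ weight b a)
weight-absorb b zero = sym (trans (cong (⁺ suc b ⊗_) (ℤₚ.+-inverseˡ (weight b 0))) (ℤₚ.*-zeroʳ (⁺ suc b)))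
weight-absorb zero (suc zero)    = refl
weight-absorb zero (suc (suc a)) = ℤₚ.*-zeroʳ (⁺ suc (suc a))
weight-absorb (suc b) (suc a) = absorb (⁺ a) (⁺ b) (weight (suc b) a) (weight b a) (weight b (suc a))
  (weight-absorb b a) (weight-absorb b (suc a))
  where
  absorb : ∀ a b p q r → a ⊗ p ≡ (1ℤ ⊕ b) ⊗ (p ⊕ q) →
           (1ℤ ⊕ a) ⊗ (q ⊖ r) ≡ (1ℤ ⊕ b) ⊗ (q ⊖ r ⊕ r) →
           (1ℤ ⊕ a) ⊗ (p ⊖ (q ⊖ r)) ≡ (1ℤ ⊕ (1ℤ ⊕ b)) ⊗ (p ⊖ (q ⊖ r) ⊕ (q ⊖ r))
  absorb a b p q r e₁ e₂ = begin
    (1ℤ ⊕ a) ⊗ (p ⊖ (q ⊖ r))                                  ≡⟨ expand a p q r ⟩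
    p ⊕ a ⊗ p ⊖ (1ℤ ⊕ a) ⊗ (q ⊖ r)                            ≡⟨ cong₂ (λ x y → p ⊕ x ⊖ y) e₁ e₂ ⟩
    p ⊕ (1ℤ ⊕ b) ⊗ (p ⊕ q) ⊖ (1ℤ ⊕ b) ⊗ (q ⊖ r ⊕ r)           ≡⟨ collect b p q r ⟩
    (1ℤ ⊕ (1ℤ ⊕ b)) ⊗ (p ⊖ (q ⊖ r) ⊕ (q ⊖ r))                 ∎
    where
    open ≡-Reasoning
    expand : ∀ a p q r → (1ℤ ⊕ a) ⊗ (p ⊖ (q ⊖ r)) ≡ p ⊕ a ⊗ p ⊖ (1ℤ ⊕ a) ⊗ (q ⊖ r)
    expand = ℤ-solver.solve-∀
    collect : ∀ b p q r → p ⊕ (1ℤ ⊕ b) ⊗ (p ⊕ q) ⊖ (1ℤ ⊕ b) ⊗ (q ⊖ r ⊕ r) ≡ (1ℤ ⊕ (1ℤ ⊕ b)) ⊗ (p ⊖ (q ⊖ r) ⊕ (q ⊖ r))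
    collect = ℤ-solver.solve-∀

moment : ℕ → ℕ → ℕ → ℤ
moment B b l = ∑ B (λ a → weight b a ⊗ (⁺ a) ↑ l)

-- The recurrence for the number of surjections from an l-set onto a b-set, which `moment B b l`
-- equals when b < B; the cut-off at `B` does not disturb the recurrence itself.
moment-suc : ∀ B b l → moment B (suc b) (suc l) ≡ ⁺ suc b ⊗ (moment B (suc b) l ⊕ moment B b l)
moment-suc B b l = begin
  ∑ B (λ a → weight (suc b) a ⊗ (⁺ a ⊗ (⁺ a) ↑ l))
    ≡⟨ ∑-cong B (λ a _ → trans (rotate (weight (suc b) a) (⁺ a) ((⁺ a) ↑ l))
         (trans (cong (_⊗ (⁺ a) ↑ l) (weight-absorb b a)) (spread (⁺ suc b) (weight (suc b) a) (weight b a) ((⁺ a) ↑ l)))) ⟩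
  ∑ B (λ a → ⁺ suc b ⊗ (weight (suc b) a ⊗ (⁺ a) ↑ l ⊕ weight b a ⊗ (⁺ a) ↑ l))
    ≡⟨ ∑-⊗ˡ B (⁺ suc b) _ ⟩
  ⁺ suc b ⊗ ∑ B (λ a → weight (suc b) a ⊗ (⁺ a) ↑ l ⊕ weight b a ⊗ (⁺ a) ↑ l)
    ≡⟨ cong (⁺ suc b ⊗_) (∑-⊕ B _ _) ⟩
  ⁺ suc b ⊗ (moment B (suc b) l ⊕ moment B b l) ∎
  where
  open ≡-Reasoning
  rotate : ∀ w a p → w ⊗ (a ⊗ p) ≡ (a ⊗ w) ⊗ p
  rotate = ℤ-solver.solve-∀
  spread : ∀ c v w p → c ⊗ (v ⊕ w) ⊗ p ≡ c ⊗ (v ⊗ p ⊕ w ⊗ p)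
  spread = ℤ-solver.solve-∀

-- Partial alternating sums along a row of Pascal's triangle telescope to an entry of the row above,
-- and this entry lies beyond the end of that row.
∑-weight : ∀ b B → suc b < B → ∑ B (weight (suc b)) ≡ 0ℤ
∑-weight b (suc B) (s≤s b<B) = trans (telescope B) (cong ⊝_ (weight-> b B b<B))
  where
  telescope : ∀ B → ∑ (suc B) (weight (suc b)) ≡ ⊝ weight b B
  telescope zero    = ℤₚ.+-identityʳ _
  telescope (suc B) = trans (∑-last (suc B) (weight (suc b))) (trans (cong (_⊕ weight (suc b) (suc B)) (telescope B)) (cancel (weight b B) (weight b (suc B))))
    where
    cancel : ∀ p q → ⊝ p ⊕ (p ⊖ q) ≡ ⊝ q
    cancel = ℤ-solver.solve-∀

moment-< : ∀ B b l → b < B → l < b → moment B b l ≡ 0ℤ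
moment-< B (suc b) zero    b<B _ = trans (∑-cong B (λ a _ → ℤₚ.*-identityʳ _)) (∑-weight b B b<B)
moment-< B (suc b) (suc l) b<B (s≤s l<b) = trans (moment-suc B b l) (trans
  (cong (⁺ suc b ⊗_) (cong₂ _⊕_ (moment-< B (suc b) l b<B (m<n⇒m<1+n l<b)) (moment-< B b l (<-trans (n<1+n b) b<B) l<b)))
  (ℤₚ.*-zeroʳ (⁺ suc b)))

moment-≡ : ∀ B b → b < B → moment B b b ≡ ⁺ (b !)
moment-≡ (suc B) zero _ = cong (1ℤ ⊕_) (trans (∑-cong B (λ a _ → refl)) (∑-zero B))
moment-≡ B (suc b) b<B = begin
  moment B (suc b) (suc b)                          ≡⟨ moment-suc B b b ⟩
  ⁺ suc b ⊗ (moment B (suc b) b ⊕ moment B b b)     ≡⟨ cong (⁺ suc b ⊗_) (cong₂ _⊕_ (moment-< B (suc b) b b<B (n<1+n b)) (moment-≡ B b (<-trans (n<1+n b) b<B))) ⟩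
  ⁺ suc b ⊗ (0ℤ ⊕ ⁺ (b !))                          ≡⟨ cong (⁺ suc b ⊗_) (ℤₚ.+-identityˡ (⁺ (b !))) ⟩
  ⁺ suc b ⊗ ⁺ (b !)                                 ≡⟨ ℤₚ.pos-* (suc b) (b !) ⟨
  ⁺ (suc b !)                                       ∎
  where open ≡-Reasoning

-- Counting vectors by a Boolean predicate, and powers of products

sumℕ : ℕ → (ℕ → ℕ) → ℕ
sumℕ zero    f = 0
sumℕ (suc n) f = f 0 + sumℕ n (f ∘ suc)

allᵇ : ℕ → (ℕ → Bool) → Bool
allᵇ zero    q = true
allᵇ (suc n) q = q 0 ∧ allᵇ n (q ∘ suc)

countⱽ : ℕ → ℕ → (List ℕ → Bool) → ℕ
countⱽ zero    B q = if q [] then 1 else 0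
countⱽ (suc n) B q = sumℕ B (λ a → countⱽ n B (λ y → q (a ∷ y)))

∑-pos : ∀ n f → ∑ n (λ i → ⁺ f i) ≡ ⁺ sumℕ n f
∑-pos zero    f = refl
∑-pos (suc n) f = trans (cong (⁺ f 0 ⊕_) (∑-pos n (f ∘ suc))) (sym (ℤₚ.pos-+ (f 0) _))

∑ⱽ-count : ∀ n B q → ∑ⱽ n B (λ y → [ q y ]₀₁) ≡ ⁺ countⱽ n B q
∑ⱽ-count zero B q with q []
... | true  = refl
... | false = refl
∑ⱽ-count (suc n) B q = trans (∑-cong B (λ a _ → ∑ⱽ-count n B (λ y → q (a ∷ y)))) (∑-pos B _)

⊗-↑ : ∀ a b n → (a ⊗ b) ↑ n ≡ a ↑ n ⊗ b ↑ n
⊗-↑ a b zero    = refl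
⊗-↑ a b (suc n) = trans (cong (a ⊗ b ⊗_) (⊗-↑ a b n)) (interchange⊗ a b (a ↑ n) (b ↑ n))

∏-↑ : ∀ n f k → ∏ n f ↑ k ≡ ∏ n (λ i → f i ↑ k)
∏-↑ zero    f k = ℤₚ.^-zeroˡ k
∏-↑ (suc n) f k = trans (⊗-↑ (f 0) _ k) (cong (f 0 ↑ k ⊗_) (∏-↑ n (f ∘ suc) k))

∏-exponents : ∀ n a e → ∏ n (λ i → a ↑ e i) ≡ a ↑ sumℕ n e
∏-exponents zero    a e = refl
∏-exponents (suc n) a e = trans (cong (a ↑ e 0 ⊗_) (∏-exponents n a (e ∘ suc))) (sym (ℤₚ.^-distribˡ-+-* a (e 0) _))

≡ᵇ-refl : ∀ n → (n ≡ᵇ n) ≡ true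
≡ᵇ-refl zero    = refl
≡ᵇ-refl (suc n) = ≡ᵇ-refl n

≢⇒≡ᵇ-false : ∀ m n → m ≢ n → (m ≡ᵇ n) ≡ false
≢⇒≡ᵇ-false zero    zero    m≢n = contradiction refl m≢n
≢⇒≡ᵇ-false zero    (suc n) m≢n = refl
≢⇒≡ᵇ-false (suc m) zero    m≢n = refl
≢⇒≡ᵇ-false (suc m) (suc n) m≢n = ≢⇒≡ᵇ-false m n (m≢n ∘ cong suc)

-- A Ryser-type formula

module Ryser (B : ℕ) (t : ℤ) where

  -- The finite differences annihilate all loads l with some l v < b v, and
  -- the remaining ones other than b itself have larger total.
  term : ℕ → (b l : ℕ → ℕ) → ℤ
  term n b l = ∏ n (λ v → t ↑ l v ⊗ moment B (b v) (l v))

  denominator : ℕ → (ℕ → ℕ) → ℤ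
  denominator n b = ∏ n (λ v → t ↑ b v ⊗ ⁺ (b v !))

  agree : ℕ → (b l : ℕ → ℕ) → Bool
  agree n b l = allᵇ n (λ v → l v ≡ᵇ b v)

  denominator-factor : ∀ n b → denominator n b ≡ t ↑ sumℕ n b ⊗ ∏ n (λ v → ⁺ (b v !))
  denominator-factor n b = trans (∏-⊗ n (λ v → t ↑ b v) (λ v → ⁺ (b v !))) (cong (_⊗ ∏ n (λ v → ⁺ (b v !))) (∏-exponents n t b))

  data Outcome (n : ℕ) (b l : ℕ → ℕ) : Set where
    vanishes : agree n b l ≡ false → term n b l ≡ 0ℤ → Outcome n b l
    matches  : agree n b l ≡ true → term n b l ≡ denominator n b → Outcome n b l
    exceeds  : agree n b l ≡ false → ∀ r → term n b l ≡ t ↑ suc (sumℕ n b) ⊗ r → Outcome n b l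

  -- A single coordinate below its demand makes the product zero. If there is none, the powers of t
  -- multiply to at least t ^ Σb, with a further factor t as soon as one coordinate is larger.
  outcome : ∀ n b l → (∀ v → v < n → b v < B) → Outcome n b l
  outcome zero    b l b<B = matches refl refl
  outcome (suc n) b l b<B with <-cmp (l 0) (b 0) | outcome n (b ∘ suc) (l ∘ suc) (λ v v<n → b<B (suc v) (s<s v<n))
  ... | tri< l<b l≢b _ | _ = vanishes
    (cong (_∧ agree n (b ∘ suc) (l ∘ suc)) (≢⇒≡ᵇ-false (l 0) (b 0) l≢b))
    (trans (cong (_⊗ term n (b ∘ suc) (l ∘ suc)) (trans (cong (t ↑ l 0 ⊗_) (moment-< B (b 0) (l 0) (b<B 0 z<s) l<b)) (ℤₚ.*-zeroʳ (t ↑ l 0)))) refl)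
  ... | tri≈ _ l≡b _ | vanishes differ eq = vanishes
    (trans (cong₂ _∧_ (trans (cong (_≡ᵇ b 0) l≡b) (≡ᵇ-refl (b 0))) differ) refl)
    (trans (cong (t ↑ l 0 ⊗ moment B (b 0) (l 0) ⊗_) eq) (ℤₚ.*-zeroʳ (t ↑ l 0 ⊗ moment B (b 0) (l 0))))
  ... | tri≈ _ l≡b _ | matches ok eq = matches
    (trans (cong₂ _∧_ (trans (cong (_≡ᵇ b 0) l≡b) (≡ᵇ-refl (b 0))) ok) refl)
    (cong₂ _⊗_ (trans (cong (λ x → t ↑ x ⊗ moment B (b 0) x) l≡b) (cong (t ↑ b 0 ⊗_) (moment-≡ B (b 0) (b<B 0 z<s)))) eq)
  ... | tri≈ _ l≡b _ | exceeds differ r eq = exceeds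
    (trans (cong₂ _∧_ (trans (cong (_≡ᵇ b 0) l≡b) (≡ᵇ-refl (b 0))) differ) refl)
    (moment B (b 0) (l 0) ⊗ r)
    (trans (cong (t ↑ l 0 ⊗ moment B (b 0) (l 0) ⊗_) eq)
    (trans (cong (λ x → t ↑ x ⊗ moment B (b 0) (l 0) ⊗ (t ⊗ t ↑ sumℕ n (b ∘ suc) ⊗ r)) l≡b)
    (trans (regroup (t ↑ b 0) (moment B (b 0) (l 0)) t (t ↑ sumℕ n (b ∘ suc)) r)
           (cong (λ x → t ⊗ x ⊗ (moment B (b 0) (l 0) ⊗ r)) (sym (ℤₚ.^-distribˡ-+-* t (b 0) (sumℕ n (b ∘ suc))))))))
    where
    regroup : ∀ p q t s r → p ⊗ q ⊗ (t ⊗ s ⊗ r) ≡ t ⊗ (p ⊗ s) ⊗ (q ⊗ r)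
    regroup = ℤ-solver.solve-∀
  ... | tri> _ l≢b b<l | tail = finish tail
    where
    open ≡-Reasoning
    unequal : agree (suc n) b l ≡ false
    unequal = cong (_∧ agree n (b ∘ suc) (l ∘ suc)) (≢⇒≡ᵇ-false (l 0) (b 0) l≢b)
    rest = term n (b ∘ suc) (l ∘ suc)
    s = sumℕ n (b ∘ suc)
    μ = moment B (b 0) (l 0)
    regroup : ∀ t p q μ s r → t ⊗ p ⊗ q ⊗ μ ⊗ (s ⊗ r) ≡ t ⊗ (p ⊗ s) ⊗ (q ⊗ μ ⊗ r)
    regroup = ℤ-solver.solve-∀
    excess : ∀ r → rest ≡ t ↑ s ⊗ r → Outcome (suc n) b l
    excess r eq = exceeds unequal (t ↑ (l 0 ∸ suc (b 0)) ⊗ μ ⊗ r) (begin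
      t ↑ l 0 ⊗ μ ⊗ rest                                         ≡⟨ cong₂ (λ x y → x ⊗ μ ⊗ y) (trans (cong (t ↑_) (sym (m+[n∸m]≡n b<l))) (ℤₚ.^-distribˡ-+-* t (suc (b 0)) (l 0 ∸ suc (b 0)))) eq ⟩
      t ⊗ t ↑ b 0 ⊗ t ↑ (l 0 ∸ suc (b 0)) ⊗ μ ⊗ (t ↑ s ⊗ r)      ≡⟨ regroup t (t ↑ b 0) (t ↑ (l 0 ∸ suc (b 0))) μ (t ↑ s) r ⟩
      t ⊗ (t ↑ b 0 ⊗ t ↑ s) ⊗ (t ↑ (l 0 ∸ suc (b 0)) ⊗ μ ⊗ r)    ≡⟨ cong (λ x → t ⊗ x ⊗ (t ↑ (l 0 ∸ suc (b 0)) ⊗ μ ⊗ r)) (ℤₚ.^-distribˡ-+-* t (b 0) s) ⟨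
      t ↑ suc (b 0 + s) ⊗ (t ↑ (l 0 ∸ suc (b 0)) ⊗ μ ⊗ r)        ∎)
    finish : Outcome n (b ∘ suc) (l ∘ suc) → Outcome (suc n) b l
    finish (vanishes _ eq)  = vanishes unequal (trans (cong (t ↑ l 0 ⊗ μ ⊗_) eq) (ℤₚ.*-zeroʳ (t ↑ l 0 ⊗ μ)))
    finish (matches _ eq)   = excess _ (trans eq (denominator-factor n (b ∘ suc)))
    -- The tail already has a surplus factor t, which is moved into the cofactor.
    finish (exceeds _ r eq) = excess (t ⊗ r) (trans eq (swap t (t ↑ s) r))
      where
      swap : ∀ t s r → t ⊗ s ⊗ r ≡ s ⊗ (t ⊗ r)
      swap = ℤ-solver.solve-∀

  -- Merges the three outcomes into one congruence modulo t ^ (Σb + 1), a form that can be summed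
  -- over all x.
  term-mod : ∀ n b l → (∀ v → v < n → b v < B) →
    Σ[ r ∈ ℤ ] term n b l ≡ denominator n b ⊗ [ agree n b l ]₀₁ ⊕ t ↑ suc (sumℕ n b) ⊗ r
  term-mod n b l b<B with outcome n b l b<B
  ... | vanishes differ eq rewrite differ = 0ℤ , trans eq (sym (cong₂ _⊕_ (ℤₚ.*-zeroʳ (denominator n b)) (ℤₚ.*-zeroʳ (t ↑ suc (sumℕ n b)))))
  ... | matches ok eq rewrite ok = 0ℤ , trans eq (sym (trans (cong₂ _⊕_ (ℤₚ.*-identityʳ (denominator n b)) (ℤₚ.*-zeroʳ (t ↑ suc (sumℕ n b)))) (ℤₚ.+-identityʳ _)))
  ... | exceeds differ r eq rewrite differ = r , trans eq (sym (trans (cong (_⊕ t ↑ suc (sumℕ n b) ⊗ r) (ℤₚ.*-zeroʳ (denominator n b))) (ℤₚ.+-identityˡ _)))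

  module Formula (n m : ℕ) (A : ℕ → ℕ → ℕ) (b : ℕ → ℕ) (b<B : ∀ v → v < n → b v < B) where

    degrees : List ℕ → ℕ → ℕ
    degrees x v = sumℕ m (λ F → A F v * peek x F)

    -- The incidence entry serves as an exponent, so that vertices outside the hyperedge contribute
    -- 1.
    monomial : (ℕ → ℕ) → ℕ → ℤ
    monomial z F = ∏ n (λ v → (t ⊗ ⁺ z v) ↑ A F v)

    geometric : (ℕ → ℕ) → ℕ → ℤ
    geometric z F = ∑ B (λ j → monomial z F ↑ j)

    weights : (ℕ → ℕ) → ℤ
    weights z = ∏ n (λ v → weight (b v) (z v))

    ryser : ℤ
    ryser = ∑ⱽ n B (λ z → weights (peek z) ⊗ ∏ m (geometric (peek z)))

    geometric-expand : ∀ z → ∏ m (geometric z) ≡ ∑ⱽ m B (λ x → ∏ n (λ v → (t ⊗ ⁺ z v) ↑ degrees x v))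
    geometric-expand z = begin
      ∏ m (λ F → ∑ B (λ j → monomial z F ↑ j))
        ≡⟨ ∏-∑ m B (λ F j → monomial z F ↑ j) ⟩
      ∑ⱽ m B (λ x → ∏ m (λ F → monomial z F ↑ peek x F))
        ≡⟨ ∑ⱽ-cong m B (λ x _ → monomials x) ⟩
      ∑ⱽ m B (λ x → ∏ n (λ v → (t ⊗ ⁺ z v) ↑ degrees x v)) ∎
      where
      open ≡-Reasoning
      monomials : ∀ x → ∏ m (λ F → monomial z F ↑ peek x F) ≡ ∏ n (λ v → (t ⊗ ⁺ z v) ↑ degrees x v)
      monomials x = begin
        ∏ m (λ F → monomial z F ↑ peek x F)
          ≡⟨ ∏-cong m (λ F _ → trans (∏-↑ n _ (peek x F)) (∏-cong n (λ v _ → ℤₚ.^-*-assoc (t ⊗ ⁺ z v) (A F v) (peek x F)))) ⟩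
        ∏ m (λ F → ∏ n (λ v → (t ⊗ ⁺ z v) ↑ (A F v * peek x F)))
          ≡⟨ ∏-swap m n (λ F v → (t ⊗ ⁺ z v) ↑ (A F v * peek x F)) ⟩
        ∏ n (λ v → ∏ m (λ F → (t ⊗ ⁺ z v) ↑ (A F v * peek x F)))
          ≡⟨ ∏-cong n (λ v _ → ∏-exponents m (t ⊗ ⁺ z v) (λ F → A F v * peek x F)) ⟩
        ∏ n (λ v → (t ⊗ ⁺ z v) ↑ degrees x v) ∎

    -- After exchanging the sums over z and x, the sum over z for a fixed x factors over the
    -- vertices, and each factor is a moment times a power of t.
    ryser-terms : ryser ≡ ∑ⱽ m B (λ x → term n b (degrees x))
    ryser-terms = begin
      ∑ⱽ n B (λ z → weights (peek z) ⊗ ∏ m (geometric (peek z)))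
        ≡⟨ ∑ⱽ-cong n B (λ z _ → trans (cong (weights (peek z) ⊗_) (geometric-expand (peek z))) (sym (∑ⱽ-⊗ˡ m B (weights (peek z)) _))) ⟩
      ∑ⱽ n B (λ z → ∑ⱽ m B (λ x → weights (peek z) ⊗ ∏ n (λ v → (t ⊗ ⁺ peek z v) ↑ degrees x v)))
        ≡⟨ ∑ⱽ-swap n m B (λ z x → weights (peek z) ⊗ ∏ n (λ v → (t ⊗ ⁺ peek z v) ↑ degrees x v)) ⟩
      ∑ⱽ m B (λ x → ∑ⱽ n B (λ z → weights (peek z) ⊗ ∏ n (λ v → (t ⊗ ⁺ peek z v) ↑ degrees x v)))
        ≡⟨ ∑ⱽ-cong m B (λ x _ → collect x) ⟩
      ∑ⱽ m B (λ x → term n b (degrees x)) ∎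
      where
      open ≡-Reasoning
      pull : ∀ w t a → w ⊗ (t ⊗ a) ≡ t ⊗ (w ⊗ a)
      pull = ℤ-solver.solve-∀
      collect : ∀ x → ∑ⱽ n B (λ z → weights (peek z) ⊗ ∏ n (λ v → (t ⊗ ⁺ peek z v) ↑ degrees x v)) ≡ term n b (degrees x)
      collect x = begin
        ∑ⱽ n B (λ z → weights (peek z) ⊗ ∏ n (λ v → (t ⊗ ⁺ peek z v) ↑ degrees x v))
          ≡⟨ ∑ⱽ-cong n B (λ z _ → sym (∏-⊗ n (λ v → weight (b v) (peek z v)) _)) ⟩
        ∑ⱽ n B (λ z → ∏ n (λ v → weight (b v) (peek z v) ⊗ (t ⊗ ⁺ peek z v) ↑ degrees x v))
          ≡⟨ ∏-∑ n B (λ v a → weight (b v) a ⊗ (t ⊗ ⁺ a) ↑ degrees x v) ⟨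
        ∏ n (λ v → ∑ B (λ a → weight (b v) a ⊗ (t ⊗ ⁺ a) ↑ degrees x v))
          ≡⟨ ∏-cong n (λ v _ → trans
               (∑-cong B (λ a _ → trans (cong (weight (b v) a ⊗_) (⊗-↑ t (⁺ a) (degrees x v)))
                                        (pull (weight (b v) a) (t ↑ degrees x v) ((⁺ a) ↑ degrees x v))))
               (∑-⊗ˡ B (t ↑ degrees x v) _)) ⟩
        term n b (degrees x) ∎

    solutions : ℕ
    solutions = countⱽ m B (λ x → agree n b (degrees x))

    ryser-mod : Σ[ r ∈ ℤ ] ryser ≡ denominator n b ⊗ ⁺ solutions ⊕ t ↑ suc (sumℕ n b) ⊗ r
    ryser-mod = ∑ⱽ m B (λ x → proj₁ (split x)) , (begin
      ryser
        ≡⟨ ryser-terms ⟩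
      ∑ⱽ m B (λ x → term n b (degrees x))
        ≡⟨ ∑ⱽ-cong m B (λ x _ → proj₂ (split x)) ⟩
      ∑ⱽ m B (λ x → denominator n b ⊗ [ agree n b (degrees x) ]₀₁ ⊕ t ↑ suc (sumℕ n b) ⊗ proj₁ (split x))
        ≡⟨ ∑ⱽ-⊕ m B (λ x → denominator n b ⊗ [ agree n b (degrees x) ]₀₁) (λ x → t ↑ suc (sumℕ n b) ⊗ proj₁ (split x)) ⟩
      ∑ⱽ m B (λ x → denominator n b ⊗ [ agree n b (degrees x) ]₀₁) ⊕ ∑ⱽ m B (λ x → t ↑ suc (sumℕ n b) ⊗ proj₁ (split x))
        ≡⟨ cong₂ _⊕_ (trans (∑ⱽ-⊗ˡ m B (denominator n b) _) (cong (denominator n b ⊗_) (∑ⱽ-count m B _)))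
                     (∑ⱽ-⊗ˡ m B (t ↑ suc (sumℕ n b)) _) ⟩
      denominator n b ⊗ ⁺ solutions ⊕ t ↑ suc (sumℕ n b) ⊗ ∑ⱽ m B (λ x → proj₁ (split x)) ∎)
      where
      open ≡-Reasoning
      split = λ x → term-mod n b (degrees x) b<B

≡ᵇ-sym : ∀ m n → (m ≡ᵇ n) ≡ (n ≡ᵇ m)
≡ᵇ-sym zero    zero    = refl
≡ᵇ-sym zero    (suc n) = refl
≡ᵇ-sym (suc m) zero    = refl
≡ᵇ-sym (suc m) (suc n) = ≡ᵇ-sym m n

∏-select-≥ : ∀ n (f : ℕ → ℤ) j → n ≤ j → ∏ n (λ u → if j ≡ᵇ u then f u else 1ℤ) ≡ 1ℤ
∏-select-≥ n f j n≤j = trans (∏-cong n (λ u u<n → cong (λ q → if q then f u else 1ℤ)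
  (≢⇒≡ᵇ-false j u (>⇒≢ (<-≤-trans u<n n≤j))))) (∏-one n)

∏-select : ∀ n (f : ℕ → ℤ) j → j < n → ∏ n (λ u → if j ≡ᵇ u then f u else 1ℤ) ≡ f j
∏-select (suc n) f zero    _         = trans (cong (f 0 ⊗_) (∏-one n)) (ℤₚ.*-identityʳ (f 0))
∏-select (suc n) f (suc j) (s≤s j<n) = trans (ℤₚ.*-identityˡ _) (∏-select n (f ∘ suc) j j<n)

χ : (ℕ → Bool) → ℕ → ℕ
χ c v = if c v then 1 else 0

-- An index i below B ^ |C| encodes a value below B for each vertex of C.

module Digits (β : ℕ) where

  private B = suc β

  -- The rank of `u` among the vertices of C is its place in base B.
  digit : (ℕ → Bool) → ℕ → ℕ → ℕ
  digit c i u = mod (apply div i (B ^ sumℕ u (χ c))) B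

  digit-< : ∀ c i u → digit c i u < B
  digit-< c i u = mod-< (apply div i (B ^ sumℕ u (χ c))) B

  coincide : ℕ → (ℕ → Bool) → ℕ → (ℕ → ℕ) → ℤ
  coincide n c i z = ∏ n (λ u → if c u then [ z u ≡ᵇ digit c i u ]₀₁ else 1ℤ)

  apply-div : ∀ x y .{{_ : NonZero y}} → apply div x y ≡ x / y
  apply-div x (suc y) = refl

  div-B* : ∀ i y .{{_ : NonZero y}} → apply div i (B * y) ≡ apply div (i / B) y
  div-B* i y = begin
    apply div i (B * y)   ≡⟨ apply-div i (B * y) ⟩
    i / (B * y)           ≡⟨ m/n/o≡m/[n*o] i B y ⟨
    i / B / y             ≡⟨ apply-div (i / B) y ⟨
    apply div (i / B) y   ∎
    where
    open ≡-Reasoning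
    instance
      B*y≢0 : NonZero (B * y)
      B*y≢0 = m*n≢0 B y

  -- Remainder and quotient by B identify [0, K B) with [0, B) × [0, K); the induction splits off
  -- the block on which the quotient is 0.
  ∑-blocks : ∀ K (g h : ℕ → ℤ) → ∑ (K * B) (λ i → g (i % B) ⊗ h (i / B)) ≡ ∑ B g ⊗ ∑ K h
  ∑-blocks zero    g h = sym (ℤₚ.*-zeroʳ (∑ B g))
  ∑-blocks (suc K) g h = begin
    ∑ (B + K * B) (λ i → g (i % B) ⊗ h (i / B))
      ≡⟨ ∑-split B (K * B) (λ i → g (i % B) ⊗ h (i / B)) ⟩
    ∑ B (λ i → g (i % B) ⊗ h (i / B)) ⊕ ∑ (K * B) (λ i → g ((B + i) % B) ⊗ h ((B + i) / B))
      ≡⟨ cong₂ _⊕_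
           (trans (∑-cong B (λ i i<B → cong₂ (λ x y → g x ⊗ h y) (m<n⇒m%n≡m i<B) (m<n⇒m/n≡0 i<B))) (∑-⊗ʳ B (h 0) g))
           (trans (∑-cong (K * B) (λ i _ → cong₂ (λ x y → g x ⊗ h y) ([n+m]%n≡m%n′ i) (quotient i))) (∑-blocks K g (h ∘ suc))) ⟩
    ∑ B g ⊗ h 0 ⊕ ∑ B g ⊗ ∑ K (h ∘ suc)
      ≡⟨ ℤₚ.*-distribˡ-+ (∑ B g) (h 0) _ ⟨
    ∑ B g ⊗ ∑ (suc K) h ∎
    where
    open ≡-Reasoning
    [n+m]%n≡m%n′ : ∀ i → (B + i) % B ≡ i % B
    [n+m]%n≡m%n′ i = trans (cong (_% B) (+-comm B i)) ([m+n]%n≡m%n i B)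
    quotient : ∀ i → (B + i) / B ≡ suc (i / B)
    quotient i = trans (m/n≡1+[m∸n]/n (m≤m+n B i)) (cong (λ x → suc (x / B)) (m+n∸m≡n B i))

  -- Existence and uniqueness of base-B expansions as a partition of unity: exactly one index has
  -- the values of z on C as its digits.
  coincide-sum : ∀ n c z → (∀ u → u < n → z u < B) → ∑ (B ^ sumℕ n (χ c)) (λ i → coincide n c i z) ≡ 1ℤ
  coincide-sum zero    c z z<B = refl
  coincide-sum (suc n) c z z<B with c 0 in c₀
  ... | false = trans
    (∑-cong (B ^ sumℕ n (χ (c ∘ suc))) (λ i _ → ℤₚ.*-identityˡ _))
    (coincide-sum n (c ∘ suc) (z ∘ suc) (λ u u<n → z<B (suc u) (s<s u<n)))
  ... | true = begin
    ∑ (B * B ^ K) (λ i → [ z 0 ≡ᵇ digit c i 0 ]₀₁ ⊗ ∏ n (λ u → if c (suc u) then [ z (suc u) ≡ᵇ later i u ]₀₁ else 1ℤ))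
      ≡⟨ cong (λ x → ∑ x (λ i → [ z 0 ≡ᵇ digit c i 0 ]₀₁ ⊗ ∏ n (λ u → if c (suc u) then [ z (suc u) ≡ᵇ later i u ]₀₁ else 1ℤ))) (*-comm B (B ^ K)) ⟩
    ∑ (B ^ K * B) (λ i → [ z 0 ≡ᵇ digit c i 0 ]₀₁ ⊗ ∏ n (λ u → if c (suc u) then [ z (suc u) ≡ᵇ later i u ]₀₁ else 1ℤ))
      ≡⟨ ∑-cong (B ^ K * B) (λ i _ → cong₂ _⊗_ (cong (λ x → [ z 0 ≡ᵇ x ]₀₁) (first i))
           (∏-cong n (λ u _ → cong (λ x → if c (suc u) then [ z (suc u) ≡ᵇ x ]₀₁ else 1ℤ) (others i u)))) ⟩
    ∑ (B ^ K * B) (λ i → [ z 0 ≡ᵇ i % B ]₀₁ ⊗ coincide n (c ∘ suc) (i / B) (z ∘ suc))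
      ≡⟨ ∑-blocks (B ^ K) (λ a → [ z 0 ≡ᵇ a ]₀₁) (λ i → coincide n (c ∘ suc) i (z ∘ suc)) ⟩
    ∑ B (λ a → [ z 0 ≡ᵇ a ]₀₁) ⊗ ∑ (B ^ K) (λ i → coincide n (c ∘ suc) i (z ∘ suc))
      ≡⟨ cong₂ _⊗_ (trans (∑-cong B (λ a _ → trans (cong [_]₀₁ (≡ᵇ-sym (z 0) a)) (sym (ℤₚ.*-identityʳ _))))
                          (∑-select B (λ _ → 1ℤ) (z 0) (z<B 0 z<s)))
                   (coincide-sum n (c ∘ suc) (z ∘ suc) (λ u u<n → z<B (suc u) (s<s u<n))) ⟩
    1ℤ ∎
    where
    open ≡-Reasoning
    K = sumℕ n (χ (c ∘ suc))
    later : ℕ → ℕ → ℕ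
    later i u = mod (apply div i (B * B ^ sumℕ u (χ (c ∘ suc)))) B
    first : ∀ i → digit c i 0 ≡ i % B
    first i = trans (mod-% (i / 1) B) (cong (_% B) (n/1≡n i))
    others : ∀ i u → later i u ≡ digit (c ∘ suc) (i / B) u
    others i u = cong (λ x → mod x B) (div-B* i (B ^ sumℕ u (χ (c ∘ suc))) {{m^n≢0 B (sumℕ u (χ (c ∘ suc)))}})

-- Factoring the sum over the vertices outside C

module Factorisation (β : ℕ) (t : ℤ) (n m : ℕ) (A : ℕ → ℕ → ℕ) (b : ℕ → ℕ) (b<B : ∀ v → v < n → b v < suc β)
                     (c : ℕ → Bool) (owner : ℕ → ℕ) where

  private B = suc β
  open Digits β
  open Ryser B t
  open Formula n m A b b<B

  -- All vertices outside C receive the same value `s`. A hyperedge has at most one of them, so its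
  -- factor does not notice the values at the others.
  merge : ℕ → ℕ → ℕ → ℕ
  merge i s v = if c v then digit c i v else s

  -- The owner of a hyperedge is its vertex outside C, or n if it has none. Accordingly
  -- `owned i n 0` collects the hyperedges inside C, and 0 is only a placeholder there.
  owned : ℕ → ℕ → ℕ → ℤ
  owned i u s = ∏ m (λ F → if owner F ≡ᵇ u then geometric (merge i s) F else 1ℤ)

  factor : ℕ → ℕ → ℤ
  factor i u = if c u then weight (b u) (digit c i u) else ∑ B (λ a → weight (b u) a ⊗ owned i u a)

  summand : ℕ → ℤ
  summand i = owned i n 0 ⊗ ∏ n (factor i)

  module _ (owner≤n : ∀ F → F < m → owner F ≤ n)
           (owner∉c : ∀ F u → F < m → u < n → c u ≡ true → owner F ≢ u)
           (merge-owner : ∀ F i (z : ℕ → ℕ) → F < m → (∀ v → v < n → c v ≡ true → z v ≡ digit c i v) →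
                          geometric (merge i (if owner F ≡ᵇ n then 0 else z (owner F))) F
                          ≡ geometric z F) where

    -- A Kronecker delta turns the factor of a vertex in C into a sum over [0, B) too, so that
    -- distributivity applies to all vertices alike.
    extended : ℕ → ℕ → ℕ → ℤ
    extended i u a = (if c u then [ a ≡ᵇ digit c i u ]₀₁ else 1ℤ) ⊗ (weight (b u) a ⊗ owned i u a)

    factor-extended : ∀ i u → u < n → factor i u ≡ ∑ B (extended i u)
    factor-extended i u u<n with c u in cu
    ... | false = ∑-cong B {λ a → weight (b u) a ⊗ owned i u a} (λ a _ → sym (ℤₚ.*-identityˡ _))
    ... | true  = sym (trans (∑-select B (λ a → weight (b u) a ⊗ owned i u a) (digit c i u) (digit-< c i u))
      (trans (cong (weight (b u) (digit c i u) ⊗_) nothing) (ℤₚ.*-identityʳ _)))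
      where
      nothing : owned i u (digit c i u) ≡ 1ℤ
      nothing = trans (∏-cong m (λ F F<m → cong (λ q → if q then geometric (merge i (digit c i u)) F else 1ℤ)
        (≢⇒≡ᵇ-false (owner F) u (owner∉c F u F<m u<n cu)))) (∏-one m)

    -- Each hyperedge has exactly one owner among 0, ..., n, so the product over all possible owners
    -- selects its factor exactly once.
    owned-all : ∀ i (z : ℕ → ℕ) → owned i n 0 ⊗ ∏ n (λ u → owned i u (z u))
                ≡ ∏ m (λ F → geometric (merge i (if owner F ≡ᵇ n then 0 else z (owner F))) F)
    owned-all i z = begin
      owned i n 0 ⊗ ∏ n (λ u → owned i u (z u))
        ≡⟨ cong (owned i n 0 ⊗_) (∏-swap n m (λ u F → if owner F ≡ᵇ u then geometric (merge i (z u)) F else 1ℤ)) ⟩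
      owned i n 0 ⊗ ∏ m (λ F → ∏ n (λ u → if owner F ≡ᵇ u then geometric (merge i (z u)) F else 1ℤ))
        ≡⟨ ∏-⊗ m (λ F → if owner F ≡ᵇ n then geometric (merge i 0) F else 1ℤ) _ ⟨
      ∏ m (λ F → (if owner F ≡ᵇ n then geometric (merge i 0) F else 1ℤ) ⊗ ∏ n (λ u → if owner F ≡ᵇ u then geometric (merge i (z u)) F else 1ℤ))
        ≡⟨ ∏-cong m each ⟩
      ∏ m (λ F → geometric (merge i (if owner F ≡ᵇ n then 0 else z (owner F))) F) ∎
      where
      open ≡-Reasoning
      each : ∀ F → F < m →
        (if owner F ≡ᵇ n then geometric (merge i 0) F else 1ℤ) ⊗ ∏ n (λ u → if owner F ≡ᵇ u then geometric (merge i (z u)) F else 1ℤ)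
        ≡ geometric (merge i (if owner F ≡ᵇ n then 0 else z (owner F))) F
      each F F<m with owner F ≟ n
      ... | yes own rewrite own | ≡ᵇ-refl n = trans (cong (geometric (merge i 0) F ⊗_) (∏-select-≥ n (λ u → geometric (merge i (z u)) F) n ≤-refl)) (ℤₚ.*-identityʳ _)
      ... | no own≢ rewrite ≢⇒≡ᵇ-false (owner F) n own≢ = trans (ℤₚ.*-identityˡ _)
        (∏-select n (λ u → geometric (merge i (z u)) F) (owner F) (≤∧≢⇒< (owner≤n F F<m) own≢))

    -- Where z disagrees with the digits of `i` on C the factor `coincide` is 0, so an equation next
    -- to it may assume agreement.
    coincide-cong : ∀ i (z : ℕ → ℕ) {x y} → ((∀ v → v < n → c v ≡ true → z v ≡ digit c i v) → x ≡ y) →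
                    coincide n c i z ⊗ x ≡ coincide n c i z ⊗ y
    coincide-cong i z {x} {y} x≡y
      with anyUpTo? (λ v → (c v 𝔹ₚ.≟ true) ×-dec ¬? (z v ≟ digit c i v)) n
    ... | yes (v , v<n , cv , z≢) = trans (cong (_⊗ x) zero₀) (sym (cong (_⊗ y) zero₀))
      where
      zero₀ : coincide n c i z ≡ 0ℤ
      zero₀ = ∏-zero n _ v v<n (trans (cong (λ q → if q then [ z v ≡ᵇ digit c i v ]₀₁ else 1ℤ) cv)
                                      (cong [_]₀₁ (≢⇒≡ᵇ-false (z v) _ z≢)))
    ... | no none = cong (coincide n c i z ⊗_) (x≡y agree′)
      where
      agree′ : ∀ v → v < n → c v ≡ true → z v ≡ digit c i v
      agree′ v v<n cv with z v ≟ digit c i v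
      ... | yes eq = eq
      ... | no neq = contradiction (v , v<n , cv , neq) none

    summand-expand : ∀ i → summand i ≡
      ∑ⱽ n B (λ z → coincide n c i (peek z) ⊗ (weights (peek z) ⊗ ∏ m (geometric (peek z))))
    summand-expand i = begin
      owned i n 0 ⊗ ∏ n (factor i)
        ≡⟨ cong (owned i n 0 ⊗_) (trans (∏-cong n (factor-extended i)) (∏-∑ n B (extended i))) ⟩
      owned i n 0 ⊗ ∑ⱽ n B (λ z → ∏ n (λ u → extended i u (peek z u)))
        ≡⟨ ∑ⱽ-⊗ˡ n B (owned i n 0) _ ⟨
      ∑ⱽ n B (λ z → owned i n 0 ⊗ ∏ n (λ u → extended i u (peek z u)))
        ≡⟨ ∑ⱽ-cong n B (λ z _ → each (peek z)) ⟩
      ∑ⱽ n B (λ z → coincide n c i (peek z) ⊗ (weights (peek z) ⊗ ∏ m (geometric (peek z)))) ∎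
      where
      open ≡-Reasoning
      regroup : ∀ o d w p → o ⊗ (d ⊗ (w ⊗ p)) ≡ d ⊗ (w ⊗ (o ⊗ p))
      regroup = ℤ-solver.solve-∀
      each : ∀ (z : ℕ → ℕ) → owned i n 0 ⊗ ∏ n (λ u → extended i u (z u)) ≡ coincide n c i z ⊗ (weights z ⊗ ∏ m (geometric z))
      each z = begin
        owned i n 0 ⊗ ∏ n (λ u → extended i u (z u))
          ≡⟨ cong (owned i n 0 ⊗_) (trans (∏-⊗ n (λ u → if c u then [ z u ≡ᵇ digit c i u ]₀₁ else 1ℤ) _)
               (cong (coincide n c i z ⊗_) (∏-⊗ n (λ u → weight (b u) (z u)) _))) ⟩
        owned i n 0 ⊗ (coincide n c i z ⊗ (weights z ⊗ ∏ n (λ u → owned i u (z u))))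
          ≡⟨ regroup (owned i n 0) (coincide n c i z) (weights z) _ ⟩
        coincide n c i z ⊗ (weights z ⊗ (owned i n 0 ⊗ ∏ n (λ u → owned i u (z u))))
          ≡⟨ coincide-cong i z (λ eq → cong (weights z ⊗_)
               (trans (owned-all i z) (∏-cong m (λ F F<m → merge-owner F i z F<m eq)))) ⟩
        coincide n c i z ⊗ (weights z ⊗ ∏ m (geometric z)) ∎

    summand-sum : ∑ (B ^ sumℕ n (χ c)) summand ≡ ryser
    summand-sum = begin
      ∑ X summand
        ≡⟨ ∑-cong X (λ i _ → summand-expand i) ⟩
      ∑ X (λ i → ∑ⱽ n B (λ z → coincide n c i (peek z) ⊗ Φ z))
        ≡⟨ ∑-∑ⱽ-swap X n B (λ i z → coincide n c i (peek z) ⊗ Φ z) ⟩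
      ∑ⱽ n B (λ z → ∑ X (λ i → coincide n c i (peek z) ⊗ Φ z))
        ≡⟨ ∑ⱽ-cong n B (λ z box → trans (∑-⊗ʳ X (Φ z) (λ i → coincide n c i (peek z)))
             (trans (cong (_⊗ Φ z) (coincide-sum n c (peek z) (box-peek box))) (ℤₚ.*-identityˡ (Φ z)))) ⟩
      ryser ∎
      where
      open ≡-Reasoning
      X = B ^ sumℕ n (χ c)
      Φ : List ℕ → ℤ
      Φ z = weights (peek z) ⊗ ∏ m (geometric (peek z))

-- Counting solutions

Σ-Fin-↔ : ∀ {n} {X : Fin n → Set} (g : ℕ → ℕ) → (∀ i → X i ↔ Fin (g (toℕ i))) →
          Σ (Fin n) X ↔ Fin (sumℕ n g)
Σ-Fin-↔ {zero}      g iso = mk↔ₛ′ (λ ()) (λ ()) (λ ()) (λ ())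
Σ-Fin-↔ {suc n} {X} g iso =
  ↔-trans uncons (↔-trans (iso zero ⊎-↔ Σ-Fin-↔ (g ∘ suc) (λ i → iso (suc i))) (↔-sym +↔⊎))
  where
  uncons : Σ (Fin (suc n)) X ↔ (X zero ⊎ Σ (Fin n) (λ i → X (suc i)))
  uncons = mk↔ₛ′
    (λ { (zero , x) → inj₁ x ; (suc i , x) → inj₂ (i , x) })
    (λ { (inj₁ x) → zero , x ; (inj₂ (i , x)) → suc i , x })
    (λ { (inj₁ x) → refl ; (inj₂ (i , x)) → refl })
    (λ { (zero , x) → refl ; (suc i , x) → refl })

Satisfying : ℕ → ℕ → (List ℕ → Bool) → Set
Satisfying B m q = Σ[ x ∈ Vec (Fin B) m ] T (q (toList (Vec.map toℕ x)))

satisfying-↔ : ∀ B m q → Satisfying B m q ↔ Fin (countⱽ m B q)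
satisfying-↔ B zero q with q [] in q[]
... | true  = mk↔ₛ′ (λ _ → zero) (λ _ → [] , subst T (sym q[]) tt) (λ { zero → refl })
                (λ { ([] , p) → cong ([] ,_) (𝔹ₚ.T-irrelevant _ p) })
... | false = mk↔ₛ′ (λ { ([] , p) → ⊥-elim (subst T q[] p) }) (λ ()) (λ ())
                (λ { ([] , p) → ⊥-elim (subst T q[] p) })
satisfying-↔ B (suc m) q = ↔-trans uncons
  (Σ-Fin-↔ (λ a → countⱽ m B (λ y → q (a ∷ y))) (λ a → satisfying-↔ B m (λ y → q (toℕ a ∷ y))))
  where
  uncons : Satisfying B (suc m) q ↔ Σ (Fin B) (λ a → Satisfying B m (λ y → q (toℕ a ∷ y)))
  uncons = mk↔ₛ′ (λ { (a ∷ x , p) → a , x , p }) (λ { (a , x , p) → a ∷ x , p }) (λ _ → refl) (λ { (a ∷ x , p) → refl })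

sumℕ-cong : ∀ n {f g} → (∀ i → i < n → f i ≡ g i) → sumℕ n f ≡ sumℕ n g
sumℕ-cong zero    f≡g = refl
sumℕ-cong (suc n) f≡g = cong₂ _+_ (f≡g 0 z<s) (sumℕ-cong n (λ i i<n → f≡g (suc i) (s<s i<n)))

sumℕ-≤ : ∀ n f c → (∀ i → i < n → f i ≤ c) → sumℕ n f ≤ n * c
sumℕ-≤ zero    f c f≤c = z≤n
sumℕ-≤ (suc n) f c f≤c = +-mono-≤ (f≤c 0 z<s) (sumℕ-≤ n (f ∘ suc) c (λ i i<n → f≤c (suc i) (s<s i<n)))

countⱽ-≤ : ∀ n B q → countⱽ n B q ≤ B ^ n
countⱽ-≤ zero B q with q []
... | true  = ≤-refl
... | false = z≤n
countⱽ-≤ (suc n) B q = sumℕ-≤ B _ (B ^ n) (λ a _ → countⱽ-≤ n B (λ y → q (a ∷ y)))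

≡ᵇ-true⇒≡ : ∀ m n → (m ≡ᵇ n) ≡ true → m ≡ n
≡ᵇ-true⇒≡ m n eq = ≡ᵇ⇒≡ m n (subst T (sym eq) tt)

allᵇ⁺ : ∀ n q → (∀ v → v < n → q v ≡ true) → allᵇ n q ≡ true
allᵇ⁺ zero    q all = refl
allᵇ⁺ (suc n) q all = cong₂ _∧_ (all 0 z<s) (allᵇ⁺ n (q ∘ suc) (λ v v<n → all (suc v) (s<s v<n)))

allᵇ⁻ : ∀ n q → allᵇ n q ≡ true → ∀ v → v < n → q v ≡ true
allᵇ⁻ (suc n) q all v v<n with q 0 in q₀
allᵇ⁻ (suc n) q all zero    _         | true = q₀
allᵇ⁻ (suc n) q all (suc v) (s≤s v<n) | true = allᵇ⁻ n (q ∘ suc) all v v<n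

-- The input format

𝟙[_] : Bool → ℕ
𝟙[ q ] = if q then 1 else 0

peek-++ˡ : ∀ xs ys i → i < length xs → peek (xs List.++ ys) i ≡ peek xs i
peek-++ˡ (x ∷ xs) ys zero    _         = refl
peek-++ˡ (x ∷ xs) ys (suc i) (s≤s i<n) = peek-++ˡ xs ys i i<n

peek-++ʳ : ∀ xs ys i → peek (xs List.++ ys) (length xs + i) ≡ peek ys i
peek-++ʳ []       ys i = refl
peek-++ʳ (x ∷ xs) ys i = peek-++ʳ xs ys i

peek-toList : ∀ {n} (xs : Vec ℕ n) i → peek (toList xs) (toℕ i) ≡ lookup xs i
peek-toList (x ∷ xs) zero    = refl
peek-toList (x ∷ xs) (suc i) = peek-toList xs i

peek-map-tabulate : ∀ {n} {A : Set} (f : A → ℕ) (g : Fin n → A) i → peek (List.map f (List.tabulate g)) (toℕ i) ≡ f (g i)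
peek-map-tabulate f g zero    = refl
peek-map-tabulate f g (suc i) = peek-map-tabulate f (g ∘ suc) i

peek-concatMap : ∀ {A : Set} {m} (f : A → List ℕ) n → (∀ x → length (f x) ≡ n) →
  ∀ (xs : Vec A m) j i → i < n → peek (List.concatMap f (toList xs)) (toℕ j * n + i) ≡ peek (f (lookup xs j)) i
peek-concatMap f n len (x ∷ xs) zero    i i<n = peek-++ˡ (f x) _ i (subst (i <_) (sym (len x)) i<n)
peek-concatMap f n len (x ∷ xs) (suc j) i i<n = begin
  peek (f x List.++ rest) (n + toℕ j * n + i)            ≡⟨ cong (peek (f x List.++ rest)) (+-assoc n (toℕ j * n) i) ⟩
  peek (f x List.++ rest) (n + (toℕ j * n + i))          ≡⟨ cong (λ k → peek (f x List.++ rest) (k + (toℕ j * n + i))) (len x) ⟨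
  peek (f x List.++ rest) (length (f x) + (toℕ j * n + i)) ≡⟨ peek-++ʳ (f x) rest (toℕ j * n + i) ⟩
  peek rest (toℕ j * n + i)                              ≡⟨ peek-concatMap f n len xs j i i<n ⟩
  peek (f (lookup xs j)) i                               ∎
  where
  open ≡-Reasoning
  rest = List.concatMap f (toList xs)

length-concatMap : ∀ {A : Set} {m} (f : A → List ℕ) n → (∀ x → length (f x) ≡ n) →
  ∀ (xs : Vec A m) → length (List.concatMap f (toList xs)) ≡ m * n
length-concatMap f n len []       = refl
length-concatMap f n len (x ∷ xs) = trans (length-++ (f x)) (cong₂ _+_ (len x) (length-concatMap f n len xs))

‖‖∞-bound : ∀ {n} (b : Vec ℕ n) v → lookup b v ≤ ‖ b ‖∞
‖‖∞-bound (x ∷ b) zero    = m≤m⊔n x _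
‖‖∞-bound (x ∷ b) (suc v) = ≤-trans (‖‖∞-bound b v) (m≤n⊔m x _)

All-peek : ∀ {K xs} → All (_≤ K) xs → ∀ i → peek xs i ≤ K
All-peek []         i       = z≤n
All-peek (x≤ ∷ all) zero    = x≤
All-peek (x≤ ∷ all) (suc i) = All-peek all i

module Input (H : Hypergraph) (b : Vec ℕ (order H)) where

  n = order H
  m = size H

  incident : Fin m → Fin n → Bool
  incident j v = does (v ∈? lookup (edges H) j)

  row : Subset n → List ℕ
  row F = List.map (λ v → 𝟙[ does (v ∈? F) ]) (List.allFin n)

  length-row : ∀ F → length (row F) ≡ n
  length-row F = trans (length-map _ (List.allFin n)) (length-tabulate (λ i → i))

  input-b : ∀ v → peek (encode H b) (2 + toℕ v) ≡ lookup b v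
  input-b v = trans (peek-++ˡ (toList b) _ (toℕ v) (subst (toℕ v <_) (sym (length-toList b)) (toℕ<n v))) (peek-toList b v)

  input-A : ∀ j v → peek (encode H b) (2 + (n + (toℕ j * n + toℕ v))) ≡ 𝟙[ incident j v ]
  input-A j v = begin
    peek (toList b List.++ rows) (n + (toℕ j * n + toℕ v))               ≡⟨ cong (λ k → peek (toList b List.++ rows) (k + (toℕ j * n + toℕ v))) (length-toList b) ⟨
    peek (toList b List.++ rows) (length (toList b) + (toℕ j * n + toℕ v)) ≡⟨ peek-++ʳ (toList b) rows _ ⟩
    peek rows (toℕ j * n + toℕ v)                                         ≡⟨ peek-concatMap row n length-row (edges H) j (toℕ v) (toℕ<n v) ⟩
    peek (row (lookup (edges H) j)) (toℕ v)                               ≡⟨ peek-map-tabulate (λ v → 𝟙[ does (v ∈? lookup (edges H) j) ]) (λ i → i) v ⟩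
    𝟙[ incident j v ]                                                     ∎
    where
    open ≡-Reasoning
    rows = List.concatMap row (toList (edges H))

  length-input : length (encode H b) ≡ 2 + (n + m * n)
  length-input = cong (2 +_) (trans (length-++ (toList b)) (cong₂ _+_ (length-toList b) (length-concatMap row n length-row (edges H))))

  input-≤ : ∀ i → peek (encode H b) i ≤ 1 + (n + (m + ‖ b ‖∞))
  input-≤ = All-peek
    (≤-trans (m≤m+n n _) (n≤1+n _) ∷
     ≤-trans (≤-trans (m≤m+n m _) (m≤n+m _ n)) (n≤1+n _) ∷
     Allₚ.++⁺ (entries b (λ v → ≤-trans (≤-trans (≤-trans (‖‖∞-bound b v) (m≤n+m _ m)) (m≤n+m _ n)) (n≤1+n _)))
              (Allₚ.concat⁺ (Allₚ.map⁺ (All.universal (λ F → Allₚ.map⁺ (All.universal (λ v → bit (does (v ∈? F))) (List.allFin n))) (toList (edges H))))))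
    where
    bit : ∀ q → 𝟙[ q ] ≤ 1 + (n + (m + ‖ b ‖∞))
    bit true  = s≤s z≤n
    bit false = z≤n
    entries : ∀ {n K} (b : Vec ℕ n) → (∀ v → lookup b v ≤ K) → All (_≤ K) (toList b)
    entries []      b≤ = []
    entries (x ∷ b) b≤ = b≤ zero ∷ entries b (b≤ ∘ suc)

  -- Read off the encoding, so that this and `A#` are by computation the very numbers which the
  -- program reads; `input-b` and `input-A` relate them to the hypergraph.
  b# : ℕ → ℕ
  b# v = peek (encode H b) (2 + v)

  A# : ℕ → ℕ → ℕ
  A# F v = peek (encode H b) (2 + (n + (F * n + v)))

  module _ (nonempty : EdgesNonempty H) (t : ℤ) (b#<B : ∀ v → v < n → b# v < suc ‖ b ‖∞) where

    open Ryser (suc ‖ b ‖∞) t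
    open Formula n m A# b# b#<B

    q : List ℕ → Bool
    q x = agree n b# (degrees x)

    load-≡ : ∀ (x : Vec ℕ m) v → degrees (toList x) (toℕ v) ≡ load H x v
    load-≡ x v = sym (generalised (edges H) x (λ F → A# F (toℕ v)) (λ j → input-A j v))
      where
      generalised : ∀ {m} (es : Vec (Subset n) m) (x : Vec ℕ m) (a : ℕ → ℕ) →
        (∀ j → a (toℕ j) ≡ 𝟙[ does (v ∈? lookup es j) ]) →
        Vec.sum (Vec.zipWith (λ F xF → if does (v ∈? F) then xF else 0) es x) ≡ sumℕ m (λ F → a F * peek (toList x) F)
      generalised []       []       a a≡ = refl
      generalised (e ∷ es) (x ∷ xs) a a≡ = cong₂ _+_ (trans (choose (does (v ∈? e))) (cong (_* x) (sym (a≡ zero))))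
        (generalised es xs (a ∘ suc) (λ j → a≡ (suc j)))
        where
        choose : ∀ p → (if p then x else 0) ≡ 𝟙[ p ] * x
        choose true  = sym (+-identityʳ x)
        choose false = refl

    matching⇒q : ∀ (x : Vec ℕ m) → Vec.tabulate (load H x) ≡ b → T (q (toList x))
    matching⇒q x eq = subst T (sym (allᵇ⁺ n _ each)) tt
      where
      each : ∀ v → v < n → (degrees (toList x) v ≡ᵇ b# v) ≡ true
      each v v<n with fromℕ< v<n | toℕ-fromℕ< v<n
      ... | i | refl = trans (cong₂ _≡ᵇ_
        (trans (load-≡ x i) (trans (sym (lookup∘tabulate (load H x) i)) (cong (λ b → lookup b i) eq))) (input-b i)) (≡ᵇ-refl (lookup b i))

    q⇒matching : ∀ (x : Vec ℕ m) → T (q (toList x)) → Vec.tabulate (load H x) ≡ b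
    q⇒matching x ok = trans (tabulate-cong each) (tabulate∘lookup b)
      where
      T⇒≡ : ∀ {p} → T p → p ≡ true
      T⇒≡ {true} _ = refl
      each : ∀ v → load H x v ≡ lookup b v
      each v = trans (sym (load-≡ x v)) (trans
        (≡ᵇ-true⇒≡ _ _ (allᵇ⁻ n (λ v → degrees (toList x) v ≡ᵇ b# v) (T⇒≡ ok) (toℕ v) (toℕ<n v))) (input-b v))

    -- A nonempty hyperedge has a vertex, and the demand there already limits its multiplicity.
    -- Hence matchings lie in the box [0, B)^E over which the truncated geometric sums range.
    matching-< : ∀ (x : Vec ℕ m) → Vec.tabulate (load H x) ≡ b → ∀ j → lookup x j < suc ‖ b ‖∞
    matching-< x eq j with nonempty j
    ... | v , v∈j = s≤s (begin
      lookup x j                                  ≡⟨ cong (λ p → if p then lookup x j else 0) (dec-true (v ∈? lookup (edges H) j) v∈j) ⟨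
      (if incident j v then lookup x j else 0)    ≤⟨ summand (edges H) x j ⟩
      load H x v                                  ≡⟨ lookup∘tabulate (load H x) v ⟨
      lookup (Vec.tabulate (load H x)) v          ≡⟨ cong (λ b → lookup b v) eq ⟩
      lookup b v                                  ≤⟨ ‖‖∞-bound b v ⟩
      ‖ b ‖∞                                      ∎)
      where
      open ≤-Reasoning
      summand : ∀ {m} (es : Vec (Subset n) m) (x : Vec ℕ m) j → (if does (v ∈? lookup es j) then lookup x j else 0)
        ≤ Vec.sum (Vec.zipWith (λ F xF → if does (v ∈? F) then xF else 0) es x)
      summand (e ∷ es) (x ∷ xs) zero    = m≤m+n _ _
      summand (e ∷ es) (x ∷ xs) (suc j) = ≤-trans (summand es xs j) (m≤n+m _ _)

    matchings-↔ : PerfectMatching H b ↔ Fin (countⱽ m (suc ‖ b ‖∞) q)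
    matchings-↔ = ↔-trans (mk↔ₛ′ to from to∘from from∘to) (satisfying-↔ (suc ‖ b ‖∞) m q)
      where
      digits : ∀ (x : Vec ℕ m) → (∀ j → lookup x j < suc ‖ b ‖∞) → Vec (Fin (suc ‖ b ‖∞)) m
      digits x x< = Vec.tabulate (λ j → fromℕ< (x< j))
      map-digits : ∀ x x< → Vec.map toℕ (digits x x<) ≡ x
      map-digits x x< = trans (sym (tabulate-∘ toℕ _)) (trans (tabulate-cong (λ j → toℕ-fromℕ< (x< j))) (tabulate∘lookup x))
      digits-map : ∀ y y< → digits (Vec.map toℕ y) y< ≡ y
      digits-map y y< = trans (tabulate-cong (λ j → toℕ-injective (trans (toℕ-fromℕ< (y< j)) (lookup-map j toℕ y)))) (tabulate∘lookup y)
      to : PerfectMatching H b → Satisfying (suc ‖ b ‖∞) m q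
      to (x , eq) = digits x (matching-< x eq) , subst (T ∘ q ∘ toList) (sym (map-digits x (matching-< x eq))) (matching⇒q x eq)
      from : Satisfying (suc ‖ b ‖∞) m q → PerfectMatching H b
      from (y , ok) = Vec.map toℕ y , q⇒matching (Vec.map toℕ y) ok
      satisfying-≡ : ∀ {y y′ p p′} → y ≡ y′ → _≡_ {A = Satisfying (suc ‖ b ‖∞) m q} (y , p) (y′ , p′)
      satisfying-≡ {p = p} {p′} refl = cong (_ ,_) (𝔹ₚ.T-irrelevant p p′)
      matching-≡ : ∀ {x x′ p p′} → x ≡ x′ → _≡_ {A = PerfectMatching H b} (x , p) (x′ , p′)
      matching-≡ {p = refl} {refl} refl = refl
      to∘from : ∀ s → to (from s) ≡ s
      to∘from (y , ok) = satisfying-≡ (digits-map y (matching-< (Vec.map toℕ y) (q⇒matching (Vec.map toℕ y) ok)))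
      from∘to : ∀ s → from (to s) ≡ s
      from∘to (x , eq) = matching-≡ (map-digits x (matching-< x eq))

-- The expressions of the program

Term : Set
Term = ℕ → Tm

module Terms where

  V : ℕ → Term
  V l _ = var l

  # : ℕ → Term
  # n _ = lit n

  infixl 6 _`+_ _`∸_
  infixl 7 _`*_ _`/_ _`%_

  _`+_ _`∸_ _`*_ _`/_ _`%_ : Term → Term → Term
  (a `+ b) d = bin add (a d) (b (suc d))
  (a `∸ b) d = bin sub (a d) (b (suc d))
  (a `* b) d = bin mul (a d) (b (suc d))
  (a `/ b) d = bin div (a d) (b (suc d))
  (a `% b) d = rem (a d) (b (suc d))

  Inp : Term → Term
  Inp a d = inp (a d)

  Let : Term → (Term → Term) → Term
  Let a f d = bind (a d) (f (V d) (suc d))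

  Iter : Fin 5 → Term → (Term → Term → Term) → Term
  Iter k a f d = iter k (a d) (f (V d) (V (suc d)) (2 + d))

  pattern byN = zero
  pattern byM = suc zero
  pattern byβ = suc (suc zero)
  pattern byB = suc (suc (suc zero))
  pattern byP = suc (suc (suc (suc zero)))

  -- Registers 0 to 12 are global. Those without a name here are 5 for the number of
  -- hyperedge-vertex-vertex triples, 9 for the result of the cover test, and 10 for the number of
  -- summands.
  `Q `n `m `β `B `t `s `mask `i `acc : Term
  `Q = V 0
  `n = V 1
  `m = V 2
  `β = V 3
  `B = V 4
  `t = V 6
  `s = V 7
  `mask = V 8
  `i = V 11
  `acc = V 12

  `b : Term → Term
  `b v = Inp (# 2 `+ v)

  `A : Term → Term → Term
  `A F v = Inp (# 2 `+ (`n `+ (F `* `n `+ v)))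

  `if : Term → Term → Term → Term
  `if q x y = Let q λ q → q `* x `+ (# 1 `∸ q) `* y

  -- Under truncated subtraction, 1 ∸ d is the indicator of d = 0.
  `lt `eq : Term → Term → Term
  `lt x y = # 1 `∸ (# 1 `∸ (y `∸ x))
  `eq x y = # 1 `∸ ((x `∸ y) `+ (y `∸ x))

  -- Loop counts come from five fixed registers only, so a smaller exponent is obtained by
  -- multiplying by 1 in the surplus passes.
  `pow : Fin 5 → Term → Term → Term
  `pow k x e = Iter k (# 1) λ a j → a `* `if (`lt j e) x (# 1)

  `bit : Term → Term → Term
  `bit mask v = mask `/ `pow byN (# 2) v `% # 2

  `pop : Term → Term
  `pop mask = Iter byN (# 0) λ a v → a `+ `bit mask v

  -- p < m n n encodes a hyperedge and two vertices.
  `open : Term → Term → (Term → Term → Term) → Term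
  `open mask p f =
    Let (p `/ (`n `* `n)) λ F → Let (p `/ `n `% `n) λ u → Let (p `% `n) λ v →
    `A F u `* (`A F v `* ((# 1 `∸ `eq u v) `* ((# 1 `∸ `bit mask u) `* ((# 1 `∸ `bit mask v) `* f u v))))

  -- Bit j of s selects the end of the uncovered pair at which vertex number j
  -- of the cover is chosen; the leading bit of s only marks the end of the code.
  `cover : Term
  `cover = Iter byP (# 0) λ a p → a `+ `open a p λ u v →
    Let (`s `/ `pow byN (# 2) (`pop a)) λ r →
    `lt (# 1) r `* `pow byN (# 2) (`if (r `% # 2) u v)

  -- For β = 0 the time bound has no room for 2^|C| trials because B = 1; the factor β then makes
  -- the very first mask acceptable.
  `uncovered : Term
  `uncovered = `β `* Iter byP (# 0) λ a p → a `+ `open `mask p λ _ _ → # 1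

  `size : Term
  `size = `pow byN `B (`pop `mask)

  `rank : Term → Term
  `rank u = Iter byN (# 0) λ a v → a `+ `lt v u `* `bit `mask v

  `digit : Term → Term
  `digit u = `i `/ `pow byN `B (`rank u) `% `B

  `monomial : Term → Term → Term
  `monomial F s = Iter byN (# 1) λ a v → a `* `if (`A F v) (`t `* `if (`bit `mask v) (`digit v) s) (# 1)

  `geometric : Term → Term → Term
  `geometric F s = Let (`monomial F s) λ x → Iter byβ (# 1) λ a _ → a `* x `+ # 1

  `owner : Term → Term
  `owner F = Iter byN `n λ a v → `if (`A F v `* (# 1 `∸ `bit `mask v)) v a

  `owned : Term → Term → Term
  `owned u s = Iter byM (# 1) λ a F → a `* `if (`eq (`owner F) u) (`geometric F s) (# 1)

  -- Multiplicative formula: every intermediate accumulator is itself a binomial coefficient, so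
  -- each division is exact. Division does not respect residues, so this loop has to stay below Q
  -- and not merely be right modulo Q.
  `binomial : Term → Term → Term
  `binomial b y = Iter byβ (# 1) λ a j → a `* `if (`lt j y) (b `∸ j) (j `+ # 1) `/ (j `+ # 1)

  -- The sign is a power of Q - 1, the residue of -1.
  `weight : Term → Term → Term
  `weight b y = `binomial b y `* `pow byβ (`Q `∸ # 1) (b `∸ y)

  `factor : Term → Term
  `factor u = `if (`bit `mask u) (`weight (`b u) (`digit u))
    (Iter byB (# 0) λ x a → x `+ `weight (`b u) a `* `owned u a)

  `summand : Term
  `summand = `owned `n (# 0) `* Iter byN (# 1) λ a u → a `* `factor u

  `accumulate : Term
  `accumulate = (`acc `+ `summand) `% `Q

  `denominator : Term
  `denominator = Iter byN (# 1) λ a v → a `* Iter byβ (# 1) λ x j → x `* `if (`lt j (`b v)) (`t `* (j `+ # 1)) (# 1)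

  `modulus : Term
  `modulus = `t `* Iter byN (# 1) λ a v → a `* `pow byβ `t (`b v)

  `result : Term
  `result = `acc `% `modulus `/ `denominator

open Terms

-- Counterparts of the terms as functions on numbers. They follow the terms so closely that the
-- denotation of a term in the intended registers unfolds to them by computation, with no proof of
-- agreement.
module Spec (I : List ℕ) (n m β t Q : ℕ) where

  B P : ℕ
  B = suc β
  P = m * (n * n)

  bS : ℕ → ℕ
  bS v = peek I (2 + v)

  AS : ℕ → ℕ → ℕ
  AS F v = peek I (2 + (n + (F * n + v)))

  if₀ : ℕ → ℕ → ℕ → ℕ
  if₀ q x y = q * x + (1 ∸ q) * y

  lt₀ eq₀ : ℕ → ℕ → ℕ
  lt₀ x y = 1 ∸ (1 ∸ (y ∸ x))
  eq₀ x y = 1 ∸ ((x ∸ y) + (y ∸ x))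

  pow : ℕ → ℕ → ℕ → ℕ
  pow N x e = loop Q N 1 λ j a → a * if₀ (lt₀ j e) x 1

  bit : ℕ → ℕ → ℕ
  bit mask v = mod (apply div mask (pow n 2 v)) 2

  pop : ℕ → ℕ
  pop mask = loop Q n 0 λ v a → a + bit mask v

  open₀ : ℕ → ℕ → (ℕ → ℕ → ℕ) → ℕ
  open₀ mask p f =
    let F = apply div p (n * n)
        u = mod (apply div p n) n
        v = mod p n
    in AS F u * (AS F v * ((1 ∸ eq₀ u v) * ((1 ∸ bit mask u) * ((1 ∸ bit mask v) * f u v))))

  choice : ℕ → ℕ → ℕ → ℕ → ℕ
  choice s a u v =
    let r = apply div s (pow n 2 (pop a))
    in lt₀ 1 r * pow n 2 (if₀ (mod r 2) u v)

  cover : ℕ → ℕ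
  cover s = loop Q P 0 λ p a → a + open₀ a p (choice s a)

  uncovered : ℕ → ℕ
  uncovered mask = β * loop Q P 0 λ p a → a + open₀ mask p λ _ _ → 1

  module Sum (mask : ℕ) where

    size₀ : ℕ
    size₀ = pow n B (pop mask)

    rank : ℕ → ℕ
    rank u = loop Q n 0 λ v a → a + lt₀ v u * bit mask v

    digit₀ : ℕ → ℕ → ℕ
    digit₀ i u = mod (apply div i (pow n B (rank u))) B

    monomial₀ : ℕ → ℕ → ℕ → ℕ
    monomial₀ i F s = loop Q n 1 λ v a → a * if₀ (AS F v) (t * if₀ (bit mask v) (digit₀ i v) s) 1

    geometric₀ : ℕ → ℕ → ℕ → ℕ
    geometric₀ i F s = loop Q β 1 λ _ a → a * monomial₀ i F s + 1

    owner : ℕ → ℕ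
    owner F = loop Q n n λ v a → if₀ (AS F v * (1 ∸ bit mask v)) v a

    owned₀ : ℕ → ℕ → ℕ → ℕ
    owned₀ i u s = loop Q m 1 λ F a → a * if₀ (eq₀ (owner F) u) (geometric₀ i F s) 1

    binomial : ℕ → ℕ → ℕ
    binomial b y = loop Q β 1 λ j a → apply div (a * if₀ (lt₀ j y) (b ∸ j) (j + 1)) (j + 1)

    weight₀ : ℕ → ℕ → ℕ
    weight₀ b y = binomial b y * pow β (Q ∸ 1) (b ∸ y)

    factor₀ : ℕ → ℕ → ℕ
    factor₀ i u = if₀ (bit mask u) (weight₀ (bS u) (digit₀ i u))
      (loop Q B 0 λ a x → x + weight₀ (bS u) a * owned₀ i u a)

    summand₀ : ℕ → ℕ
    summand₀ i = owned₀ i n 0 * loop Q n 1 λ u a → a * factor₀ i u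

  denominator₀ : ℕ
  denominator₀ = loop Q n 1 λ v a → a * loop Q β 1 λ j x → x * if₀ (lt₀ j (bS v)) (t * (j + 1)) 1

  modulus₀ : ℕ
  modulus₀ = t * loop Q n 1 λ v a → a * pow β t (bS v)

  result₀ : ℕ → ℕ
  result₀ acc = apply div (mod acc modulus₀) denominator₀

  κ : Fin 5 → ℕ
  κ zero = n
  κ (suc zero) = m
  κ (suc (suc zero)) = β
  κ (suc (suc (suc zero))) = B
  κ (suc (suc (suc (suc zero)))) = P

-- Loops whose values stay below the modulus

mod-id : ∀ {x y} → x < y → mod x y ≡ x
mod-id {x} {suc y} x<y = trans (mod-% x (suc y)) (m<n⇒m%n≡m x<y)

-- For loops whose result is needed as a number and not as a residue: those that feed exponents,
-- divisors, bit tests or comparisons.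
loop-exact : ∀ {Q} N {a f} (g : ℕ → ℕ) → a ≡ g 0 → (∀ i → i ≤ N → g i < Q) →
             (∀ i → i < N → f i (g i) ≡ g (suc i)) → loop Q N a f ≡ g N
loop-exact zero    g refl g<Q step = mod-id (g<Q 0 z≤n)
loop-exact {Q} (suc N) {f = f} g a≡ g<Q step = trans
  (cong (λ x → mod (f N x) Q) (loop-exact N g a≡ (λ i i≤N → g<Q i (m≤n⇒m≤1+n i≤N)) (λ i i<N → step i (m<n⇒m<1+n i<N))))
  (trans (cong (λ x → mod x Q) (step N ≤-refl)) (mod-id (g<Q (suc N) ≤-refl)))

sumℕ-last : ∀ n f → sumℕ (suc n) f ≡ sumℕ n f + f n
sumℕ-last zero    f = +-comm (f 0) 0
sumℕ-last (suc n) f = trans (cong (f 0 +_) (sumℕ-last n (f ∘ suc))) (sym (+-assoc (f 0) _ _))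

sumℕ-mono : ∀ {m n} f → m ≤ n → sumℕ m f ≤ sumℕ n f
sumℕ-mono f z≤n       = z≤n
sumℕ-mono f (s≤s m≤n) = +-monoʳ-≤ (f 0) (sumℕ-mono (f ∘ suc) m≤n)

loop-sum : ∀ {Q} N {f} (g : ℕ → ℕ) → sumℕ N g < Q → (∀ i x → i < N → f i x ≡ x + g i) → loop Q N 0 f ≡ sumℕ N g
loop-sum N {f} g sum<Q step = loop-exact N (λ j → sumℕ j g) refl (λ i i≤N → ≤-<-trans (sumℕ-mono g i≤N) sum<Q)
  (λ i i<N → trans (step i _ i<N) (sym (sumℕ-last i g)))

𝟙-0⊎1 : ∀ {x} → x ≤ 1 → x ≡ 0 ⊎ x ≡ 1
𝟙-0⊎1 z≤n       = inj₁ refl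
𝟙-0⊎1 (s≤s z≤n) = inj₂ refl

eq-𝟙 : ∀ x y → 1 ∸ ((x ∸ y) + (y ∸ x)) ≡ 𝟙[ x ≡ᵇ y ]
eq-𝟙 zero    zero    = refl
eq-𝟙 zero    (suc y) = 0∸n≡0 y
eq-𝟙 (suc x) zero    = 0∸n≡0 (x + 0)
eq-𝟙 (suc x) (suc y) = eq-𝟙 x y

lt-𝟙 : ∀ x y → 1 ∸ (1 ∸ (y ∸ x)) ≡ 𝟙[ x <ᵇ y ]
lt-𝟙 zero    zero    = refl
lt-𝟙 zero    (suc y) = cong (1 ∸_) (0∸n≡0 y)
lt-𝟙 (suc x) zero    = refl
lt-𝟙 (suc x) (suc y) = lt-𝟙 x y

if-𝟙 : ∀ q x y → 𝟙[ q ] * x + (1 ∸ 𝟙[ q ]) * y ≡ (if q then x else y)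
if-𝟙 true  x y = trans (+-identityʳ (x + 0)) (+-identityʳ x)
if-𝟙 false x y = +-identityʳ y

<ᵇ-true : ∀ {x y} → x < y → (x <ᵇ y) ≡ true
<ᵇ-true {x} {y} x<y with x <ᵇ y | <⇒<ᵇ x<y
... | true | _ = refl

<ᵇ-false : ∀ {x y} → y ≤ x → (x <ᵇ y) ≡ false
<ᵇ-false {x} {y} y≤x with x <ᵇ y in eq
... | false = refl
... | true  = contradiction (<ᵇ⇒< x y (subst T (sym eq) tt)) (≤⇒≯ y≤x)

⊓-suc-< : ∀ {j e} → j < e → suc j ⊓ e ≡ suc (j ⊓ e)
⊓-suc-< {j} {e} j<e = trans (m≤n⇒m⊓n≡m j<e) (cong suc (sym (m≤n⇒m⊓n≡m (<⇒≤ j<e))))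

⊓-suc-≥ : ∀ {j e} → e ≤ j → suc j ⊓ e ≡ j ⊓ e
⊓-suc-≥ e≤j = trans (m≥n⇒m⊓n≡n (m≤n⇒m≤1+n e≤j)) (sym (m≥n⇒m⊓n≡n e≤j))

loop-power : ∀ {Q} N x e .{{_ : NonZero x}} → e ≤ N → x ^ e < Q →
  loop Q N 1 (λ j a → a * ((1 ∸ (1 ∸ (e ∸ j))) * x + (1 ∸ (1 ∸ (1 ∸ (e ∸ j)))) * 1)) ≡ x ^ e
loop-power {Q} N x e e≤N x^e<Q = trans
  -- The minimum expresses that the power stops growing once the index reaches `e`.
  (loop-exact N (λ j → x ^ (j ⊓ e)) refl (λ j _ → ≤-<-trans (^-monoʳ-≤ x (m⊓n≤n j e)) x^e<Q) step)
  (cong (x ^_) (m≥n⇒m⊓n≡n e≤N))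
  where
  step : ∀ j → j < N → x ^ (j ⊓ e) * ((1 ∸ (1 ∸ (e ∸ j))) * x + (1 ∸ (1 ∸ (1 ∸ (e ∸ j)))) * 1) ≡ x ^ (suc j ⊓ e)
  step j _ rewrite lt-𝟙 j e | if-𝟙 (j <ᵇ e) x 1 with j <? e
  ... | yes j<e rewrite <ᵇ-true j<e | ⊓-suc-< j<e = *-comm _ x
  ... | no j≮e rewrite <ᵇ-false (≮⇒≥ j≮e) | ⊓-suc-≥ {j} (≮⇒≥ j≮e) = *-identityʳ _

-- Binomial coefficients

choose : ℕ → ℕ → ℕ
choose _       zero    = 1
choose zero    (suc y) = 0
choose (suc b) (suc y) = choose b y + choose b (suc y)

choose-> : ∀ b y → b < y → choose b y ≡ 0
choose-> zero    (suc y) _         = refl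
choose-> (suc b) (suc y) (s≤s b<y) = cong₂ _+_ (choose-> b y b<y) (choose-> b (suc y) (m<n⇒m<1+n b<y))

-- Both sides count (y+1)-subsets with a marked element, and both vanish for y ≥ b, where the
-- subtraction is truncated. This makes the divisions in `binomial` exact.
choose-absorb : ∀ b y → choose b y * (b ∸ y) ≡ choose b (suc y) * suc y
choose-absorb zero    zero    = refl
choose-absorb zero    (suc y) = refl
choose-absorb (suc b) zero    = cong suc (trans (+-identityʳ b) (trans (trans (sym (+-identityʳ b)) (choose-absorb b 0)) refl))
choose-absorb (suc b) (suc y) with y <? b
... | yes y<b = begin
  (p + q) * (b ∸ y)                   ≡⟨ *-distribʳ-+ (b ∸ y) p q ⟩
  p * (b ∸ y) + q * (b ∸ y)           ≡⟨ cong₂ _+_ (choose-absorb b y) (cong (q *_) (+-∸-assoc 1 y<b)) ⟩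
  q * suc y + q * suc (b ∸ suc y)     ≡⟨ cong (q * suc y +_) (trans (*-suc q (b ∸ suc y)) (cong (q +_) (choose-absorb b (suc y)))) ⟩
  q * suc y + (q + r * suc (suc y))   ≡⟨ regroup q r y ⟩
  (q + r) * suc (suc y)               ∎
  where
  open ≡-Reasoning
  p = choose b y
  q = choose b (suc y)
  r = choose b (suc (suc y))
  regroup : ∀ q r y → q * suc y + (q + r * suc (suc y)) ≡ (q + r) * suc (suc y)
  regroup = solve-∀
... | no y≮b rewrite choose-> b (suc y) (s≤s (≮⇒≥ y≮b)) | choose-> b (suc (suc y)) (m<n⇒m<1+n (s≤s (≮⇒≥ y≮b)))
                   | m≤n⇒m∸n≡0 (≮⇒≥ y≮b) = *-zeroʳ (choose b y + 0)

choose-≤ : ∀ b y → choose b y ≤ 2 ^ b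
choose-≤ b       zero    = m^n>0 2 b
choose-≤ zero    (suc y) = z≤n
choose-≤ (suc b) (suc y) = +-mono-≤ (choose-≤ b y) (≤-trans (choose-≤ b (suc y)) (m≤m+n (2 ^ b) 0))

weight-choose : ∀ b y → weight b y ≡ ⁺ choose b y ⊗ -1ℤ ↑ (b ∸ y)
weight-choose zero    zero    = refl
weight-choose zero    (suc y) = refl
weight-choose (suc b) zero    = trans (cong ⊝_ (weight-choose b zero)) (flip (-1ℤ ↑ b))
  where
  flip : ∀ s → ⊝ (1ℤ ⊗ s) ≡ 1ℤ ⊗ (-1ℤ ⊗ s)
  flip = ℤ-solver.solve-∀
weight-choose (suc b) (suc y) with y <? b
... | yes y<b = begin
  weight b y ⊖ weight b (suc y)
    ≡⟨ cong₂ _⊖_ (weight-choose b y) (weight-choose b (suc y)) ⟩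
  ⁺ choose b y ⊗ -1ℤ ↑ (b ∸ y) ⊖ ⁺ choose b (suc y) ⊗ -1ℤ ↑ (b ∸ suc y)
    ≡⟨ cong (λ k → ⁺ choose b y ⊗ -1ℤ ↑ k ⊖ ⁺ choose b (suc y) ⊗ -1ℤ ↑ (b ∸ suc y)) (+-∸-assoc 1 y<b) ⟩
  ⁺ choose b y ⊗ (-1ℤ ⊗ -1ℤ ↑ (b ∸ suc y)) ⊖ ⁺ choose b (suc y) ⊗ -1ℤ ↑ (b ∸ suc y)
    ≡⟨ collect (⁺ choose b y) (⁺ choose b (suc y)) (-1ℤ ↑ (b ∸ suc y)) ⟩
  (⁺ choose b y ⊕ ⁺ choose b (suc y)) ⊗ (-1ℤ ⊗ -1ℤ ↑ (b ∸ suc y))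
    ≡⟨ cong₂ (λ x k → x ⊗ -1ℤ ↑ k) (sym (ℤₚ.pos-+ (choose b y) (choose b (suc y)))) (sym (+-∸-assoc 1 y<b)) ⟩
  ⁺ choose (suc b) (suc y) ⊗ -1ℤ ↑ (b ∸ y) ∎
  where
  open ≡-Reasoning
  collect : ∀ p q s → p ⊗ (-1ℤ ⊗ s) ⊖ q ⊗ s ≡ (p ⊕ q) ⊗ (-1ℤ ⊗ s)
  collect = ℤ-solver.solve-∀
... | no y≮b rewrite weight-> b (suc y) (s≤s (≮⇒≥ y≮b)) | choose-> b (suc y) (s≤s (≮⇒≥ y≮b)) | +-identityʳ (choose b y) =
  trans (ℤₚ.+-identityʳ (weight b y)) (weight-choose b y)

-- Residues

-- Congruence modulo Q of a machine number with an integer. The signed quotient is kept, because the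
-- final division reuses it modulo a divisor of Q.
record Represents (Q : ℕ) (x : ℕ) (z : ℤ) : Set where
  constructor represents
  field
    quotient : ℤ
    equation : ⁺ x ≡ z ⊕ quotient ⊗ ⁺ Q

module Residue (Q : ℕ) .{{_ : NonZero Q}} where

  infix 4 _≋_
  _≋_ : ℕ → ℤ → Set
  _≋_ = Represents Q

  ≋-refl : ∀ {x} → x ≋ ⁺ x
  ≋-refl = represents 0ℤ (sym (ℤₚ.+-identityʳ _))

  ≋-pos : ∀ {x z} → z ≡ ⁺ x → x ≋ z
  ≋-pos refl = ≋-refl

  ≋-subst : ∀ {x y z w} → x ≡ y → z ≡ w → x ≋ z → y ≋ w
  ≋-subst refl refl r = r

  ≋-+ : ∀ {x y z w} → x ≋ z → y ≋ w → x + y ≋ z ⊕ w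
  ≋-+ {x} {y} {z} {w} (represents k e) (represents l f) =
    represents (k ⊕ l) (trans (ℤₚ.pos-+ x y) (trans (cong₂ _⊕_ e f) (regroup z w k l (⁺ Q))))
    where
    regroup : ∀ z w k l q → z ⊕ k ⊗ q ⊕ (w ⊕ l ⊗ q) ≡ z ⊕ w ⊕ (k ⊕ l) ⊗ q
    regroup = ℤ-solver.solve-∀

  ≋-* : ∀ {x y z w} → x ≋ z → y ≋ w → x * y ≋ z ⊗ w
  ≋-* {x} {y} {z} {w} (represents k e) (represents l f) =
    represents (z ⊗ l ⊕ k ⊗ w ⊕ k ⊗ l ⊗ ⁺ Q) (trans (ℤₚ.pos-* x y) (trans (cong₂ _⊗_ e f) (regroup z w k l (⁺ Q))))
    where
    regroup : ∀ z w k l q → (z ⊕ k ⊗ q) ⊗ (w ⊕ l ⊗ q) ≡ z ⊗ w ⊕ (z ⊗ l ⊕ k ⊗ w ⊕ k ⊗ l ⊗ q) ⊗ q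
    regroup = ℤ-solver.solve-∀

  ≋-mod : ∀ {x z} → x ≋ z → mod x Q ≋ z
  ≋-mod {x} {z} (represents k e) = represents (k ⊖ ⁺ (x / Q)) (begin
    ⁺ mod x Q                                          ≡⟨ cong ⁺_ (mod-% x Q) ⟩
    ⁺ (x % Q)                                          ≡⟨ cancel (⁺ (x % Q)) (⁺ (x / Q)) (⁺ Q) ⟩
    (⁺ (x % Q) ⊕ ⁺ (x / Q) ⊗ ⁺ Q) ⊖ ⁺ (x / Q) ⊗ ⁺ Q   ≡⟨ cong (_⊖ ⁺ (x / Q) ⊗ ⁺ Q) (trans (cong (⁺ (x % Q) ⊕_) (sym (ℤₚ.pos-* (x / Q) Q))) (trans (sym (ℤₚ.pos-+ (x % Q) (x / Q * Q))) (cong ⁺_ (sym (m≡m%n+[m/n]*n x Q))))) ⟩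
    ⁺ x ⊖ ⁺ (x / Q) ⊗ ⁺ Q                              ≡⟨ cong (_⊖ ⁺ (x / Q) ⊗ ⁺ Q) e ⟩
    (z ⊕ k ⊗ ⁺ Q) ⊖ ⁺ (x / Q) ⊗ ⁺ Q                    ≡⟨ regroup z k (⁺ (x / Q)) (⁺ Q) ⟩
    z ⊕ (k ⊖ ⁺ (x / Q)) ⊗ ⁺ Q                          ∎)
    where
    open ≡-Reasoning
    cancel : ∀ a b q → a ≡ (a ⊕ b ⊗ q) ⊖ b ⊗ q
    cancel = ℤ-solver.solve-∀
    regroup : ∀ z k l q → (z ⊕ k ⊗ q) ⊖ l ⊗ q ≡ z ⊕ (k ⊖ l) ⊗ q
    regroup = ℤ-solver.solve-∀

  ≋-minus-one : Q ∸ 1 ≋ -1ℤ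
  ≋-minus-one = represents 1ℤ (equation Q)
    where
    equation : ∀ q .{{_ : NonZero q}} → ⁺ (q ∸ 1) ≡ -1ℤ ⊕ 1ℤ ⊗ ⁺ q
    equation (suc q) = sym (cong (-1ℤ ⊕_) (ℤₚ.*-identityˡ (⁺ suc q)))

  loop-∏ : ∀ N {f} (h : ℕ → ℕ) (g : ℕ → ℤ) → (∀ i x → i < N → f i x ≡ x * h i) → (∀ i → i < N → h i ≋ g i) → loop Q N 1 f ≋ ∏ N g
  loop-∏ zero h g step each = ≋-mod ≋-refl
  loop-∏ (suc N) h g step each = ≋-mod (≋-subst (sym (step N _ ≤-refl)) (sym (∏-last N g))
    (≋-* (loop-∏ N h g (λ i x i<N → step i x (m<n⇒m<1+n i<N)) (λ i i<N → each i (m<n⇒m<1+n i<N))) (each N ≤-refl)))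

  loop-∑ : ∀ N {f} (h : ℕ → ℕ) (g : ℕ → ℤ) → (∀ i x → i < N → f i x ≡ x + h i) → (∀ i → i < N → h i ≋ g i) → loop Q N 0 f ≋ ∑ N g
  loop-∑ zero h g step each = ≋-mod ≋-refl
  loop-∑ (suc N) h g step each = ≋-mod (≋-subst (sym (step N _ ≤-refl)) (sym (∑-last N g))
    (≋-+ (loop-∑ N h g (λ i x i<N → step i x (m<n⇒m<1+n i<N)) (λ i i<N → each i (m<n⇒m<1+n i<N))) (each N ≤-refl)))

  -- Horner's rule: N passes give N + 1 terms, which is why β passes cover all exponents below B.
  loop-geometric : ∀ N {x z} → x ≋ z → loop Q N 1 (λ _ a → a * x + 1) ≋ ∑ (suc N) (λ j → z ↑ j)
  loop-geometric zero    x≋z = ≋-mod ≋-refl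
  loop-geometric (suc N) {x} {z} x≋z = ≋-mod (≋-subst (+-comm 1 _) horner (≋-+ {1} ≋-refl (≋-* (loop-geometric N x≋z) x≋z)))
    where
    horner : 1ℤ ⊕ ∑ (suc N) (λ j → z ↑ j) ⊗ z ≡ ∑ (suc (suc N)) (λ j → z ↑ j)
    horner = cong (1ℤ ⊕_) (trans (ℤₚ.*-comm _ z) (sym (∑-⊗ˡ (suc N) z (λ j → z ↑ j))))

  ∏-power : ∀ N e (z : ℤ) → e ≤ N → ∏ N (λ j → if j <ᵇ e then z else 1ℤ) ≡ z ↑ e
  ∏-power N       zero    z _         = ∏-one N
  ∏-power (suc N) (suc e) z (s≤s e≤N) = cong (z ⊗_) (∏-power N e z e≤N)

  loop-power-≋ : ∀ N {x z} e → x ≋ z → e ≤ N →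
    loop Q N 1 (λ j a → a * ((1 ∸ (1 ∸ (e ∸ j))) * x + (1 ∸ (1 ∸ (1 ∸ (e ∸ j)))) * 1)) ≋ z ↑ e
  loop-power-≋ N {x} {z} e x≋z e≤N = ≋-subst refl (∏-power N e z e≤N)
    (loop-∏ N (λ j → if j <ᵇ e then x else 1) (λ j → if j <ᵇ e then z else 1ℤ) (λ j a _ → cong (a *_) (trans (cong (λ q → q * x + (1 ∸ q) * 1) (lt-𝟙 j e)) (if-𝟙 (j <ᵇ e) x 1)))
      (λ j _ → if-≋ (j <ᵇ e)))
    where
    if-≋ : ∀ q → (if q then x else 1) ≋ (if q then z else 1ℤ)
    if-≋ true  = x≋z
    if-≋ false = ≋-refl

-- Correctness of the program's expressions

testBit : ℕ → ℕ → ℕ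
testBit mask v = mod (apply div mask (2 ^ v)) 2

member : ℕ → ℕ → Bool
member mask v = testBit mask v ≡ᵇ 1

testBit-χ : ∀ mask v → testBit mask v ≡ χ (member mask) v
testBit-χ mask v with testBit mask v | mod-< (apply div mask (2 ^ v)) 2
... | zero  | _ = refl
... | suc zero | _ = refl
... | suc (suc _) | s≤s (s≤s ())

χ-≤1 : ∀ c v → χ c v ≤ 1
χ-≤1 c v with c v
... | true  = ≤-refl
... | false = z≤n

rank-≤ : ∀ n c → sumℕ n (χ c) ≤ n
rank-≤ n c = subst (sumℕ n (χ c) ≤_) (*-identityʳ n) (sumℕ-≤ n (χ c) 1 (λ v _ → χ-≤1 c v))

module Correct (I : List ℕ) (n m β t Q : ℕ) .{{_ : NonZero Q}}
  (n<Q : n < Q) (2^n<Q : 2 ^ n < Q) (B^n<Q : suc β ^ n < Q) (2^β<Q : 2 ^ β < Q) (P<Q : m * (n * n) < Q)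
  (b≤β : ∀ v → v < n → peek I (2 + v) ≤ β)
  (A≤1 : ∀ F v → F < m → v < n → peek I (2 + (n + (F * n + v))) ≤ 1) where

  open Spec I n m β t Q
  open Residue Q

  pow2-exact : ∀ v → v ≤ n → pow n 2 v ≡ 2 ^ v
  pow2-exact v v≤n = loop-power n 2 v v≤n (≤-<-trans (^-monoʳ-≤ 2 v≤n) 2^n<Q)

  bit-exact : ∀ mask v → v ≤ n → bit mask v ≡ χ (member mask) v
  bit-exact mask v v≤n = trans (cong (λ x → mod (apply div mask x) 2) (pow2-exact v v≤n)) (testBit-χ mask v)

  pop-exact : ∀ mask → pop mask ≡ sumℕ n (χ (member mask))
  pop-exact mask = loop-sum n (χ (member mask)) (≤-<-trans (rank-≤ n (member mask)) n<Q)
    (λ v a v<n → cong (λ x → a + x) (bit-exact mask v (<⇒≤ v<n)))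

  b<B : ∀ v → v < n → bS v < suc β
  b<B v v<n = s≤s (b≤β v v<n)

  binomial-exact : ∀ mask b y → b ≤ β → y ≤ β → Sum.binomial mask b y ≡ choose b y
  binomial-exact mask b y b≤β y≤β = trans
    (loop-exact β (λ j → choose b (j ⊓ y)) refl (λ j _ → ≤-<-trans (≤-trans (choose-≤ b (j ⊓ y)) (^-monoʳ-≤ 2 b≤β)) 2^β<Q) step)
    (cong (choose b) (m≥n⇒m⊓n≡n y≤β))
    where
    step : ∀ j → j < β → apply div (choose b (j ⊓ y) * if₀ (lt₀ j y) (b ∸ j) (j + 1)) (j + 1) ≡ choose b (suc j ⊓ y)
    step j _ rewrite +-comm j 1 | lt-𝟙 j y | if-𝟙 (j <ᵇ y) (b ∸ j) (suc j) with j <? y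
    ... | yes j<y rewrite <ᵇ-true j<y | ⊓-suc-< j<y | m≤n⇒m⊓n≡m (<⇒≤ j<y) | choose-absorb b j = m*n/n≡m (choose b (suc j)) (suc j)
    ... | no j≮y rewrite <ᵇ-false (≮⇒≥ j≮y) | ⊓-suc-≥ {j} (≮⇒≥ j≮y) = m*n/n≡m _ (suc j)

  weight-≋ : ∀ mask b y → b ≤ β → y ≤ β → Sum.weight₀ mask b y ≋ weight b y
  weight-≋ mask b y b≤β y≤β = ≋-subst refl (sym (weight-choose b y))
    (≋-* (≋-pos (cong ⁺_ (sym (binomial-exact mask b y b≤β y≤β))))
         (loop-power-≋ β (b ∸ y) ≋-minus-one (≤-trans (m∸n≤m b y) b≤β)))

  module Summation (mask : ℕ) where

    open Sum mask

    c : ℕ → Bool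
    c = member mask

    owner-step : ∀ F v a → F < m → v < n → if₀ (AS F v * (1 ∸ bit mask v)) v a ≡ (if (AS F v ≡ᵇ 1) ∧ not (c v) then v else a)
    owner-step F v a F<m v<n rewrite bit-exact mask v (<⇒≤ v<n) with 𝟙-0⊎1 (A≤1 F v F<m v<n) | c v
    ... | inj₁ A≡0 | q rewrite A≡0 = +-identityʳ a
    ... | inj₂ A≡1 | true rewrite A≡1 = +-identityʳ a
    ... | inj₂ A≡1 | false rewrite A≡1 = trans (+-identityʳ (v + 0)) (+-identityʳ v)

    ownerᶠ : ℕ → ℕ → ℕ
    ownerᶠ F zero    = n
    ownerᶠ F (suc v) = if (AS F v ≡ᵇ 1) ∧ not (c v) then v else ownerᶠ F v

    ownerᶠ-≤ : ∀ F v → v ≤ n → ownerᶠ F v ≤ n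
    ownerᶠ-≤ F zero    _     = ≤-refl
    ownerᶠ-≤ F (suc v) v<n with (AS F v ≡ᵇ 1) ∧ not (c v)
    ... | true  = <⇒≤ v<n
    ... | false = ownerᶠ-≤ F v (<⇒≤ v<n)

    owner-exact : ∀ F → F < m → owner F ≡ ownerᶠ F n
    owner-exact F F<m = loop-exact n (ownerᶠ F) refl (λ v v≤n → ≤-<-trans (ownerᶠ-≤ F v v≤n) n<Q)
      (λ v v<n → owner-step F v (ownerᶠ F v) F<m v<n)

    data Owner (F : ℕ) (v : ℕ) : ℕ → Set where
      none : (∀ u → u < v → AS F u ≡ 1 → c u ≡ true) → Owner F v n
      some : ∀ {u} → u < v → AS F u ≡ 1 → c u ≡ false → Owner F v u

    ownerᶠ-view : ∀ F v → Owner F v (ownerᶠ F v)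
    ownerᶠ-view F zero = none (λ u ())
    ownerᶠ-view F (suc v) with AS F v ≡ᵇ 1 in A-eq | c v in c-eq | ownerᶠ F v | ownerᶠ-view F v
    ... | true  | false | _ | _ = some ≤-refl (≡ᵇ-true⇒≡ _ 1 A-eq) c-eq
    ... | true  | true  | _ | some u<v Au cu = some (m<n⇒m<1+n u<v) Au cu
    ... | false | _     | _ | some u<v Au cu = some (m<n⇒m<1+n u<v) Au cu
    ... | true  | true  | _ | none all = none λ u u<1+v Au → extend u u<1+v Au (λ { refl → c-eq })
      where
      extend : ∀ u → u < suc v → AS F u ≡ 1 → (u ≡ v → c u ≡ true) → c u ≡ true
      extend u u<1+v Au at-v with u ≟ v
      ... | yes u≡v = at-v u≡v
      ... | no u≢v  = all u (≤∧≢⇒< (s≤s⁻¹ u<1+v) u≢v) Au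
    ... | false | _ | _ | none all = none λ u u<1+v Au → extend u u<1+v Au
      where
      extend : ∀ u → u < suc v → AS F u ≡ 1 → c u ≡ true
      extend u u<1+v Au with u ≟ v
      ... | no u≢v  = all u (≤∧≢⇒< (s≤s⁻¹ u<1+v) u≢v) Au
      ... | yes refl with trans (sym A-eq) (cong (_≡ᵇ 1) Au)
      ...   | ()

    owner-view : ∀ F → F < m → Owner F n (owner F)
    owner-view F F<m = subst (Owner F n) (sym (owner-exact F F<m)) (ownerᶠ-view F n)

    rank-exact : ∀ u → u ≤ n → rank u ≡ sumℕ u (χ c)
    rank-exact u u≤n = trans
      (loop-exact n (λ j → sumℕ (j ⊓ u) (χ c)) refl
        (λ j _ → ≤-<-trans (≤-trans (rank-≤ (j ⊓ u) c) (≤-trans (m⊓n≤n j u) u≤n)) n<Q) step)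
      (cong (λ k → sumℕ k (χ c)) (m≥n⇒m⊓n≡n u≤n))
      where
      step : ∀ j → j < n → sumℕ (j ⊓ u) (χ c) + lt₀ j u * bit mask j ≡ sumℕ (suc j ⊓ u) (χ c)
      step j j<n rewrite lt-𝟙 j u | bit-exact mask j (<⇒≤ j<n) with j <? u
      ... | yes j<u rewrite <ᵇ-true j<u | ⊓-suc-< j<u | m≤n⇒m⊓n≡m (<⇒≤ j<u) | +-identityʳ (χ c j) = sym (sumℕ-last j (χ c))
      ... | no j≮u rewrite <ᵇ-false (≮⇒≥ j≮u) | ⊓-suc-≥ {j} (≮⇒≥ j≮u) = +-identityʳ _

    powB-exact : ∀ r → r ≤ n → pow n B r ≡ B ^ r
    powB-exact r r≤n = loop-power n B r r≤n (≤-<-trans (^-monoʳ-≤ B r≤n) B^n<Q)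

    size-exact : size₀ ≡ B ^ sumℕ n (χ c)
    size-exact = trans (cong (pow n B) (pop-exact mask)) (powB-exact _ (rank-≤ n c))

    open Digits β

    digit-exact : ∀ i u → u ≤ n → digit₀ i u ≡ digit c i u
    digit-exact i u u≤n = cong (λ x → mod (apply div i x) B)
      (trans (cong (pow n B) (rank-exact u u≤n)) (powB-exact _ (≤-trans (rank-≤ u c) u≤n)))

    open Factorisation β (⁺ t) n m AS bS b<B c owner
    open Ryser B (⁺ t)
    open Formula n m AS bS b<B

    monomial-≋ : ∀ i F s → F < m → monomial₀ i F s ≋ monomial (merge i s) F
    monomial-≋ i F s F<m = loop-∏ n (λ v → if₀ (AS F v) (t * if₀ (bit mask v) (digit₀ i v) s) 1) (λ v → (⁺ t ⊗ ⁺ merge i s v) ↑ AS F v)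
      (λ v a _ → refl) each
      where
      coordinate : ∀ v → v < n → if₀ (bit mask v) (digit₀ i v) s ≡ merge i s v
      coordinate v v<n rewrite bit-exact mask v (<⇒≤ v<n) | digit-exact i v (<⇒≤ v<n) = if-𝟙 (c v) (digit c i v) s
      each : ∀ v → v < n → if₀ (AS F v) (t * if₀ (bit mask v) (digit₀ i v) s) 1 ≋ (⁺ t ⊗ ⁺ merge i s v) ↑ AS F v
      each v v<n rewrite coordinate v v<n with 𝟙-0⊎1 (A≤1 F v F<m v<n)
      ... | inj₁ A≡0 rewrite A≡0 = ≋-refl
      ... | inj₂ A≡1 rewrite A≡1 = ≋-subst (sym (if-𝟙 true (t * merge i s v) 1)) (sym (ℤₚ.*-identityʳ (⁺ t ⊗ ⁺ merge i s v))) (≋-* (≋-refl {t}) (≋-refl {merge i s v}))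

    geometric-≋ : ∀ i F s → F < m → geometric₀ i F s ≋ geometric (merge i s) F
    geometric-≋ i F s F<m = loop-geometric β (monomial-≋ i F s F<m)

    owned-≋ : ∀ i u s → owned₀ i u s ≋ owned i u s
    owned-≋ i u s = loop-∏ m (λ F → if₀ (eq₀ (owner F) u) (geometric₀ i F s) 1) (λ F → if owner F ≡ᵇ u then geometric (merge i s) F else 1ℤ)
      (λ F a _ → refl) each
      where
      each : ∀ F → F < m → if₀ (eq₀ (owner F) u) (geometric₀ i F s) 1 ≋ (if owner F ≡ᵇ u then geometric (merge i s) F else 1ℤ)
      each F F<m = ≋-subst (sym (trans (cong (λ q → if₀ q (geometric₀ i F s) 1) (eq-𝟙 (owner F) u)) (if-𝟙 (owner F ≡ᵇ u) _ 1))) refl (case (owner F ≡ᵇ u))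
        where
        case : ∀ q → (if q then geometric₀ i F s else 1) ≋ (if q then geometric (merge i s) F else 1ℤ)
        case true  = geometric-≋ i F s F<m
        case false = ≋-refl

    factor-≋ : ∀ i u → u < n → factor₀ i u ≋ factor i u
    factor-≋ i u u<n = ≋-subst (sym (trans (cong (λ q → if₀ q (weight₀ (bS u) (digit₀ i u)) sum₀) (bit-exact mask u (<⇒≤ u<n))) (if-𝟙 (c u) (weight₀ (bS u) (digit₀ i u)) sum₀))) refl (case (c u))
      where
      sum₀ = loop Q B 0 λ a x → x + weight₀ (bS u) a * owned₀ i u a
      sum = ∑ B (λ a → weight (bS u) a ⊗ owned i u a)
      sum-≋ : sum₀ ≋ sum
      sum-≋ = loop-∑ B (λ a → weight₀ (bS u) a * owned₀ i u a) (λ a → weight (bS u) a ⊗ owned i u a) (λ a x _ → refl)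
        (λ a a<B → ≋-* (weight-≋ mask (bS u) a (b≤β u u<n) (s≤s⁻¹ a<B)) (owned-≋ i u a))
      case : ∀ q → (if q then weight₀ (bS u) (digit₀ i u) else sum₀) ≋ (if q then weight (bS u) (digit c i u) else sum)
      case true  = ≋-subst (cong (weight₀ (bS u)) (sym (digit-exact i u (<⇒≤ u<n)))) refl
                     (weight-≋ mask (bS u) (digit c i u) (b≤β u u<n) (s≤s⁻¹ (digit-< c i u)))
      case false = sum-≋

    summand-≋ : ∀ i → summand₀ i ≋ summand i
    summand-≋ i = ≋-* (owned-≋ i n 0) (loop-∏ n (factor₀ i) (factor i) (λ u a _ → refl) (factor-≋ i))

    -- The sum has only one term when β = 0, so no independence is needed then.
    Strong : Set
    Strong = β ≡ 0 ⊎ (∀ F u v → F < m → u < n → v < n → AS F u ≡ 1 → AS F v ≡ 1 → c u ≡ false → c v ≡ false → u ≡ v)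

    owner≤n : ∀ F → F < m → owner F ≤ n
    owner≤n F F<m = subst (_≤ n) (sym (owner-exact F F<m)) (ownerᶠ-≤ F n ≤-refl)

    owner∉c : ∀ F u → F < m → u < n → c u ≡ true → owner F ≢ u
    owner∉c F u F<m u<n cu own with owner F | owner-view F F<m
    ... | _ | none _       = contradiction (sym own) (<⇒≢ u<n)
    ... | _ | some _ _ cu′ with trans (sym cu) (trans (cong c (sym own)) cu′)
    ...   | ()

    merge-owner : Strong → ∀ F i (z : ℕ → ℕ) → F < m → (∀ v → v < n → c v ≡ true → z v ≡ digit c i v) →
      geometric (merge i (if owner F ≡ᵇ n then 0 else z (owner F))) F ≡ geometric z F
    merge-owner (inj₁ β≡0) F i z F<m agree′ = cong (λ β → ∑ (suc β) (λ j → monomial (merge i (if owner F ≡ᵇ n then 0 else z (owner F))) F ↑ j)) β≡0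
                    ⟨trans⟩ sym (cong (λ β → ∑ (suc β) (λ j → monomial z F ↑ j)) β≡0)
      where _⟨trans⟩_ = trans
    merge-owner (inj₂ independent) F i z F<m agree′ = cong (λ x → ∑ B (λ j → x ↑ j)) (∏-cong n each)
      where
      each : ∀ v → v < n → (⁺ t ⊗ ⁺ merge i (if owner F ≡ᵇ n then 0 else z (owner F)) v) ↑ AS F v ≡ (⁺ t ⊗ ⁺ z v) ↑ AS F v
      each v v<n with 𝟙-0⊎1 (A≤1 F v F<m v<n)
      ... | inj₁ A≡0 rewrite A≡0 = refl
      ... | inj₂ A≡1 = cong (λ x → (⁺ t ⊗ ⁺ x) ↑ AS F v) (coordinate (c v) refl)
        where
        coordinate : ∀ q → c v ≡ q → (if q then digit c i v else (if owner F ≡ᵇ n then 0 else z (owner F))) ≡ z v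
        coordinate true  cv = sym (agree′ v v<n cv)
        coordinate false cv with owner F | owner-view F F<m
        ... | _ | none all with trans (sym cv) (all v v<n A≡1)
        ...   | ()
        -- Both `v` and the owner `u` lie in the hyperedge and outside C, so independence identifies
        -- them.
        coordinate false cv | u | some u<n Au cu
          rewrite ≢⇒≡ᵇ-false u n (<⇒≢ u<n) = cong z (independent F u v F<m u<n v<n Au A≡1 cu cv)

    summation : Strong → ∑ size₀ summand ≡ ryser
    summation strong = trans (cong (λ X → ∑ X summand) size-exact) (summand-sum owner≤n owner∉c (merge-owner strong))

-- The final division

prodℕ : ℕ → (ℕ → ℕ) → ℕ
prodℕ zero    f = 1
prodℕ (suc n) f = f 0 * prodℕ n (f ∘ suc)

∏-pos : ∀ n f → ∏ n (λ i → ⁺ f i) ≡ ⁺ prodℕ n f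
∏-pos zero    f = refl
∏-pos (suc n) f = trans (cong (⁺ f 0 ⊗_) (∏-pos n (f ∘ suc))) (sym (ℤₚ.pos-* (f 0) _))

pos-^ : ∀ a n → (⁺ a) ↑ n ≡ ⁺ (a ^ n)
pos-^ a zero    = refl
pos-^ a (suc n) = trans (cong (⁺ a ⊗_) (pos-^ a n)) (sym (ℤₚ.pos-* a (a ^ n)))

prodℕ-≤ : ∀ n f c → (∀ i → i < n → f i ≤ c) → prodℕ n f ≤ c ^ n
prodℕ-≤ zero    f c f≤c = ≤-refl
prodℕ-≤ (suc n) f c f≤c = *-mono-≤ (f≤c 0 z<s) (prodℕ-≤ n (f ∘ suc) c (λ i i<n → f≤c (suc i) (s<s i<n)))

prodℕ->0 : ∀ n f → (∀ i → i < n → 0 < f i) → 0 < prodℕ n f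
prodℕ->0 zero    f f>0 = z<s
prodℕ->0 (suc n) f f>0 = *-mono-≤ (f>0 0 z<s) (prodℕ->0 n (f ∘ suc) (λ i i<n → f>0 (suc i) (s<s i<n)))

factorial-≤ : ∀ b β → b ≤ β → b ! ≤ suc β ^ b
factorial-≤ zero    β b≤β = ≤-refl
factorial-≤ (suc b) β b<β = *-mono-≤ (m≤n⇒m≤1+n b<β) (factorial-≤ b β (<⇒≤ b<β))

factorial->0 : ∀ b → 0 < b !
factorial->0 zero    = z<s
factorial->0 (suc b) = ≤-trans (factorial->0 b) (m≤m+n (b !) (b * b !))

∏-guard : ∀ N b (f : ℕ → ℤ) → b ≤ N → ∏ N (λ j → if j <ᵇ b then f j else 1ℤ) ≡ ∏ b f
∏-guard N       zero    f _         = ∏-one N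
∏-guard (suc N) (suc b) f (s≤s b≤N) = cong (f 0 ⊗_) (∏-guard N b (f ∘ suc) b≤N)

∏-factorial : ∀ t b → ∏ b (λ j → t ⊗ ⁺ (j + 1)) ≡ t ↑ b ⊗ ⁺ (b !)
∏-factorial t zero    = refl
∏-factorial t (suc b) = begin
  ∏ (suc b) (λ j → t ⊗ ⁺ (j + 1))         ≡⟨ ∏-last b _ ⟩
  ∏ b (λ j → t ⊗ ⁺ (j + 1)) ⊗ (t ⊗ ⁺ (b + 1)) ≡⟨ cong₂ (λ x y → x ⊗ (t ⊗ ⁺ y)) (∏-factorial t b) (+-comm b 1) ⟩
  t ↑ b ⊗ ⁺ (b !) ⊗ (t ⊗ ⁺ suc b)          ≡⟨ regroup (t ↑ b) (⁺ (b !)) t (⁺ suc b) ⟩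
  t ⊗ t ↑ b ⊗ (⁺ suc b ⊗ ⁺ (b !))          ≡⟨ cong (t ⊗ t ↑ b ⊗_) (ℤₚ.pos-* (suc b) (b !)) ⟨
  t ↑ suc b ⊗ ⁺ (suc b !)                 ∎
  where
  open ≡-Reasoning
  regroup : ∀ p f t s → p ⊗ f ⊗ (t ⊗ s) ≡ t ⊗ p ⊗ (s ⊗ f)
  regroup = ℤ-solver.solve-∀

-- A negative quotient cannot occur: moving its multiple of `K` to the other side would exhibit `y`
-- as a sum of naturals that is at least `K`.
residue-unique : ∀ {x y K} .{{_ : NonZero K}} r → ⁺ x ≡ ⁺ y ⊕ r ⊗ ⁺ K → y < K → mod x K ≡ y
residue-unique {x} {y} {K} (⁺ k) eq y<K = begin
  mod x K            ≡⟨ mod-% x K ⟩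
  x % K              ≡⟨ cong (_% K) (ℤₚ.+-injective (trans eq (trans (cong (⁺ y ⊕_) (sym (ℤₚ.pos-* k K))) (sym (ℤₚ.pos-+ y (k * K)))))) ⟩
  (y + k * K) % K    ≡⟨ [m+kn]%n≡m%n y k K ⟩
  y % K              ≡⟨ m<n⇒m%n≡m y<K ⟩
  y                  ∎
  where open ≡-Reasoning
residue-unique {x} {y} {K} -[1+ k ] eq y<K = contradiction y<K (≤⇒≯ (subst (K ≤_) total (≤-trans (m≤m+n K (k * K)) (m≤n+m (suc k * K) x))))
  where
  total : x + suc k * K ≡ y
  total = ℤₚ.+-injective (begin
    ⁺ (x + suc k * K)                           ≡⟨ ℤₚ.pos-+ x (suc k * K) ⟩
    ⁺ x ⊕ ⁺ (suc k * K)                         ≡⟨ cong₂ _⊕_ eq (ℤₚ.pos-* (suc k) K) ⟩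
    ⁺ y ⊕ -[1+ k ] ⊗ ⁺ K ⊕ ⁺ suc k ⊗ ⁺ K        ≡⟨ cancel (⁺ y) (⁺ suc k) (⁺ K) ⟩
    ⁺ y                                         ∎)
    where
    open ≡-Reasoning
    cancel : ∀ y k K → y ⊕ ⊝ k ⊗ K ⊕ k ⊗ K ≡ y
    cancel = ℤ-solver.solve-∀

demand : List ℕ → ℕ → ℕ
demand I n = sumℕ n (λ v → peek I (2 + v))

module Division (I : List ℕ) (n m β t Q k : ℕ) .{{_ : NonZero Q}} .{{_ : NonZero t}}
  (b≤β : ∀ v → v < n → peek I (2 + v) ≤ β)
  (N : ℕ) (N-small : N * prodℕ n (λ v → peek I (2 + v) !) < t)
  (Q-factor : Q ≡ t ^ suc (demand I n) * k) (K<Q : t ^ suc (demand I n) < Q) where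

  open Spec I n m β t Q
  open Residue Q

  total F D K : ℕ
  total = demand I n
  F = prodℕ n (λ v → bS v !)
  D = t ^ total * F
  K = t ^ suc total

  F>0 : 0 < F
  F>0 = prodℕ->0 n _ (λ v _ → factorial->0 (bS v))

  residue-≡ : ∀ {x y} → x < Q → y < Q → x ≋ ⁺ y → x ≡ y
  residue-≡ x<Q y<Q (represents r eq) = trans (sym (mod-id x<Q)) (residue-unique r eq y<Q)

  D-pos : Ryser.denominator B (⁺ t) n bS ≡ ⁺ D
  D-pos = trans (Ryser.denominator-factor B (⁺ t) n bS)
    (trans (cong₂ _⊗_ (pos-^ t total) (∏-pos n (λ v → bS v !))) (sym (ℤₚ.pos-* (t ^ total) F)))

  DN<K : D * N < K
  DN<K = begin-strict
    t ^ total * F * N     ≡⟨ trans (*-assoc (t ^ total) F N) (cong (t ^ total *_) (*-comm F N)) ⟩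
    t ^ total * (N * F)   <⟨ *-monoʳ-< (t ^ total) {{m^n≢0 t total}} N-small ⟩
    t ^ total * t         ≡⟨ *-comm (t ^ total) t ⟩
    K                 ∎
    where open ≤-Reasoning

  module _ (F<t : F < t) where

    D<Q : D < Q
    D<Q = <-trans (subst (D <_) (*-comm (t ^ total) t) (*-monoʳ-< (t ^ total) {{m^n≢0 t total}} F<t)) K<Q

    denominator-exact : denominator₀ ≡ D
    denominator-exact = residue-≡ (loop-< n 1 (λ v a → a * inner v)) D<Q (≋-subst refl D-pos
      (loop-∏ n inner (λ v → (⁺ t) ↑ bS v ⊗ ⁺ (bS v !)) (λ v a _ → refl) each))
      where
      inner : ℕ → ℕ
      inner v = loop Q β 1 λ j x → x * if₀ (lt₀ j (bS v)) (t * (j + 1)) 1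
      each : ∀ v → v < n → inner v ≋ (⁺ t) ↑ bS v ⊗ ⁺ (bS v !)
      each v v<n = ≋-subst refl (trans (∏-guard β (bS v) (λ j → ⁺ t ⊗ ⁺ (j + 1)) (b≤β v v<n)) (∏-factorial (⁺ t) (bS v)))
        (loop-∏ β (λ j → if₀ (lt₀ j (bS v)) (t * (j + 1)) 1) (λ j → if j <ᵇ bS v then ⁺ t ⊗ ⁺ (j + 1) else 1ℤ) (λ j x _ → refl)
          (λ j _ → ≋-subst (sym (trans (cong (λ q → if₀ q (t * (j + 1)) 1) (lt-𝟙 j (bS v))) (if-𝟙 (j <ᵇ bS v) (t * (j + 1)) 1))) refl (case (j <ᵇ bS v) j)))
        where
        case : ∀ q j → (if q then t * (j + 1) else 1) ≋ (if q then ⁺ t ⊗ ⁺ (j + 1) else 1ℤ)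
        case true  j = ≋-* (≋-refl {t}) (≋-refl {j + 1})
        case false j = ≋-refl

    modulus-exact : modulus₀ ≡ K
    modulus-exact = cong (t *_) (residue-≡ (loop-< n 1 (λ v a → a * pow β t (bS v))) (≤-<-trans (m≤n*m (t ^ total) t) K<Q)
      (≋-subst refl (trans (∏-exponents n (⁺ t) bS) (pos-^ t total))
        (loop-∏ n (λ v → pow β t (bS v)) (λ v → (⁺ t) ↑ bS v) (λ v a _ → refl) (λ v v<n → loop-power-≋ β (bS v) ≋-refl (b≤β v v<n)))))

    -- `K` divides Q, so the multiple of Q left by the reduction and the surplus term are both
    -- multiples of `K`. What remains, `D * N`, is already below `K` and divisible by `D`.
    result-exact : ∀ {acc} r → acc ≋ Ryser.denominator B (⁺ t) n bS ⊗ ⁺ N ⊕ (⁺ t) ↑ suc total ⊗ r → result₀ acc ≡ N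
    result-exact {acc} r (represents l eq) = begin
      apply div (mod acc modulus₀) denominator₀   ≡⟨ cong₂ (λ x y → apply div (mod acc x) y) modulus-exact denominator-exact ⟩
      apply div (mod acc K) D                     ≡⟨ cong (λ x → apply div x D) (residue-unique {acc} {D * N} {K} {{m^n≢0 t (suc total)}} (r ⊕ l ⊗ ⁺ k) congruent DN<K) ⟩
      apply div (D * N) D                         ≡⟨ exact D {{m*n≢0 (t ^ total) F {{m^n≢0 t total}} {{>-nonZero F>0}}}} ⟩
      N                                           ∎
      where
      open ≡-Reasoning
      exact : ∀ D .{{_ : NonZero D}} → apply div (D * N) D ≡ N
      exact (suc D) = m*n/m≡n N (suc D)
        where
        m*n/m≡n : ∀ N D .{{_ : NonZero D}} → D * N / D ≡ N
        m*n/m≡n N D = trans (cong (_/ D) (*-comm D N)) (m*n/n≡m N D)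
      regroup : ∀ d p r l k → d ⊕ p ⊗ r ⊕ l ⊗ (p ⊗ k) ≡ d ⊕ (r ⊕ l ⊗ k) ⊗ p
      regroup = ℤ-solver.solve-∀
      congruent : ⁺ acc ≡ ⁺ (D * N) ⊕ (r ⊕ l ⊗ ⁺ k) ⊗ ⁺ K
      congruent = begin
        ⁺ acc                                                              ≡⟨ eq ⟩
        Ryser.denominator B (⁺ t) n bS ⊗ ⁺ N ⊕ (⁺ t) ↑ suc total ⊗ r ⊕ l ⊗ ⁺ Q ≡⟨ cong₂ (λ x y → x ⊕ y ⊗ r ⊕ l ⊗ ⁺ Q) (trans (cong (_⊗ ⁺ N) D-pos) (sym (ℤₚ.pos-* D N))) (pos-^ t (suc total)) ⟩
        ⁺ (D * N) ⊕ ⁺ K ⊗ r ⊕ l ⊗ ⁺ Q                                      ≡⟨ cong (λ x → ⁺ (D * N) ⊕ ⁺ K ⊗ r ⊕ l ⊗ x) (trans (cong ⁺_ Q-factor) (ℤₚ.pos-* K k)) ⟩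
        ⁺ (D * N) ⊕ ⁺ K ⊗ r ⊕ l ⊗ (⁺ K ⊗ ⁺ k)                              ≡⟨ regroup (⁺ (D * N)) (⁺ K) r l (⁺ k) ⟩
        ⁺ (D * N) ⊕ (r ⊕ l ⊗ ⁺ k) ⊗ ⁺ K                                    ∎

-- Searching for a vertex cover

testBit-suc : ∀ a v → testBit a (suc v) ≡ testBit (a / 2) v
testBit-suc a v = cong (λ x → mod x 2) (Digits.div-B* 1 a (2 ^ v) {{m^n≢0 2 v}})

testBit-zero : ∀ a → testBit a 0 ≡ a % 2
testBit-zero a = trans (cong (λ x → mod x 2) (n/1≡n a)) (mod-% a 2)

testBit-0 : ∀ v → testBit 0 v ≡ 0
testBit-0 v = cong (λ x → mod x 2) (trans (Digits.apply-div 1 0 (2 ^ v) {{m^n≢0 2 v}}) (0/n≡0 (2 ^ v) {{m^n≢0 2 v}}))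

even-split : ∀ a → a % 2 ≡ 0 → a ≡ a / 2 * 2
even-split a even = trans (m≡m%n+[m/n]*n a 2) (cong (_+ a / 2 * 2) even)

half-suc : ∀ a → a % 2 ≡ 0 → (a + 1) / 2 ≡ a / 2 × (a + 1) % 2 ≡ 1
half-suc a even = subst (λ x → (x + 1) / 2 ≡ a / 2) (sym (even-split a even)) (trans (cong (_/ 2) (+-comm (a / 2 * 2) 1)) (trans (+-distrib-/ 1 (a / 2 * 2) small) (cong (0 +_) (m*n/n≡m (a / 2) 2))))
                , subst (λ x → (x + 1) % 2 ≡ 1) (sym (even-split a even)) (trans (cong (_% 2) (+-comm (a / 2 * 2) 1)) ([m+kn]%n≡m%n 1 (a / 2) 2))
  where
  small : 1 % 2 + a / 2 * 2 % 2 < 2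
  small = subst (λ x → suc x < 2) (sym (m*n%n≡0 (a / 2) 2)) ≤-refl

half-+ : ∀ a h → (a + 2 * h) / 2 ≡ a / 2 + h
half-+ a h = trans (cong (λ x → (a + x) / 2) (*-comm 2 h)) (trans (+-distrib-/-∣ʳ a (divides h refl)) (cong (a / 2 +_) (m*n/n≡m h 2)))

parity-+ : ∀ a h → (a + 2 * h) % 2 ≡ a % 2
parity-+ a h = trans (cong (λ x → (a + x) % 2) (*-comm 2 h)) ([m+kn]%n≡m%n a h 2)

-- Adding a power of two at a clear bit produces no carry; the induction halves the number.
testBit-set : ∀ x a v → testBit a x ≡ 0 → testBit (a + 2 ^ x) v ≡ (if v ≡ᵇ x then 1 else testBit a v)
testBit-set zero a zero    clear = trans (testBit-zero (a + 1)) (proj₂ (half-suc a (trans (sym (testBit-zero a)) clear)))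
testBit-set zero a (suc v) clear = trans (testBit-suc (a + 1) v)
  (trans (cong (λ h → testBit h v) (proj₁ (half-suc a (trans (sym (testBit-zero a)) clear)))) (sym (testBit-suc a v)))
testBit-set (suc x) a zero    clear = trans (testBit-zero (a + 2 ^ suc x)) (trans (parity-+ a (2 ^ x)) (sym (testBit-zero a)))
testBit-set (suc x) a (suc v) clear = begin
  testBit (a + 2 ^ suc x) (suc v)                  ≡⟨ testBit-suc (a + 2 ^ suc x) v ⟩
  testBit ((a + 2 ^ suc x) / 2) v                  ≡⟨ cong (λ h → testBit h v) (half-+ a (2 ^ x)) ⟩
  testBit (a / 2 + 2 ^ x) v                        ≡⟨ testBit-set x (a / 2) v (trans (sym (testBit-suc a x)) clear) ⟩
  (if v ≡ᵇ x then 1 else testBit (a / 2) v)        ≡⟨ cong (λ b → if v ≡ᵇ x then 1 else b) (testBit-suc a v) ⟨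
  (if v ≡ᵇ x then 1 else testBit a (suc v))        ∎
  where open ≡-Reasoning

set-bound : ∀ n x a → x < n → a < 2 ^ n → testBit a x ≡ 0 → a + 2 ^ x < 2 ^ n
set-bound (suc n) x a x<n a<2^n clear = subst (_< 2 ^ suc n) (sym (m≡m%n+[m/n]*n (a + 2 ^ x) 2)) (begin-strict
  (a + 2 ^ x) % 2 + (a + 2 ^ x) / 2 * 2   <⟨ +-monoˡ-< ((a + 2 ^ x) / 2 * 2) (m%n<n (a + 2 ^ x) 2) ⟩
  2 + (a + 2 ^ x) / 2 * 2                 ≤⟨ *-monoˡ-≤ 2 (half x x<n clear) ⟩
  2 ^ n * 2                               ≡⟨ *-comm (2 ^ n) 2 ⟩
  2 ^ suc n                               ∎)
  where
  open ≤-Reasoning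
  a/2<2^n : a / 2 < 2 ^ n
  a/2<2^n = m<n*o⇒m/o<n (subst (a <_) (*-comm 2 (2 ^ n)) a<2^n)
  half : ∀ x → x < suc n → testBit a x ≡ 0 → (a + 2 ^ x) / 2 < 2 ^ n
  half zero    _         clear = subst (_< 2 ^ n) (sym (proj₁ (half-suc a (trans (sym (testBit-zero a)) clear)))) a/2<2^n
  half (suc x) (s≤s x<n) clear = subst (_< 2 ^ n) (sym (half-+ a (2 ^ x)))
    (set-bound n x (a / 2) x<n a/2<2^n (trans (sym (testBit-suc a x)) clear))

sumℕ-zero : ∀ n {f} → (∀ v → v < n → f v ≡ 0) → sumℕ n f ≡ 0
sumℕ-zero zero    f≡0 = refl
sumℕ-zero (suc n) f≡0 = cong₂ _+_ (f≡0 0 z<s) (sumℕ-zero n (λ v v<n → f≡0 (suc v) (s<s v<n)))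

sumℕ-raise : ∀ n x {f g} → x < n → (∀ v → v ≢ x → g v ≡ f v) → g x ≡ suc (f x) → sumℕ n g ≡ suc (sumℕ n f)
sumℕ-raise (suc n) zero    {f} x<n same raised = cong₂ _+_ raised (sumℕ-cong n (λ v _ → same (suc v) λ ()))
sumℕ-raise (suc n) (suc x) {f} (s≤s x<n) same raised = trans
  (cong₂ _+_ (same 0 λ ()) (sumℕ-raise n x x<n (λ v v≢x → same (suc v) (v≢x ∘ suc-injective)) raised)) (+-suc (f 0) _)

_⊆ᵇ_ : (ℕ → Bool) → (ℕ → Bool) → Set
c ⊆ᵇ d = ∀ v → c v ≡ true → d v ≡ true

rank-mono : ∀ n {c d} → c ⊆ᵇ d → sumℕ n (χ c) ≤ sumℕ n (χ d)
rank-mono zero    c⊆d = z≤n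
rank-mono (suc n) {c} {d} c⊆d = +-mono-≤ first (rank-mono n (λ v → c⊆d (suc v)))
  where
  first : χ c 0 ≤ χ d 0
  first with c 0 in c₀
  ... | false = z≤n
  ... | true rewrite c⊆d 0 c₀ = ≤-refl

member-testBit : ∀ {a v} → member a v ≡ false → testBit a v ≡ 0
member-testBit {a} {v} eq with member a v | testBit-χ a v
member-testBit refl | false | χ-eq = χ-eq

member-set : ∀ {a x} → member a x ≡ false → ∀ v → member (a + 2 ^ x) v ≡ (if v ≡ᵇ x then true else member a v)
member-set {a} {x} clear v = trans (cong (_≡ᵇ 1) (testBit-set x a v (member-testBit {a} {x} clear))) (push (v ≡ᵇ x))
  where
  push : ∀ q → ((if q then 1 else testBit a v) ≡ᵇ 1) ≡ (if q then true else member a v)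
  push true  = refl
  push false = refl

module _ {a x : ℕ} (clear : member a x ≡ false) where

  member-set-same : member (a + 2 ^ x) x ≡ true
  member-set-same = trans (member-set {a} {x} clear x) (cong (λ q → if q then true else member a x) (≡ᵇ-refl x))

  member-set-other : ∀ v → v ≢ x → member (a + 2 ^ x) v ≡ member a v
  member-set-other v v≢x = trans (member-set {a} {x} clear v) (cong (λ q → if q then true else member a v) (≢⇒≡ᵇ-false v x v≢x))

  set-⊇ : member a ⊆ᵇ member (a + 2 ^ x)
  set-⊇ v v∈a with v ≟ x
  ... | yes refl = member-set-same
  ... | no v≢x   = trans (member-set-other v v≢x) v∈a

  set-⊆ : ∀ {d} → member a ⊆ᵇ d → d x ≡ true → member (a + 2 ^ x) ⊆ᵇ d
  set-⊆ a⊆d dx v v∈ with v ≟ x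
  ... | yes refl = dx
  ... | no v≢x   = a⊆d v (trans (sym (member-set-other v v≢x)) v∈)

  set-size : ∀ n → x < n → sumℕ n (χ (member (a + 2 ^ x))) ≡ suc (sumℕ n (χ (member a)))
  set-size n x<n = sumℕ-raise n x x<n (λ v v≢x → cong 𝟙[_] (member-set-other v v≢x))
    (trans (cong 𝟙[_] member-set-same) (cong suc (sym (cong 𝟙[_] clear))))

-- The search as a run over all hyperedge-vertex-vertex triples

module Search (I : List ℕ) (n m β t Q : ℕ) .{{_ : NonZero Q}}
  (n<Q : n < Q) (2^n<Q : 2 ^ n < Q) (B^n<Q : suc β ^ n < Q) (2^β<Q : 2 ^ β < Q) (P<Q : m * (n * n) < Q)
  (b≤β : ∀ v → v < n → peek I (2 + v) ≤ β)
  (A≤1 : ∀ F v → F < m → v < n → peek I (2 + (n + (F * n + v))) ≤ 1) where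

  open Spec I n m β t Q
  open Correct I n m β t Q n<Q 2^n<Q B^n<Q 2^β<Q P<Q b≤β A≤1

  count : ℕ → ℕ
  count a = sumℕ n (χ (member a))

  edgeᵖ leftᵖ rightᵖ : ℕ → ℕ
  edgeᵖ  p = apply div p (n * n)
  leftᵖ  p = mod (apply div p n) n
  rightᵖ p = mod p n

  isOpen : ℕ → ℕ → Bool
  isOpen a p = (AS (edgeᵖ p) (leftᵖ p) ≡ᵇ 1) ∧ ((AS (edgeᵖ p) (rightᵖ p) ≡ᵇ 1) ∧
    (not (leftᵖ p ≡ᵇ rightᵖ p) ∧ (not (member a (leftᵖ p)) ∧ not (member a (rightᵖ p)))))

  n≢0 : ∀ {p} → p < P → NonZero n
  n≢0 {p} p<P = ≢-nonZero (λ n≡0 → contradiction (subst (p <_) (trans (cong (λ n → m * (n * n)) n≡0) (*-zeroʳ m)) p<P) λ ())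

  edge< : ∀ {p} → p < P → edgeᵖ p < m
  edge< {p} p<P = subst (_< m) (sym (Digits.apply-div 0 p (n * n))) (m<n*o⇒m/o<n p<P)
    where
    instance
      n≢0′ = n≢0 p<P
      nn≢0 = m*n≢0 n n

  left< : ∀ {p} → p < P → leftᵖ p < n
  left< p<P = mod-< _ n {{n≢0 p<P}}

  right< : ∀ {p} → p < P → rightᵖ p < n
  right< p<P = mod-< _ n {{n≢0 p<P}}

  bool-value : ∀ {x} → x ≤ 1 → x ≡ 𝟙[ x ≡ᵇ 1 ]
  bool-value x≤1 with 𝟙-0⊎1 x≤1
  ... | inj₁ refl = refl
  ... | inj₂ refl = refl

  not-𝟙 : ∀ q → 1 ∸ 𝟙[ q ] ≡ 𝟙[ not q ]
  not-𝟙 true  = refl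
  not-𝟙 false = refl

  ∧-𝟙 : ∀ p q {x} → 𝟙[ p ] * (if q then x else 0) ≡ (if p ∧ q then x else 0)
  ∧-𝟙 true  q = +-identityʳ _
  ∧-𝟙 false q = refl

  open-exact : ∀ a p f → p < P → open₀ a p f ≡ (if isOpen a p then f (leftᵖ p) (rightᵖ p) else 0)
  open-exact a p f p<P = begin
    open₀ a p f
      ≡⟨ cong₂ (λ x y → x * (y * ((1 ∸ eq₀ u v) * ((1 ∸ bit a u) * ((1 ∸ bit a v) * f u v)))))
           (bool-value (A≤1 F u (edge< p<P) (left< p<P))) (bool-value (A≤1 F v (edge< p<P) (right< p<P))) ⟩
    𝟙[ AS F u ≡ᵇ 1 ] * (𝟙[ AS F v ≡ᵇ 1 ] * ((1 ∸ eq₀ u v) * ((1 ∸ bit a u) * ((1 ∸ bit a v) * f u v))))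
      ≡⟨ cong (λ x → 𝟙[ AS F u ≡ᵇ 1 ] * (𝟙[ AS F v ≡ᵇ 1 ] * x))
           (cong₂ _*_ (trans (cong (1 ∸_) (eq-𝟙 u v)) (not-𝟙 (u ≡ᵇ v)))
             (cong₂ _*_ (trans (cong (1 ∸_) (bit-exact a u (<⇒≤ (left< p<P)))) (not-𝟙 (member a u)))
               (trans (cong (_* f u v) (trans (cong (1 ∸_) (bit-exact a v (<⇒≤ (right< p<P)))) (not-𝟙 (member a v)))) (last (not (member a v)))))) ⟩
    𝟙[ AS F u ≡ᵇ 1 ] * (𝟙[ AS F v ≡ᵇ 1 ] * (𝟙[ not (u ≡ᵇ v) ] * (𝟙[ not (member a u) ] * (if not (member a v) then f u v else 0))))
      ≡⟨ cong (λ x → 𝟙[ AS F u ≡ᵇ 1 ] * (𝟙[ AS F v ≡ᵇ 1 ] * (𝟙[ not (u ≡ᵇ v) ] * x))) (∧-𝟙 (not (member a u)) _) ⟩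
    𝟙[ AS F u ≡ᵇ 1 ] * (𝟙[ AS F v ≡ᵇ 1 ] * (𝟙[ not (u ≡ᵇ v) ] * (if not (member a u) ∧ not (member a v) then f u v else 0)))
      ≡⟨ cong (λ x → 𝟙[ AS F u ≡ᵇ 1 ] * (𝟙[ AS F v ≡ᵇ 1 ] * x)) (∧-𝟙 (not (u ≡ᵇ v)) _) ⟩
    𝟙[ AS F u ≡ᵇ 1 ] * (𝟙[ AS F v ≡ᵇ 1 ] * (if not (u ≡ᵇ v) ∧ (not (member a u) ∧ not (member a v)) then f u v else 0))
      ≡⟨ trans (cong (𝟙[ AS F u ≡ᵇ 1 ] *_) (∧-𝟙 (AS F v ≡ᵇ 1) _)) (∧-𝟙 (AS F u ≡ᵇ 1) _) ⟩
    (if isOpen a p then f u v else 0) ∎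
    where
    open ≡-Reasoning
    F = edgeᵖ p
    u = leftᵖ p
    v = rightᵖ p
    last : ∀ q → 𝟙[ q ] * f u v ≡ (if q then f u v else 0)
    last true  = +-identityʳ _
    last false = refl

  -- The part of the code not yet read: one bit is consumed for each chosen vertex, and 1 is the
  -- bare end marker.
  remaining : ℕ → ℕ → ℕ
  remaining s a = apply div s (2 ^ count a)

  record Open (a p : ℕ) : Set where
    field
      left∈    : AS (edgeᵖ p) (leftᵖ p) ≡ 1
      right∈   : AS (edgeᵖ p) (rightᵖ p) ≡ 1
      distinct : leftᵖ p ≢ rightᵖ p
      left∉    : member a (leftᵖ p) ≡ false
      right∉   : member a (rightᵖ p) ≡ false
  open Open

  ∧-true : ∀ {p q} → p ∧ q ≡ true → p ≡ true × q ≡ true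
  ∧-true {true} {true} _ = refl , refl

  not-true : ∀ {p} → not p ≡ true → p ≡ false
  not-true {false} _ = refl

  isOpen⁻ : ∀ {a p} → isOpen a p ≡ true → Open a p
  isOpen⁻ {a} {p} eq =
    let (e₁ , eq₁) = ∧-true eq
        (e₂ , eq₂) = ∧-true eq₁
        (e₃ , eq₃) = ∧-true eq₂
        (e₄ , e₅)  = ∧-true eq₃
    in record
      { left∈    = ≡ᵇ-true⇒≡ _ 1 e₁
      ; right∈   = ≡ᵇ-true⇒≡ _ 1 e₂
      ; distinct = λ u≡v → contradiction (trans (sym (≡ᵇ-refl (rightᵖ p))) (trans (cong (_≡ᵇ rightᵖ p) (sym u≡v)) (not-true e₃))) λ ()
      ; left∉    = not-true e₄
      ; right∉   = not-true e₅
      }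

  isOpen⁺ : ∀ {a p} → Open a p → isOpen a p ≡ true
  isOpen⁺ {a} {p} o rewrite left∈ o | right∈ o | ≢⇒≡ᵇ-false _ _ (distinct o) | left∉ o | right∉ o = refl

  data Step (s a p : ℕ) : ℕ → Set where
    closed : isOpen a p ≡ false → Step s a p a
    stuck  : isOpen a p ≡ true → remaining s a ≤ 1 → Step s a p a
    left   : isOpen a p ≡ true → 2 ≤ remaining s a → remaining s a % 2 ≡ 1 → Step s a p (a + 2 ^ leftᵖ p)
    right  : isOpen a p ≡ true → 2 ≤ remaining s a → remaining s a % 2 ≡ 0 → Step s a p (a + 2 ^ rightᵖ p)

  step : ℕ → ℕ → ℕ → ℕ
  step s p a = a + open₀ a p (choice s a)

  remaining-exact : ∀ s a → apply div s (pow n 2 (pop a)) ≡ remaining s a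
  remaining-exact s a = cong (apply div s) (trans (cong (pow n 2) (pop-exact a)) (pow2-exact (count a) (rank-≤ n (member a))))

  choice-exact : ∀ s a u v → u ≤ n → v ≤ n →
    choice s a u v ≡ (if 1 <ᵇ remaining s a then 2 ^ (if remaining s a % 2 ≡ᵇ 1 then u else v) else 0)
  choice-exact s a u v u≤n v≤n rewrite remaining-exact s a | lt-𝟙 1 (remaining s a) = trans
    (cong (𝟙[ 1 <ᵇ remaining s a ] *_) (trans (cong (pow n 2) select) (pow2-exact _ (bounded (remaining s a % 2 ≡ᵇ 1)))))
    (last (1 <ᵇ remaining s a))
    where
    select : if₀ (mod (remaining s a) 2) u v ≡ (if remaining s a % 2 ≡ᵇ 1 then u else v)
    select = trans (cong (λ q → if₀ q u v) (trans (mod-% (remaining s a) 2) (bool-value (s≤s⁻¹ (m%n<n (remaining s a) 2))))) (if-𝟙 _ u v)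
    bounded : ∀ q → (if q then u else v) ≤ n
    bounded true  = u≤n
    bounded false = v≤n
    last : ∀ q {x} → 𝟙[ q ] * x ≡ (if q then x else 0)
    last true  = +-identityʳ _
    last false = refl

  step-view : ∀ s a p → p < P → Step s a p (step s p a)
  step-view s a p p<P rewrite open-exact a p (choice s a) p<P
    | choice-exact s a (leftᵖ p) (rightᵖ p) (<⇒≤ (left< p<P)) (<⇒≤ (right< p<P)) with isOpen a p in eq
  ... | false rewrite +-identityʳ a = closed eq
  ... | true with 1 <? remaining s a
  ...   | no r≯1 rewrite <ᵇ-false (≮⇒≥ r≯1) | +-identityʳ a = stuck eq (≮⇒≥ r≯1)
  ...   | yes r>1 rewrite <ᵇ-true r>1 with 𝟙-0⊎1 (s≤s⁻¹ (m%n<n (remaining s a) 2))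
  ...     | inj₁ even rewrite even = right eq r>1 even
  ...     | inj₂ odd rewrite odd = left eq r>1 odd

  run : ℕ → ℕ → ℕ → ℕ → ℕ
  run s i zero    a = a
  run s i (suc k) a = run s (suc i) k (step s i a)

  run-last : ∀ s i k a → run s i (suc k) a ≡ step s (i + k) (run s i k a)
  run-last s i zero    a = cong (λ j → step s j a) (sym (+-identityʳ i))
  run-last s i (suc k) a = trans (run-last s (suc i) k (step s i a)) (cong (λ j → step s j (run s (suc i) k (step s i a))) (sym (+-suc i k)))

  -- `paid` is preserved because a vertex is chosen only while at least 2 remains of the code. It
  -- limits the mask to log₂ s vertices, so whichever mask the first successful code yields, it is
  -- small.
  record Sound (s a : ℕ) : Set where
    constructor sound
    field
      below : a < 2 ^ n
      paid  : 2 ^ count a ≤ s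
  open Sound

  remaining-/ : ∀ s a → remaining s a ≡ _/_ s (2 ^ count a) {{m^n≢0 2 (count a)}}
  remaining-/ s a = Digits.apply-div 0 s (2 ^ count a) {{m^n≢0 2 (count a)}}

  sound-set : ∀ {s a x} → x < n → member a x ≡ false → 2 ≤ remaining s a → Sound s a → Sound s (a + 2 ^ x)
  sound-set {s} {a} {x} x<n clear r≥2 snd .below = set-bound n x a x<n (below snd) (member-testBit {a} {x} clear)
  sound-set {s} {a} {x} x<n clear r≥2 snd .paid  = begin
    2 ^ count (a + 2 ^ x)              ≡⟨ cong (2 ^_) (set-size {a} {x} clear n x<n) ⟩
    2 * 2 ^ count a                    ≤⟨ *-monoˡ-≤ (2 ^ count a) (subst (2 ≤_) (remaining-/ s a) r≥2) ⟩
    s / 2 ^ count a * 2 ^ count a      ≤⟨ m/n*n≤m s (2 ^ count a) ⟩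
    s                                  ∎
    where
    open ≤-Reasoning
    instance
      2^≢0 = m^n≢0 2 (count a)

  sound-step : ∀ {s a p a′} → p < P → Sound s a → Step s a p a′ → Sound s a′
  sound-step p<P snd (closed _)   = snd
  sound-step p<P snd (stuck _ _)  = snd
  sound-step {a = a} {p} p<P snd (left o r≥2 _)  = sound-set (left< p<P) (left∉ (isOpen⁻ {a} {p} o)) r≥2 snd
  sound-step {a = a} {p} p<P snd (right o r≥2 _) = sound-set (right< p<P) (right∉ (isOpen⁻ {a} {p} o)) r≥2 snd

  sound-run : ∀ s k → k ≤ P → Sound s 0 → Sound s (run s 0 k 0)
  sound-run s zero    _   snd = snd
  sound-run s (suc k) k<P snd = subst (Sound s) (sym (run-last s 0 k 0))
    (sound-step k<P (sound-run s k (<⇒≤ k<P) snd) (step-view s (run s 0 k 0) k k<P))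

  member-0 : ∀ v → member 0 v ≡ false
  member-0 v = cong (_≡ᵇ 1) (testBit-0 v)

  count-0 : count 0 ≡ 0
  count-0 = sumℕ-zero n (λ v _ → cong 𝟙[_] (member-0 v))

  sound-0 : ∀ {s} → 1 ≤ s → Sound s 0
  sound-0 1≤s = sound (m^n>0 2 n) (subst (λ k → 2 ^ k ≤ _) (sym count-0) 1≤s)

  cover-exact : ∀ s → 1 ≤ s → cover s ≡ run s 0 P 0
  cover-exact s 1≤s = loop-exact P (λ k → run s 0 k 0) refl
    (λ k k≤P → <-trans (below (sound-run s k k≤P (sound-0 1≤s))) 2^n<Q) (λ k _ → sym (run-last s 0 k 0))

  cover-sound : ∀ s → 1 ≤ s → Sound s (cover s)
  cover-sound s 1≤s = subst (Sound s) (sym (cover-exact s 1≤s)) (sound-run s P ≤-refl (sound-0 1≤s))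

  uncovered-exact : ∀ a → uncovered a ≡ β * sumℕ P (λ p → 𝟙[ isOpen a p ])
  uncovered-exact a = cong (β *_) (loop-sum P (λ p → 𝟙[ isOpen a p ])
    (≤-<-trans (subst (sumℕ P (λ p → 𝟙[ isOpen a p ]) ≤_) (*-identityʳ P) (sumℕ-≤ P _ 1 (λ p _ → χ-≤1 (isOpen a) p))) P<Q)
    (λ p x p<P → cong (λ y → x + y) (open-exact a p (λ _ _ → 1) p<P)))

  sumℕ-0⁻ : ∀ n f → sumℕ n f ≡ 0 → ∀ i → i < n → f i ≡ 0
  sumℕ-0⁻ (suc n) f sum≡0 zero    _         = m+n≡0⇒m≡0 (f 0) sum≡0
  sumℕ-0⁻ (suc n) f sum≡0 (suc i) (s≤s i<n) = sumℕ-0⁻ n (f ∘ suc) (m+n≡0⇒n≡0 (f 0) sum≡0) i i<n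

  -- Mixed-radix inverse of `edgeᵖ`, `leftᵖ` and `rightᵖ`.
  pair : ℕ → ℕ → ℕ → ℕ
  pair F u v = (F * n + u) * n + v

  module Pair {F u v} (F<m : F < m) (u<n : u < n) (v<n : v < n) where

    instance
      n≢0′ : NonZero n
      n≢0′ = >-nonZero (≤-<-trans z≤n u<n)
      nn≢0 : NonZero (n * n)
      nn≢0 = m*n≢0 n n

    block< : ∀ {k l j} → j < k → l < n → j * n + l < k * n
    block< {k} {l} {j} j<k l<n = begin-strict
      j * n + l  <⟨ +-monoʳ-< (j * n) l<n ⟩
      j * n + n  ≡⟨ +-comm (j * n) n ⟩
      suc j * n  ≤⟨ *-monoˡ-≤ n j<k ⟩
      k * n      ∎
      where open ≤-Reasoning

    pair< : pair F u v < P
    pair< = subst (pair F u v <_) (*-assoc m n n) (block< (block< F<m u<n) v<n)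

    quotient : ∀ j {l} → l < n → (j * n + l) / n ≡ j
    quotient j {l} l<n = trans (+-distrib-/-∣ˡ {j * n} l {n} (divides j refl)) (trans (cong₂ _+_ (m*n/n≡m j n) (m<n⇒m/n≡0 l<n)) (+-identityʳ j))

    residue : ∀ j {l} → l < n → (j * n + l) % n ≡ l
    residue j {l} l<n = trans (cong (_% n) (+-comm (j * n) l)) (trans ([m+kn]%n≡m%n l j n) (m<n⇒m%n≡m l<n))

    edge-pair : edgeᵖ (pair F u v) ≡ F
    edge-pair = trans (Digits.apply-div 0 _ (n * n)) (trans (sym (m/n/o≡m/[n*o] _ n n)) (trans (cong (_/ n) (quotient (F * n + u) v<n)) (quotient F u<n)))

    left-pair : leftᵖ (pair F u v) ≡ u
    left-pair = trans (mod-% _ n) (trans (cong (_% n) (trans (Digits.apply-div 0 _ n) (quotient (F * n + u) v<n))) (residue F u<n))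

    right-pair : rightᵖ (pair F u v) ≡ v
    right-pair = trans (mod-% _ n) (residue (F * n + u) v<n)

  uncovered⇒strong : ∀ a → uncovered a ≡ 0 → Summation.Strong a
  uncovered⇒strong a unc≡0 with m*n≡0⇒m≡0∨n≡0 β (trans (sym (uncovered-exact a)) unc≡0)
  ... | inj₁ β≡0 = inj₁ β≡0
  ... | inj₂ sum≡0 = inj₂ independent
    where
    independent : ∀ F u v → F < m → u < n → v < n → AS F u ≡ 1 → AS F v ≡ 1 → member a u ≡ false → member a v ≡ false → u ≡ v
    independent F u v F<m u<n v<n Au Av u∉a v∉a with u ≟ v
    ... | yes u≡v = u≡v
    ... | no u≢v = contradiction (trans (sym (cong 𝟙[_] (isOpen⁺ {a} {pair F u v} opened))) (sumℕ-0⁻ P _ sum≡0 (pair F u v) pair<)) λ ()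
      where
      open Pair F<m u<n v<n
      opened : Open a (pair F u v)
      opened .left∈    rewrite edge-pair | left-pair = Au
      opened .right∈   rewrite edge-pair | right-pair = Av
      opened .distinct rewrite left-pair | right-pair = u≢v
      opened .left∉    rewrite left-pair = u∉a
      opened .right∉   rewrite right-pair = v∉a

  -- By backward induction over the pairs, some code below 2 ^ (|d| + 1) steers
  -- the search into the given cover d.
  module Steering (d : ℕ → Bool)
    (d-covers : ∀ F u v → F < m → u < n → v < n → u ≢ v → AS F u ≡ 1 → AS F v ≡ 1 → d u ≡ true ⊎ d v ≡ true) where

    -- `r` is the unread code when pair `i` is reached with mask `a`. The backward induction builds
    -- it from the leading bit downwards, so the claims range over every full code `s` that leaves
    -- `r` unread at this moment. The bound `short` grants one bit to each vertex of `d` that is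
    -- still to be chosen.
    record Steered (i k a r : ℕ) : Set where
      constructor steered
      field
        positive : 1 ≤ r
        short    : r < 2 ^ suc (sumℕ n (χ d) ∸ count a)
        grows    : ∀ s → remaining s a ≡ r → member a ⊆ᵇ member (run s i k a)
        closes   : ∀ s → remaining s a ≡ r → ∀ p → i ≤ p → p < i + k → isOpen (run s i k a) p ≡ false
    open Steered

    -- Enlarging the mask can only cover more pairs, so a pair once dealt with needs no second look
    -- later in the run.
    still-closed : ∀ {a a′ p} → member a ⊆ᵇ member a′ → isOpen a p ≡ false → isOpen a′ p ≡ false
    still-closed {a} {a′} {p} a⊆a′ closed-a with isOpen a′ p in eq
    ... | false = refl
    ... | true = contradiction (trans (sym (isOpen⁺ {a} {p} opened)) closed-a) λ ()
      where
      o = isOpen⁻ {a′} {p} eq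
      shrink : ∀ v → member a′ v ≡ false → member a v ≡ false
      shrink v v∉a′ with member a v in v-eq
      ... | false = refl
      ... | true = trans (sym (a⊆a′ v v-eq)) v∉a′
      opened : Open a p
      opened = record { left∈ = left∈ o ; right∈ = right∈ o ; distinct = distinct o ; left∉ = shrink (leftᵖ p) (left∉ o) ; right∉ = shrink (rightᵖ p) (right∉ o) }

    covered-closed : ∀ {a x p} → x ≡ leftᵖ p ⊎ x ≡ rightᵖ p → member a x ≡ true → isOpen a p ≡ false
    covered-closed {a} {x} {p} x≡ x∈a with isOpen a p in eq
    ... | false = refl
    ... | true with x≡ | isOpen⁻ {a} {p} eq
    ...   | inj₁ refl | o = contradiction (trans (sym x∈a) (left∉ o)) λ ()
    ...   | inj₂ refl | o = contradiction (trans (sym x∈a) (right∉ o)) λ ()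

    -- Choosing a vertex shifts the code by one place, which drops exactly the bit `e` that selected
    -- it.
    halve : ∀ s a x e r → x < n → member a x ≡ false → e ≤ 1 → remaining s a ≡ e + 2 * r → remaining s (a + 2 ^ x) ≡ r
    halve s a x e r x<n clear e≤1 eq = begin
      apply div s (2 ^ count (a + 2 ^ x))  ≡⟨ cong (λ k → apply div s (2 ^ k)) (set-size {a} {x} clear n x<n) ⟩
      apply div s (2 * 2 ^ count a)        ≡⟨ cong (apply div s) (*-comm 2 (2 ^ count a)) ⟩
      apply div s (2 ^ count a * 2)        ≡⟨ Digits.apply-div 0 s (2 ^ count a * 2) ⟩
      s / (2 ^ count a * 2)                ≡⟨ m/n/o≡m/[n*o] s (2 ^ count a) 2 ⟨
      s / 2 ^ count a / 2                  ≡⟨ cong (_/ 2) (trans (sym (remaining-/ s a)) eq) ⟩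
      (e + 2 * r) / 2                      ≡⟨ trans (half-+ e r) (cong (_+ r) (m<n⇒m/n≡0 (s≤s e≤1))) ⟩
      r                                    ∎
      where
      open ≡-Reasoning
      instance
        2^≢0 = m^n≢0 2 (count a)
        2^*2≢0 = m*n≢0 (2 ^ count a) 2

    -- Here e is the bit that selects x.
    steer-into : ∀ {i k a} x e r → i < P → isOpen a i ≡ true → x < n → x ≡ leftᵖ i ⊎ x ≡ rightᵖ i → member a x ≡ false →
      e ≤ 1 → count (a + 2 ^ x) ≤ sumℕ n (χ d) → (∀ s → remaining s a ≡ e + 2 * r → step s i a ≡ a + 2 ^ x) →
      Steered (suc i) k (a + 2 ^ x) r → Steered i (suc k) a (e + 2 * r)
    steer-into {i} {k} {a} x e r i<P o x<n x≡ clear e≤1 room moves st .positive = ≤-trans (positive st) (≤-trans (m≤m+n r (r + 0)) (m≤n+m (2 * r) e))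
    steer-into {i} {k} {a} x e r i<P o x<n x≡ clear e≤1 room moves st .short = begin-strict
      e + 2 * r                                ≤⟨ +-monoˡ-≤ (2 * r) e≤1 ⟩
      1 + 2 * r                                <⟨ ≤-refl ⟩
      2 + 2 * r                                ≡⟨ *-suc 2 r ⟨
      2 * suc r                                ≤⟨ *-monoʳ-≤ 2 (short st) ⟩
      2 * 2 ^ suc (c* ∸ count (a + 2 ^ x))     ≡⟨ cong (λ j → 2 * 2 ^ suc (c* ∸ j)) grown ⟩
      2 ^ suc (suc (c* ∸ suc (count a)))       ≡⟨ cong (λ j → 2 ^ suc j) (sym (+-∸-assoc 1 (subst (_≤ c*) grown room))) ⟩
      2 ^ suc (c* ∸ count a)                   ∎
      where
      open ≤-Reasoning
      c* = sumℕ n (χ d)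
      grown = set-size {a} {x} clear n x<n
    steer-into {i} {k} {a} x e r i<P o x<n x≡ clear e≤1 room moves st .grows s eq rewrite moves s eq =
      λ v v∈a → grows st s (halve s a x e r x<n clear e≤1 eq) v (set-⊇ {a} {x} clear v v∈a)
    steer-into {i} {k} {a} x e r i<P o x<n x≡ clear e≤1 room moves st .closes s eq p i≤p p<i+k rewrite moves s eq with i ≟ p
    ... | no i≢p = closes st s (halve s a x e r x<n clear e≤1 eq) p (≤∧≢⇒< i≤p i≢p) (subst (p <_) (+-suc i k) p<i+k)
    ... | yes refl = still-closed {a + 2 ^ x} {p = i} (grows st s (halve s a x e r x<n clear e≤1 eq))
      (covered-closed {a + 2 ^ x} {x} {i} x≡ (member-set-same {a} {x} clear))

    moves-left : ∀ {i a r} → i < P → isOpen a i ≡ true → 1 ≤ r → ∀ s → remaining s a ≡ 1 + 2 * r → step s i a ≡ a + 2 ^ leftᵖ i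
    moves-left {i} {a} {r} i<P o r≥1 s eq with step s i a | step-view s a i i<P
    ... | _ | closed c    = contradiction (trans (sym c) o) λ ()
    ... | _ | stuck _ r≤1 = contradiction (subst (_≤ 1) eq r≤1) (<⇒≱ (s≤s (≤-trans r≥1 (m≤m+n r (r + 0)))))
    ... | _ | left _ _ _  = refl
    ... | _ | right _ _ even = contradiction (trans (sym even) (trans (cong (_% 2) eq) (parity-+ 1 r))) λ ()

    moves-right : ∀ {i a r} → i < P → isOpen a i ≡ true → 1 ≤ r → ∀ s → remaining s a ≡ 0 + 2 * r → step s i a ≡ a + 2 ^ rightᵖ i
    moves-right {i} {a} {r} i<P o r≥1 s eq with step s i a | step-view s a i i<P
    ... | _ | closed c    = contradiction (trans (sym c) o) λ ()
    ... | _ | stuck _ r≤1 = contradiction (subst (_≤ 1) eq r≤1) (<⇒≱ (*-monoʳ-≤ 2 r≥1))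
    ... | _ | left _ _ odd = contradiction (trans (sym odd) (trans (cong (_% 2) eq) (parity-+ 0 r))) λ ()
    ... | _ | right _ _ _ = refl

    steer : ∀ k i a → i + k ≡ P → member a ⊆ᵇ d → Σ[ r ∈ ℕ ] Steered i k a r
    -- No pair is left, so the unread code is just its end marker.
    steer zero    i a i+k≡P a⊆d = 1 , steered ≤-refl (^-monoʳ-≤ 2 {1} {suc (sumℕ n (χ d) ∸ count a)} (s≤s z≤n)) (λ s _ v v∈a → v∈a)
      (λ s _ p i≤p p<i+0 → contradiction (subst (p <_) (+-identityʳ i) p<i+0) (≤⇒≯ i≤p))
    steer (suc k) i a i+k≡P a⊆d = go (isOpen a i) refl
      where
      i<P : i < P
      i<P = subst (i <_) i+k≡P (m<m+n i z<s)
      next : suc i + k ≡ P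
      next = trans (sym (+-suc i k)) i+k≡P
      room : ∀ {x} → member a x ≡ false → d x ≡ true → count (a + 2 ^ x) ≤ sumℕ n (χ d)
      room {x} clear dx = rank-mono n (set-⊆ {a} {x} clear a⊆d dx)
      go : ∀ q → isOpen a i ≡ q → Σ[ r ∈ ℕ ] Steered i (suc k) a r
      go false closed-a with steer k (suc i) a next a⊆d
      ... | r , st = r , steered (positive st) (short st)
        (λ s eq → subst (λ b → member a ⊆ᵇ member (run s (suc i) k b)) (sym (stays s)) (grows st s eq))
        (λ s eq p i≤p p<i+k → subst (λ b → isOpen (run s (suc i) k b) p ≡ false) (sym (stays s)) (closing s eq p i≤p p<i+k))
        where
        stays : ∀ s → step s i a ≡ a
        stays s with step s i a | step-view s a i i<P
        ... | _ | closed _    = refl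
        ... | _ | stuck _ _   = refl
        ... | _ | left o _ _  = contradiction (trans (sym o) closed-a) λ ()
        ... | _ | right o _ _ = contradiction (trans (sym o) closed-a) λ ()
        closing : ∀ s → remaining s a ≡ r → ∀ p → i ≤ p → p < i + suc k → isOpen (run s (suc i) k a) p ≡ false
        closing s eq p i≤p p<i+k with i ≟ p
        ... | no i≢p   = closes st s eq p (≤∧≢⇒< i≤p i≢p) (subst (p <_) (+-suc i k) p<i+k)
        ... | yes refl = still-closed {a} {p = i} (grows st s eq) closed-a
      go true open-a with isOpen⁻ {a} {i} open-a
      ... | o with d-covers (edgeᵖ i) (leftᵖ i) (rightᵖ i) (edge< i<P) (left< i<P) (right< i<P) (distinct o) (left∈ o) (right∈ o)
      -- Bit 1 stands for the left end and bit 0 for the right one. Choosing an end that lies in `d`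
      -- keeps the mask inside `d`, which limits the number of bits spent.
      ...   | inj₁ du = let (r , st) = steer k (suc i) (a + 2 ^ leftᵖ i) next (set-⊆ {a} {leftᵖ i} (left∉ o) a⊆d du) in
        1 + 2 * r , steer-into (leftᵖ i) 1 r i<P open-a (left< i<P) (inj₁ refl) (left∉ o) ≤-refl (room (left∉ o) du)
          (moves-left i<P open-a (positive st)) st
      ...   | inj₂ dv = let (r , st) = steer k (suc i) (a + 2 ^ rightᵖ i) next (set-⊆ {a} {rightᵖ i} (right∉ o) a⊆d dv) in
        0 + 2 * r , steer-into (rightᵖ i) 0 r i<P open-a (right< i<P) (inj₂ refl) (right∉ o) z≤n (room (right∉ o) dv)
          (moves-right i<P open-a (positive st)) st

    found : Σ[ s ∈ ℕ ] 1 ≤ s × s < 2 ^ suc (sumℕ n (χ d)) × uncovered (cover s) ≡ 0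
    found with steer P 0 0 refl (λ v v∈0 → contradiction (trans (sym v∈0) (member-0 v)) λ ())
    ... | s , st = s , positive st , subst (λ k → s < 2 ^ suc (sumℕ n (χ d) ∸ k)) count-0 (short st)
                 , trans (uncovered-exact (cover s)) (trans (cong (β *_) all-closed) (*-zeroʳ β))
      where
      remaining-0 : remaining s 0 ≡ s
      remaining-0 = trans (cong (λ k → apply div s (2 ^ k)) count-0) (n/1≡n s)
      all-closed : sumℕ P (λ p → 𝟙[ isOpen (cover s) p ]) ≡ 0
      all-closed = sumℕ-zero P (λ p p<P → cong 𝟙[_] (trans (cong (λ a → isOpen a p) (cover-exact s (positive st))) (closes st s remaining-0 p z≤n p<P)))

-- The largest part of a k-partition

contains : ∀ {n} → Subset n → ℕ → Bool
contains []      _       = false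
contains (x ∷ p) zero    = x
contains (x ∷ p) (suc v) = contains p v

contains-∈ : ∀ {n} {p : Subset n} {v} → v ∈ˢ p → contains p (toℕ v) ≡ true
contains-∈ here        = refl
contains-∈ (there v∈p) = contains-∈ v∈p

contains-∈⁻ : ∀ {n} (p : Subset n) v → contains p (toℕ v) ≡ true → v ∈ˢ p
contains-∈⁻ (x ∷ p) zero    refl = here
contains-∈⁻ (x ∷ p) (suc v) eq   = there (contains-∈⁻ p v eq)

1≤∣p∣ : ∀ {n} {p : Subset n} {v} → v ∈ˢ p → 1 ≤ ∣ p ∣
1≤∣p∣ here                    = s≤s z≤n
1≤∣p∣ {p = true ∷ p}  (there v∈p) = s≤s z≤n
1≤∣p∣ {p = false ∷ p} (there v∈p) = 1≤∣p∣ v∈p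

2≤∣p∣ : ∀ {n} {p : Subset n} {u v} → u ≢ v → u ∈ˢ p → v ∈ˢ p → 2 ≤ ∣ p ∣
2≤∣p∣ u≢v here here = contradiction refl u≢v
2≤∣p∣ u≢v here (there v∈p) = s≤s (1≤∣p∣ v∈p)
2≤∣p∣ u≢v (there u∈p) here = s≤s (1≤∣p∣ u∈p)
2≤∣p∣ {p = true ∷ p}  u≢v (there u∈p) (there v∈p) = m≤n⇒m≤1+n (2≤∣p∣ (u≢v ∘ cong suc) u∈p v∈p)
2≤∣p∣ {p = false ∷ p} u≢v (there u∈p) (there v∈p) = 2≤∣p∣ (u≢v ∘ cong suc) u∈p v∈p

sumᶠ : ∀ k → (Fin k → ℕ) → ℕ
sumᶠ zero    f = 0
sumᶠ (suc k) f = f zero + sumᶠ k (f ∘ suc)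

sumᶠ-+ : ∀ k f g → sumᶠ k (λ i → f i + g i) ≡ sumᶠ k f + sumᶠ k g
sumᶠ-+ zero    f g = refl
sumᶠ-+ (suc k) f g = trans (cong (f zero + g zero +_) (sumᶠ-+ k (f ∘ suc) (g ∘ suc))) (regroup (f zero) (g zero) _ _)
  where
  regroup : ∀ a b c d → a + b + (c + d) ≡ a + c + (b + d)
  regroup = solve-∀

term≤sumᶠ : ∀ k (f : Fin k → ℕ) i → f i ≤ sumᶠ k f
term≤sumᶠ (suc k) f zero    = m≤m+n (f zero) _
term≤sumᶠ (suc k) f (suc i) = ≤-trans (term≤sumᶠ k (f ∘ suc) i) (m≤n+m _ (f zero))

largest : ∀ k → 1 ≤ k → (f : Fin k → ℕ) → Σ[ i ∈ Fin k ] sumᶠ k f ≤ k * f i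
largest (suc zero)    _ f = zero , ≤-refl
largest (suc (suc k)) _ f with largest (suc k) (s≤s z≤n) (f ∘ suc)
... | i , sum≤ with ≤-total (f zero) (f (suc i))
...   | inj₁ f₀≤fᵢ = suc i , +-mono-≤ f₀≤fᵢ sum≤
...   | inj₂ fᵢ≤f₀ = zero , +-monoʳ-≤ (f zero) (≤-trans sum≤ (*-monoʳ-≤ (suc k) fᵢ≤f₀))

covered-sum : ∀ k n (c : Fin k → ℕ → Bool) → (∀ v → v < n → Σ[ i ∈ Fin k ] c i v ≡ true) →
              n ≤ sumᶠ k (λ i → sumℕ n (χ (c i)))
covered-sum k zero    c cov = z≤n
covered-sum k (suc n) c cov = subst (suc n ≤_) (sym (sumᶠ-+ k (λ i → χ (c i) 0) _))
  (+-mono-≤ first (covered-sum k n (λ i v → c i (suc v)) (λ v v<n → cov (suc v) (s<s v<n))))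
  where
  first : 1 ≤ sumᶠ k (λ i → χ (c i) 0)
  first with cov 0 z<s
  ... | i , c₀ = subst (_≤ sumᶠ k (λ i → χ (c i) 0)) (cong 𝟙[_] c₀) (term≤sumᶠ k (λ i → χ (c i) 0) i)

complement-count : ∀ n c → sumℕ n (χ (λ v → not (c v))) + sumℕ n (χ c) ≡ n
complement-count zero    c = refl
complement-count (suc n) c with c 0
... | true  = trans (+-suc _ _) (cong suc (complement-count n (λ v → c (suc v))))
... | false = cong suc (complement-count n (λ v → c (suc v)))

module _ {k} (1≤k : 1 ≤ k) (H : Hypergraph) (parts : KPartite k H) (b : Vec ℕ (order H)) where

  open KPartite parts
  open Input H b

  private
    big : Σ[ i ∈ Fin k ] sumᶠ k (λ i → sumℕ n (χ (contains (part i)))) ≤ k * sumℕ n (χ (contains (part i)))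
    big = largest k 1≤k _

  outside : ℕ → Bool
  outside v = not (contains (part (proj₁ big)) v)

  -- The k parts cover all n vertices, so the largest has at least n / k of them; multiplying by k
  -- avoids the fraction.
  outside-count : sumℕ n (χ outside) * k ≤ (k ∸ 1) * n
  outside-count = begin
    o * k                ≡⟨ *-comm o k ⟩
    k * o                ≡⟨ m+n∸n≡m (k * o) n ⟨
    k * o + n ∸ n        ≤⟨ ∸-monoˡ-≤ n (+-monoʳ-≤ (k * o) (≤-trans (covered-sum k n (λ i → contains (part i)) cov) (proj₂ big))) ⟩
    k * o + k * s ∸ n    ≡⟨ cong (_∸ n) (trans (sym (*-distribˡ-+ k o s)) (cong (k *_) (complement-count n _))) ⟩
    k * n ∸ n            ≡⟨ cong (k * n ∸_) (*-identityˡ n) ⟨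
    k * n ∸ 1 * n        ≡⟨ *-distribʳ-∸ n k 1 ⟨
    (k ∸ 1) * n          ∎
    where
    open ≤-Reasoning
    o = sumℕ n (χ outside)
    s = sumℕ n (χ (contains (part (proj₁ big))))
    cov : ∀ v → v < n → Σ[ i ∈ Fin k ] contains (part i) v ≡ true
    cov v v<n with covering (fromℕ< v<n)
    ... | i , v∈ = i , subst (λ x → contains (part i) x ≡ true) (toℕ-fromℕ< v<n) (contains-∈ v∈)

  outside-covers : ∀ F u v → F < m → u < n → v < n → u ≢ v → A# F u ≡ 1 → A# F v ≡ 1 →
                   outside u ≡ true ⊎ outside v ≡ true
  outside-covers F u v F<m u<n v<n u≢v Au Av with contains (part (proj₁ big)) u in u-eq | contains (part (proj₁ big)) v in v-eq
  ... | false | _     = inj₁ refl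
  ... | true  | false = inj₂ refl
  ... | true  | true  = contradiction (atMostOne j (proj₁ big)) (<⇒≱ (2≤∣p∣ û≢v̂ (both u<n Au u-eq) (both v<n Av v-eq)))
    where
    j = fromℕ< F<m
    û≢v̂ : fromℕ< u<n ≢ fromℕ< v<n
    û≢v̂ eq = u≢v (trans (sym (toℕ-fromℕ< u<n)) (trans (cong toℕ eq) (toℕ-fromℕ< v<n)))
    both : ∀ {w} (w<n : w < n) → A# F w ≡ 1 → contains (part (proj₁ big)) w ≡ true → fromℕ< w<n ∈ˢ (lookup (edges H) j ∩ part (proj₁ big))
    both {w} w<n Aw w-eq = x∈p∩q⁺ (in-edge , contains-∈⁻ (part (proj₁ big)) (fromℕ< w<n) (trans (cong (contains (part (proj₁ big))) (toℕ-fromℕ< w<n)) w-eq))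
      where
      in-edge : fromℕ< w<n ∈ˢ lookup (edges H) j
      in-edge with fromℕ< w<n ∈? lookup (edges H) j in w?
      ... | yes w∈ = w∈
      ... | no w∉ = contradiction (trans (sym Aw) (trans (cong₂ (λ x y → peek (encode H b) (2 + (n + (x * n + y)))) (sym (toℕ-fromℕ< F<m)) (sym (toℕ-fromℕ< w<n)))
                      (trans (input-A j (fromℕ< w<n)) (cong (λ d → 𝟙[ does d ]) w?)))) λ ()

-- The machine program

open Terms

nᴾ mᴾ βᴾ Bᴾ Pᴾ τᴾ Eᴾ : Poly 3
nᴾ = var zero
mᴾ = var (suc zero)
βᴾ = var (suc (suc zero))
Bᴾ = con 1 :+ βᴾ
Pᴾ = mᴾ :* (nᴾ :* nᴾ)
-- There are at most B ^ m ≤ 2 ^ (β m) matchings, and the product of all b(v)! is at most B ^ (β n)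
-- ≤ 2 ^ (β β n). With the final 1, the product of both numbers is strictly below t = 2 ^ τ.
τᴾ = βᴾ :* (mᴾ :+ βᴾ :* nᴾ) :+ con 1
-- The first summand is at least the exponent of t ^ (Σb + 1), since Σb ≤ n β. The others keep 2 ^
-- (n + 1), which bounds the codes, as well as B ^ n, 2 ^ β, β P and all input entries below Q; the
-- constant leaves room for strictness.
Eᴾ = τᴾ :* (con 1 :+ nᴾ :* βᴾ) :+ (nᴾ :+ (βᴾ :* nᴾ :+ (βᴾ :+ (Pᴾ :+ (mᴾ :+ con 3)))))

cntᴾ : Fin 5 → Poly 3
cntᴾ byN = nᴾ
cntᴾ byM = mᴾ
cntᴾ byβ = βᴾ
cntᴾ byB = Bᴾ
cntᴾ byP = Pᴾ

-- 20 bounds the degrees and 64 the register numbers of all terms of the program, as the evaluation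
-- of `valid` confirms.
open Static Eᴾ cntᴾ 20 64

top : ℕ
top = 13

ones : List ℕ
ones = List.replicate top 1

-- The parameters are held in registers 1, 2 and 3.
toExpr : Poly 3 → Expr 2
toExpr (con c)  = lit c
toExpr (var i)  = reg (suc (toℕ i))
toExpr (p :+ q) = op add (toExpr p) (toExpr q)
toExpr (p :* q) = op mul (toExpr p) (toExpr q)

increment : ℕ → Cmd 2
increment l = set l (op add (reg l) (lit 1))

upTo : ℕ → ℕ → Cmd 2 → Cmd 2
upTo c i body = while (op sub (reg c) (reg i)) (body ⨾ increment i)

-- With truncated subtraction, x + (y ∸ x) is the maximum of x and y.
maximum : Cmd 2
maximum = upTo 1 7 (set 3 (op add (reg 3) (op sub (zero [ op add (lit 2) (reg 7) ]) (reg 3))))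

-- Repeated doubling, with registers 8 and 7 borrowed for the exponent and the counter before they
-- hold the mask and the code.
power : ℕ → Poly 3 → Cmd 2
power l p = set 8 (toExpr p) ⨾ set l (lit 1) ⨾ set 7 (lit 0) ⨾ upTo 8 7 (set l (op add (reg l) (reg l)))

setup : Cmd 2
-- Writing cell 12 first pads the array to 13 cells, so that its contents can be listed explicitly
-- from then on.
setup = set 12 (lit 0) ⨾ set 1 (zero [ lit 0 ]) ⨾ set 2 (zero [ lit 1 ]) ⨾ maximum ⨾
        set 4 (op add (reg 3) (lit 1)) ⨾ set 5 (op mul (reg 2) (op mul (reg 1) (reg 1))) ⨾
        power 6 τᴾ ⨾ power 0 Eᴾ

store : ℕ → Term → Cmd 2
store l e = compile top (e top) ⨾ set l (reg top)

attempt : Cmd 2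
attempt = store 8 `cover ⨾ store 9 `uncovered

search : Cmd 2
search = (set 7 (lit 1) ⨾ attempt) ⨾ while (reg 9) (increment 7 ⨾ attempt)

summation : Cmd 2
summation = store 10 `size ⨾ set 11 (lit 0) ⨾ set 12 (lit 0) ⨾ upTo 10 11 (store 12 `accumulate)

output : Cmd 2
output = store 12 `result ⨾ (zero [ lit 0 ]≔ reg 12)

program : Program
program = record { scratch = 1 ; code = setup ⨾ search ⨾ summation ⨾ output }

upToᴾ : ℕ → ℕ → Poly 3 → Poly 3 → Poly 3
upToᴾ c i N t = (con 1 :+ N) :* (con 1 :+ costP (op sub (reg c) (reg i)) :+ (t :+ setP i (op add (reg i) (lit 1))))

maximumᴾ : Poly 3
maximumᴾ = upToᴾ 1 7 nᴾ (setP 3 (op add (reg 3) (op sub (zero [ op add (lit 2) (reg 7) ]) (reg 3))))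

powerᴾ : ℕ → Poly 3 → Poly 3
powerᴾ l p = setP 8 (toExpr p) :+ (setP l (lit 1) :+ (setP 7 (lit 0) :+ upToᴾ 8 7 p (setP l (op add (reg l) (reg l)))))

setupᴾ : Poly 3
setupᴾ = setP 12 (lit 0) :+ (setP 1 (zero [ lit 0 ]) :+ (setP 2 (zero [ lit 1 ]) :+ (maximumᴾ :+
         (setP 4 (op add (reg 3) (lit 1)) :+ (setP 5 (op mul (reg 2) (op mul (reg 1) (reg 1))) :+
         (powerᴾ 6 τᴾ :+ powerᴾ 0 Eᴾ))))))

storeᴾ : ℕ → Term → Poly 3
storeᴾ l e = timeP top (e top) :+ setP l (reg top)

attemptᴾ : Poly 3
attemptᴾ = storeᴾ 8 `cover :+ storeᴾ 9 `uncovered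

searchᴾ cycleᴾ writeᴾ spaceᴾ : Poly 3
searchᴾ = con 1 :+ costP (reg 9) :+ (setP 7 (op add (reg 7) (lit 1)) :+ attemptᴾ)
cycleᴾ = con 1 :+ costP (op sub (reg 10) (reg 11)) :+ (storeᴾ 12 `accumulate :+ setP 11 (op add (reg 11) (lit 1)))
writeᴾ = con 1 :+ (costP (lit 0) :+ costP (reg 12))
spaceᴾ = (con 2 :+ (nᴾ :+ mᴾ :* nᴾ) :+ con 64) :* (con 1 :+ MP)

-- `p` and `q` multiply the cost of one pass of the search and of the summation. The value 2 gives
-- the polynomial factor of the time, the other factor being B ^ |C|; the value 1 gives the excess
-- space, which does not accumulate over passes.
totalᴾ : (a b c z x y e r w p q : Poly 3) → Poly 3
totalᴾ a b c z x y e r w p q = a :+ ((b :+ p :* c) :+ ((z :+ (x :+ (y :+ q :* e))) :+ (r :+ w)))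

timeᴾ memoryᴾ : Poly 3
timeᴾ = totalᴾ setupᴾ (setP 7 (lit 1) :+ attemptᴾ) searchᴾ (storeᴾ 10 `size) (setP 11 (lit 0)) (setP 12 (lit 0)) cycleᴾ
               (storeᴾ 12 `result) writeᴾ (con 2) (con 2)
memoryᴾ = spaceᴾ :+ totalᴾ setupᴾ (setP 7 (lit 1) :+ attemptᴾ) searchᴾ (storeᴾ 10 `size) (setP 11 (lit 0)) (setP 12 (lit 0)) cycleᴾ
               (storeᴾ 12 `result) writeᴾ (con 1) (con 1)

-- Runs of the program on an encoded hypergraph

module Execution (H : Hypergraph) (b : Vec ℕ (order H)) where

  open Input H b

  β : ℕ
  β = ‖ b ‖∞

  I : List ℕ
  I = encode H b

  π : Vec ℕ 3
  π = n ∷ m ∷ β ∷ []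

  τ E t : ℕ
  τ = ⟦ τᴾ ⟧ π
  E = ⟦ Eᴾ ⟧ π
  t = 2 ^ τ

  P : ℕ
  P = m * (n * n)

  <E⇒2^<Q : ∀ {x} → x < E → 2 ^ x < 2 ^ E
  <E⇒2^<Q = ^-monoʳ-< 2 (s≤s (s≤s z≤n))

  sum< : ∀ x d {y} → y ≡ suc x + d → x < y
  sum< x d refl = m≤m+n (suc x) d

  X = τ * (1 + n * β)

  X<E : X < E
  X<E = sum< X (n + (β * n + (β + (P + (m + 2))))) (arrange X n (β * n) β P m)
    where
    arrange : ∀ X n z β P m → X + (n + (z + (β + (P + (m + 3))))) ≡ suc X + (n + (z + (β + (P + (m + 2)))))
    arrange = solve-∀

  1+n<E : suc n < E
  1+n<E = sum< (suc n) (X + (β * n + (β + (P + (m + 1))))) (arrange X n (β * n) β P m)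
    where
    arrange : ∀ X n z β P m → X + (n + (z + (β + (P + (m + 3))))) ≡ suc (suc n) + (X + (z + (β + (P + (m + 1)))))
    arrange = solve-∀

  βn<E : β * n < E
  βn<E = sum< (β * n) (X + (n + (β + (P + (m + 2))))) (arrange X n (β * n) β P m)
    where
    arrange : ∀ X n z β P m → X + (n + (z + (β + (P + (m + 3))))) ≡ suc z + (X + (n + (β + (P + (m + 2)))))
    arrange = solve-∀

  β+P<E : β + P < E
  β+P<E = sum< (β + P) (X + (n + (β * n + (m + 2)))) (arrange X n (β * n) β P m)
    where
    arrange : ∀ X n z β P m → X + (n + (z + (β + (P + (m + 3))))) ≡ suc (β + P) + (X + (n + (z + (m + 2))))
    arrange = solve-∀

  input<E : 1 + (n + (m + β)) < E
  input<E = sum< (1 + (n + (m + β))) (X + (β * n + (P + 1))) (arrange X n (β * n) β P m)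
    where
    arrange : ∀ X n z β P m → X + (n + (z + (β + (P + (m + 3))))) ≡ suc (1 + (n + (m + β))) + (X + (z + (P + 1)))
    arrange = solve-∀

  Qᴺ : ℕ
  Qᴺ = 2 ^ E

  <E⇒<Q : ∀ {x} → x < E → x < Qᴺ
  <E⇒<Q {x} x<E = <-trans (n<2^n x) (<E⇒2^<Q x<E)

  n<Q : n < Qᴺ
  n<Q = <E⇒<Q (<-trans (n<1+n n) 1+n<E)

  2^n<Q : 2 ^ n < Qᴺ
  2^n<Q = <E⇒2^<Q (<-trans (n<1+n n) 1+n<E)

  B≤2^β : suc β ≤ 2 ^ β
  B≤2^β = n<2^n β

  B^n<Q : suc β ^ n < Qᴺ
  B^n<Q = ≤-<-trans (^-monoˡ-≤ n B≤2^β) (subst (_< Qᴺ) (sym (^-*-assoc 2 β n)) (<E⇒2^<Q βn<E))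

  2^β<Q : 2 ^ β < Qᴺ
  2^β<Q = <E⇒2^<Q (≤-<-trans (m≤m+n β P) β+P<E)

  P<Q : P < Qᴺ
  P<Q = <E⇒<Q (≤-<-trans (m≤n+m P β) β+P<E)

  βP<Q : β * P < Qᴺ
  βP<Q = ≤-<-trans (*-mono-≤ (<⇒≤ (n<2^n β)) (<⇒≤ (n<2^n P))) (subst (_< Qᴺ) (^-distribˡ-+-* 2 β P) (<E⇒2^<Q β+P<E))

  b≤β : ∀ v → v < n → peek I (2 + v) ≤ β
  b≤β v v<n = subst (λ x → peek I (2 + x) ≤ β) (toℕ-fromℕ< v<n) (subst (_≤ β) (sym (input-b (fromℕ< v<n))) (‖‖∞-bound b (fromℕ< v<n)))

  A≤1 : ∀ F v → F < m → v < n → peek I (2 + (n + (F * n + v))) ≤ 1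
  A≤1 F v F<m v<n = subst₂ (λ x y → peek I (2 + (n + (x * n + y))) ≤ 1) (toℕ-fromℕ< F<m) (toℕ-fromℕ< v<n)
    (subst (_≤ 1) (sym (input-A (fromℕ< F<m) (fromℕ< v<n))) (𝟙≤1 (incident (fromℕ< F<m) (fromℕ< v<n))))
    where
    𝟙≤1 : ∀ q → 𝟙[ q ] ≤ 1
    𝟙≤1 true  = ≤-refl
    𝟙≤1 false = z≤n

  module S = Spec I n m β t Qᴺ

  κ-small : ∀ k → S.κ k ≤ ⟦ cntᴾ k ⟧ π
  κ-small byN = ≤-refl
  κ-small byM = ≤-refl
  κ-small byβ = ≤-refl
  κ-small byB = ≤-refl
  κ-small byP = ≤-refl

  κ≤Q : ∀ k → S.κ k ≤ 2 ^ ⟦ Eᴾ ⟧ π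
  κ≤Q byN = <⇒≤ n<Q
  κ≤Q byM = <⇒≤ (<E⇒<Q (≤-<-trans (≤-trans (m≤m+n m β) (≤-trans (m≤n+m _ n) (n≤1+n _))) input<E))
  κ≤Q byβ = <⇒≤ (<-trans (n<2^n β) 2^β<Q)
  κ≤Q byB = <⇒≤ (≤-<-trans B≤2^β 2^β<Q)
  κ≤Q byP = <⇒≤ P<Q

  I≤Q : ∀ i → peek I i ≤ 2 ^ ⟦ Eᴾ ⟧ π
  I≤Q i = <⇒≤ (≤-<-trans (input-≤ i) (<E⇒<Q input<E))

  E≥1 : 1 ≤ ⟦ Eᴾ ⟧ π
  E≥1 = ≤-trans (s≤s z≤n) 1+n<E

  open Dynamic I π S.κ κ-small κ≤Q I≤Q E≥1 (s≤s z≤n) public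

  record Reach (c : Cmd 2) (t : Poly 3) (R R′ : List ℕ) : Set where
    constructor reach
    field
      runs : Exec c R R′ (⟦ t ⟧ π) (⟦ t ⟧ π)
      kept : Good R′
  open Reach public

  infixr 4 _▷_
  _▷_ : ∀ {c c′ t t′ R R′ R″} → Reach c t R R′ → (Good R′ → Reach c′ t′ R′ R″) → Reach (c ⨾ c′) (t :+ t′) R R″
  r ▷ f = reach (exec-⨾ (runs r) (runs (f (kept r)))) (kept (f (kept r)))

  reach-set : ∀ {R} l e v {l<L : T (l <ᵇ 64)} → eval e ⟨ R ⟩ ≡ v → v ≤ Q → Good R → Reach (set l e) (setP l e) R (poke R l v)
  reach-set l e v {l<L} refl v≤Q g = reach (proj₁ done) (proj₂ done)
    where done = exec-set e g (<ᵇ⇒< l 64 l<L) (≤Q⇒<2^M v≤Q)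

  reach-upTo : ∀ {c i body t} N (S : ℕ → List ℕ) p → N ≤ ⟦ p ⟧ π →
    (∀ j → eval (op sub (reg c) (reg i)) ⟨ S j ⟩ ≡ N ∸ j) →
    (∀ j → j < N → Good (S j) → Reach (body ⨾ increment i) (t :+ setP i (op add (reg i) (lit 1))) (S j) (S (suc j))) →
    Good (S 0) → Reach (upTo c i body) (upToᴾ c i p t) (S 0) (S N)
  reach-upTo {c} {i} {body} {t} N S p N≤p guard step g₀ = reach
      (t′ , s′ , run , ≤-trans t≤ (*-monoˡ-≤ cycle (s≤s N≤p)) , ≤-trans s≤ (+-monoʳ-≤ space₀ (m≤m+n cycle (⟦ p ⟧ π * cycle))))
      g
    where
    cycle = 1 + ⟦ costP (op sub (reg c) (reg i)) ⟧ π + ⟦ t :+ setP i (op add (reg i) (lit 1)) ⟧ π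
    Inv : ℕ → List ℕ → Set
    Inv j R = Good R × R ≡ S j
    iteration : ∀ {j R} → j < N → Inv j R → NonZero (eval (op sub (reg c) (reg i)) ⟨ R ⟩) ×
      Σ[ R′ ∈ _ ] Exec (body ⨾ increment i) R R′ (⟦ t :+ setP i (op add (reg i) (lit 1)) ⟧ π) (⟦ t :+ setP i (op add (reg i) (lit 1)) ⟧ π) × Inv (suc j) R′
    iteration {j} j<N (g , refl) = subst NonZero (sym (guard j)) (>-nonZero (m<n⇒0<n∸m j<N)) ,
      S (suc j) , runs (step j j<N g) , kept (step j j<N g) , refl
    result′ : Σ[ R′ ∈ _ ] Exec (upTo c i body) (S 0) R′ (suc N * cycle) cycle × Inv N R′
    result′ = exec-while Inv (op sub (reg c) (reg i)) (body ⨾ increment i) N _ _ proj₁ iteration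
      (λ { (_ , refl) → trans (guard N) (n∸n≡0 N) }) (g₀ , refl)
    exact : Σ[ R′ ∈ _ ] Exec (upTo c i body) (S 0) R′ (suc N * cycle) cycle × Inv N R′ → Exec (upTo c i body) (S 0) (S N) (suc N * cycle) cycle × Good (S N)
    exact (_ , exec , g , refl) = exec , g
    exec = proj₁ (exact result′)
    g = proj₂ (exact result′)
    t′ = proj₁ exec
    s′ = proj₁ (proj₂ exec)
    run = proj₁ (proj₂ (proj₂ exec))
    t≤ = proj₁ (proj₂ (proj₂ (proj₂ exec)))
    s≤ = proj₂ (proj₂ (proj₂ (proj₂ exec)))

  maxᶠ : ℕ → ℕ
  maxᶠ zero    = 0
  maxᶠ (suc j) = maxᶠ j + (peek I (2 + j) ∸ maxᶠ j)

  maxᶠ-≤ : ∀ j → j ≤ n → maxᶠ j ≤ β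
  maxᶠ-≤ zero    _   = z≤n
  maxᶠ-≤ (suc j) j<n with ≤-total (maxᶠ j) (peek I (2 + j))
  ... | inj₁ ≤ = subst (_≤ β) (sym (m+[n∸m]≡n ≤)) (b≤β j j<n)
  ... | inj₂ ≥ = subst (_≤ β) (sym (trans (cong (maxᶠ j +_) (m≤n⇒m∸n≡0 ≥)) (+-identityʳ _))) (maxᶠ-≤ j (<⇒≤ j<n))

  maxᶠ-≥ : ∀ j v → v < j → peek I (2 + v) ≤ maxᶠ j
  maxᶠ-≥ (suc j) v v<1+j with v ≟ j
  ... | yes refl = m≤n+m∸n (peek I (2 + j)) (maxᶠ j)
  ... | no v≢j   = ≤-trans (maxᶠ-≥ j v (≤∧≢⇒< (s≤s⁻¹ v<1+j) v≢j)) (m≤m+n (maxᶠ j) _)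

  ‖‖∞-least : ∀ {n K} (b : Vec ℕ n) → (∀ v → lookup b v ≤ K) → ‖ b ‖∞ ≤ K
  ‖‖∞-least []      b≤ = z≤n
  ‖‖∞-least (x ∷ b) b≤ = ⊔-lub (b≤ zero) (‖‖∞-least b (b≤ ∘ suc))

  maxᶠ-≡ : maxᶠ n ≡ β
  maxᶠ-≡ = ≤-antisym (maxᶠ-≤ n ≤-refl) (‖‖∞-least b (λ v → subst (_≤ maxᶠ n) (input-b v) (maxᶠ-≥ n (toℕ v) (toℕ<n v))))

  β≤Q : β ≤ Q
  β≤Q = κ≤Q byβ

  toExpr-eval : ∀ p R → (∀ i → peek R (suc (toℕ i)) ≡ lookup π i) → eval (toExpr p) ⟨ R ⟩ ≡ ⟦ p ⟧ π
  toExpr-eval (con c)  R eq = refl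
  toExpr-eval (var i)  R eq = eq i
  toExpr-eval (p :+ q) R eq = cong₂ _+_ (toExpr-eval p R eq) (toExpr-eval q R eq)
  toExpr-eval (p :* q) R eq = cong₂ _*_ (toExpr-eval p R eq) (toExpr-eval q R eq)

  regs₁ : (x i : ℕ) → List ℕ
  regs₁ x i = 0 ∷ n ∷ m ∷ x ∷ 0 ∷ 0 ∷ 0 ∷ i ∷ 0 ∷ 0 ∷ 0 ∷ 0 ∷ 0 ∷ []

  regs₂ : (q t i c : ℕ) → List ℕ
  regs₂ q t i c = q ∷ n ∷ m ∷ β ∷ suc β ∷ P ∷ t ∷ i ∷ c ∷ 0 ∷ 0 ∷ 0 ∷ 0 ∷ []

  parameters₂ : ∀ {q t i c} v → peek (regs₂ q t i c) (suc (toℕ v)) ≡ lookup π v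
  parameters₂ zero             = refl
  parameters₂ (suc zero)       = refl
  parameters₂ (suc (suc zero)) = refl

  reach-maximum : Good (regs₁ 0 0) → Reach maximum maximumᴾ (regs₁ 0 0) (regs₁ β n)
  reach-maximum g = subst (λ x → Reach maximum maximumᴾ (regs₁ 0 0) (regs₁ x n)) maxᶠ-≡
    (reach-upTo n (λ j → regs₁ (maxᶠ j) j) nᴾ ≤-refl (λ j → refl) iteration g)
    where
    iteration : ∀ j → j < n → Good (regs₁ (maxᶠ j) j) → Reach _ _ (regs₁ (maxᶠ j) j) (regs₁ (maxᶠ (suc j)) (suc j))
    iteration j j<n g =
      reach-set 3 (op add (reg 3) (op sub (zero [ op add (lit 2) (reg 7) ]) (reg 3))) (maxᶠ (suc j)) refl (≤-trans (maxᶠ-≤ (suc j) j<n) β≤Q) g ▷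
      reach-set 7 (op add (reg 7) (lit 1)) (suc j) (+-comm j 1) (≤-trans j<n (κ≤Q byN))

  double : ∀ j → 2 ^ j + 2 ^ j ≡ 2 ^ suc j
  double j = cong (2 ^ j +_) (sym (+-identityʳ (2 ^ j)))

  E≤Q : E ≤ Q
  E≤Q = <⇒≤ (n<2^n E)

  τ≤E : τ ≤ E
  τ≤E = ≤-trans (m≤m*n τ (1 + n * β)) (<⇒≤ X<E)

  reach-t : ∀ {i c} → Good (regs₂ 0 0 i c) → Reach (power 6 τᴾ) (powerᴾ 6 τᴾ) (regs₂ 0 0 i c) (regs₂ 0 t τ τ)
  reach-t {i} {c} g =
    reach-set 8 (toExpr τᴾ) τ (toExpr-eval τᴾ (regs₂ 0 0 i c) (parameters₂ {0} {0} {i} {c})) (≤-trans τ≤E E≤Q) g ▷ λ g →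
    reach-set 6 (lit 1) 1 refl (m^n>0 2 E) g ▷ λ g →
    reach-set 7 (lit 0) 0 refl z≤n g ▷
    reach-upTo τ (λ j → regs₂ 0 (2 ^ j) j τ) τᴾ ≤-refl (λ j → refl) (λ j j<τ g →
      reach-set 6 (op add (reg 6) (reg 6)) (2 ^ suc j) (double j) (^-monoʳ-≤ 2 (≤-trans j<τ τ≤E)) g ▷
      reach-set 7 (op add (reg 7) (lit 1)) (suc j) (+-comm j 1) (≤-trans (≤-trans j<τ τ≤E) E≤Q))

  reach-Q : ∀ {t i c} → Good (regs₂ 0 t i c) → Reach (power 0 Eᴾ) (powerᴾ 0 Eᴾ) (regs₂ 0 t i c) (regs₂ Q t E E)
  reach-Q {t} {i} {c} g =
    reach-set 8 (toExpr Eᴾ) E (toExpr-eval Eᴾ (regs₂ 0 t i c) (parameters₂ {0} {t} {i} {c})) E≤Q g ▷ λ g →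
    reach-set 0 (lit 1) 1 refl (m^n>0 2 E) g ▷ λ g →
    reach-set 7 (lit 0) 0 refl z≤n g ▷
    reach-upTo E (λ j → regs₂ (2 ^ j) t j E) Eᴾ ≤-refl (λ j → refl) (λ j j<E g →
      reach-set 0 (op add (reg 0) (reg 0)) (2 ^ suc j) (double j) (^-monoʳ-≤ 2 j<E) g ▷
      reach-set 7 (op add (reg 7) (lit 1)) (suc j) (+-comm j 1) (≤-trans j<E E≤Q))

  reach-setup : Reach setup setupᴾ [] (regs₂ Q t E E)
  reach-setup =
    reach-set 12 (lit 0) 0 refl z≤n (good z≤n (λ i → m^n>0 2 M)) ▷ λ g →
    reach-set 1 (zero [ lit 0 ]) n refl (κ≤Q byN) g ▷ λ g →
    reach-set 2 (zero [ lit 1 ]) m refl (κ≤Q byM) g ▷ λ g →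
    reach-maximum g ▷ λ g →
    reach-set 4 (op add (reg 3) (lit 1)) (suc β) (+-comm β 1) (κ≤Q byB) g ▷ λ g →
    reach-set 5 (op mul (reg 2) (op mul (reg 1) (reg 1))) P refl (κ≤Q byP) g ▷ λ g →
    reach-t g ▷ λ g →
    reach-Q g

  agree-set : ∀ {d ρ R l x} → Agree d ρ R → Agree d (poke ρ l x) (poke R l x)
  agree-set {d} {ρ} {R} {l} {x} agree .at l′ l′<d with l′ ≟ l
  ... | yes refl = trans (peek-poke-same R l x) (sym (peek-poke-same ρ l x))
  ... | no l′≢l  = trans (peek-poke-other R l l′ x l′≢l) (trans (agree .at l′ l′<d) (sym (peek-poke-other ρ l l′ x l′≢l)))

  record At (ρ R : List ℕ) : Set where
    constructor mkAt
    field
      sane  : Good R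
      shown : Agree top ρ R
  open At public

  -- Compiled terms leave debris in the registers from `top` on. Hence, unlike `Reach` in the setup
  -- phase, this follows the contents only below `top`.
  Moves : Cmd 2 → ℕ → ℕ → (ρ ρ′ : List ℕ) → Set
  Moves c t s ρ ρ′ = ∀ {R} → At ρ R → Σ[ R′ ∈ List ℕ ] Exec c R R′ t s × At ρ′ R′

  moves-⨾ : ∀ {c c′ t t′ s s′ ρ ρ′ ρ″} → Moves c t s ρ ρ′ → Moves c′ t′ s′ ρ′ ρ″ → Moves (c ⨾ c′) (t + t′) (s + s′) ρ ρ″
  moves-⨾ f g now =
    let (_ , exec , later′) = f now
        (_ , exec′ , end) = g later′
    in _ , exec-⨾ exec exec′ , end

  moves-set : ∀ {ρ} l e v {l<L : T (l <ᵇ 64)} → (∀ {R} → Agree top ρ R → eval e ⟨ R ⟩ ≡ v) → v ≤ Q →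
              Moves (set l e) (⟦ setP l e ⟧ π) (⟦ setP l e ⟧ π) ρ (poke ρ l v)
  moves-set {ρ} l e v {l<L} value v≤Q {R} now with value (shown now)
  ... | refl = poke R l v , proj₁ done , mkAt (proj₂ done) (agree-set (shown now))
    where done = exec-set e (sane now) (<ᵇ⇒< l 64 l<L) (≤Q⇒<2^M v≤Q)

  moves-store : ∀ {ρ} l (e : Term) {l<L : T (l <ᵇ 64)} → T (valid top ones (e top)) → Env top ones ρ →
                Moves (store l e) (⟦ storeᴾ l e ⟧ π) (⟦ storeᴾ l e ⟧ π) ρ (poke ρ l (⟪ e top ⟫ top ρ))
  moves-store {ρ} l e {l<L} ok v {R} now = let done = exec-compile (e top) ok v (shown now) (sane now) in
    stored (execution done) (regular done) (outer done) (result done)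
    where
    stored : ∀ {R₁ x} → Exec (compile top (e top)) R R₁ (⟦ timeP top (e top) ⟧ π) (⟦ timeP top (e top) ⟧ π) → Good R₁ → Agree top ρ R₁ →
      peek R₁ top ≡ x → Σ[ R′ ∈ List ℕ ] Exec (store l e) R R′ (⟦ storeᴾ l e ⟧ π) (⟦ storeᴾ l e ⟧ π) × At (poke ρ l x) R′
    stored {R₁} exec g agree refl =
      let (exec′ , g′) = exec-set {l = l} (reg top) g (<ᵇ⇒< l 64 l<L) (small g top)
      in poke R₁ l (peek R₁ top) , exec-⨾ exec exec′ , mkAt g′ (agree-set agree)

  moves-while : ∀ (ρ : ℕ → List ℕ) g c N tb sb →
    (∀ {j R} → j < N → Agree top (ρ j) R → NonZero (eval g ⟨ R ⟩)) →
    (∀ {R} → Agree top (ρ N) R → eval g ⟨ R ⟩ ≡ 0) →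
    (∀ j → j < N → Moves c tb sb (ρ j) (ρ (suc j))) →
    Moves (while g c) (suc N * (1 + ⟦ costP g ⟧ π + tb)) (1 + ⟦ costP g ⟧ π + sb) (ρ 0) (ρ N)
  moves-while ρ g c N tb sb continue stop step now = exec-while (λ j R → At (ρ j) R) g c N tb sb sane
    (λ {j} j<N h → continue j<N (shown h) , step j j<N h) (λ h → stop (shown h)) now

  regs : (s mask flag X i acc : ℕ) → List ℕ
  regs s mask flag X i acc = Q ∷ n ∷ m ∷ β ∷ suc β ∷ P ∷ t ∷ s ∷ mask ∷ flag ∷ X ∷ i ∷ acc ∷ []

  all-bounded : ∀ {ρ} → All (_≤ Q) ρ → ∀ l → peek ρ l ≤ Q ^ peek (List.map (λ _ → 1) ρ) l
  all-bounded []         l       = z≤n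
  all-bounded (x≤ ∷ all) zero    = ≤Q⇒≤Q^1 x≤
  all-bounded (x≤ ∷ all) (suc l) = all-bounded all l

  t≤Q : t ≤ Q
  t≤Q = ^-monoʳ-≤ 2 τ≤E

  regs-env : ∀ {s mask flag X i acc} → s ≤ Q → mask ≤ Q → flag ≤ Q → X ≤ Q → i ≤ Q → acc ≤ Q → Env top ones (regs s mask flag X i acc)
  regs-env s≤ mask≤ flag≤ X≤ i≤ acc≤ = env (≤ᵇ⇒≤ 6 13 tt)
    (all-bounded (≤-refl ∷ κ≤Q byN ∷ κ≤Q byM ∷ κ≤Q byβ ∷ κ≤Q byB ∷ κ≤Q byP ∷ t≤Q ∷ s≤ ∷ mask≤ ∷ flag≤ ∷ X≤ ∷ i≤ ∷ acc≤ ∷ []))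
    refl
    (λ { byN → refl ; byM → refl ; byβ → refl ; byB → refl ; byP → refl })

  module Se = Search I n m β t Q n<Q 2^n<Q B^n<Q 2^β<Q P<Q b≤β A≤1
  module Co = Correct I n m β t Q n<Q 2^n<Q B^n<Q 2^β<Q P<Q b≤β A≤1

  cover≤Q : ∀ s → 1 ≤ s → S.cover s ≤ Q
  cover≤Q s 1≤s = <⇒≤ (<-trans (Se.Sound.below (Se.cover-sound s 1≤s)) 2^n<Q)

  uncovered≤Q : ∀ a → S.uncovered a ≤ Q
  uncovered≤Q a = subst (_≤ Q) (sym (Se.uncovered-exact a)) (≤-trans
    (*-monoʳ-≤ β (subst (sumℕ P (λ p → 𝟙[ Se.isOpen a p ]) ≤_) (*-identityʳ P) (sumℕ-≤ P _ 1 (λ p _ → χ-≤1 (Se.isOpen a) p)))) (<⇒≤ βP<Q))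

  attempt-time : ℕ
  attempt-time = ⟦ attemptᴾ ⟧ π

  searched : ℕ → List ℕ
  searched s = regs s (S.cover s) (S.uncovered (S.cover s)) 0 0 0

  moves-attempt : ∀ {s mask flag} → 1 ≤ s → s ≤ Q → mask ≤ Q → flag ≤ Q →
                  Moves attempt attempt-time attempt-time (regs s mask flag 0 0 0) (searched s)
  moves-attempt {s} 1≤s s≤Q mask≤Q flag≤Q = moves-⨾
    (moves-store 8 `cover tt (regs-env s≤Q mask≤Q flag≤Q z≤n z≤n z≤n))
    (moves-store 9 `uncovered tt (regs-env s≤Q (cover≤Q s 1≤s) flag≤Q z≤n z≤n z≤n))

  moves-search : ∀ N → suc N ≤ Q → S.uncovered (S.cover (suc N)) ≡ 0 → (∀ j → j < N → S.uncovered (S.cover (suc j)) ≢ 0) →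
    Moves search (⟦ setP 7 (lit 1) :+ attemptᴾ ⟧ π + suc N * ⟦ searchᴾ ⟧ π) (⟦ setP 7 (lit 1) :+ attemptᴾ ⟧ π + ⟦ searchᴾ ⟧ π)
      (regs E E 0 0 0 0) (searched (suc N))
  moves-search N N<Q success failure = moves-⨾
    (moves-⨾ (moves-set 7 (lit 1) 1 (λ _ → refl) (m^n>0 2 E)) (moves-attempt ≤-refl (m^n>0 2 E) E≤Q z≤n))
    (moves-while (λ j → searched (suc j)) (reg 9) (increment 7 ⨾ attempt) N
      (⟦ setP 7 (op add (reg 7) (lit 1)) :+ attemptᴾ ⟧ π) (⟦ setP 7 (op add (reg 7) (lit 1)) :+ attemptᴾ ⟧ π)
      (λ {j} j<N agree → subst NonZero (sym (agree .at 9 (≤ᵇ⇒≤ 10 13 tt))) (≢-nonZero (failure j j<N)))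
      (λ agree → trans (agree .at 9 (≤ᵇ⇒≤ 10 13 tt)) success)
      (λ j j<N → moves-⨾
        (moves-set 7 (op add (reg 7) (lit 1)) (suc (suc j)) (λ agree → trans (cong (_+ 1) (agree .at 7 (≤ᵇ⇒≤ 8 13 tt))) (+-comm (suc j) 1)) (≤-trans (s≤s j<N) N<Q))
        (moves-attempt (s≤s z≤n) (≤-trans (s≤s j<N) N<Q) (cover≤Q (suc j) (s≤s z≤n)) (uncovered≤Q (S.cover (suc j))))))

  module Main (s : ℕ) (1≤s : 1 ≤ s) (s≤Q : s ≤ Q) where

    mask : ℕ
    mask = S.cover s

    open S.Sum mask using (size₀; summand₀)

    accumulated : ℕ → ℕ
    accumulated zero    = 0
    accumulated (suc i) = mod (accumulated i + summand₀ i) Q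

    accumulated≤Q : ∀ i → accumulated i ≤ Q
    accumulated≤Q zero    = z≤n
    accumulated≤Q (suc i) = <⇒≤ (mod-< (accumulated i + summand₀ i) Q)

    size≤Q : size₀ ≤ Q
    size≤Q = <⇒≤ (loop-< n 1 _)

    summing : ℕ → List ℕ
    summing i = regs s mask (S.uncovered mask) size₀ i (accumulated i)

    summing-env : ∀ i → i ≤ Q → Env top ones (summing i)
    summing-env i i≤Q = regs-env s≤Q (cover≤Q s 1≤s) (uncovered≤Q mask) size≤Q i≤Q (accumulated≤Q i)

    moves-accumulate : Moves (upTo 10 11 (store 12 `accumulate)) (suc size₀ * ⟦ cycleᴾ ⟧ π) (⟦ cycleᴾ ⟧ π) (summing 0) (summing size₀)
    moves-accumulate = moves-while summing (op sub (reg 10) (reg 11)) (store 12 `accumulate ⨾ increment 11) size₀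
      (⟦ storeᴾ 12 `accumulate :+ setP 11 (op add (reg 11) (lit 1)) ⟧ π) (⟦ storeᴾ 12 `accumulate :+ setP 11 (op add (reg 11) (lit 1)) ⟧ π)
      (λ {j} j<N agree → subst NonZero (sym (guard j agree)) (>-nonZero (m<n⇒0<n∸m j<N)))
      (λ agree → trans (guard size₀ agree) (n∸n≡0 size₀))
      (λ j j<N → moves-⨾
        (moves-store 12 `accumulate tt (summing-env j (≤-trans (<⇒≤ j<N) size≤Q)))
        (moves-set 11 (op add (reg 11) (lit 1)) (suc j) (λ agree → trans (cong (_+ 1) (agree .at 11 (≤ᵇ⇒≤ 12 13 tt))) (+-comm j 1)) (≤-trans j<N size≤Q)))
      where
      guard : ∀ j {R} → Agree top (summing j) R → eval (op sub (reg 10) (reg 11)) ⟨ R ⟩ ≡ size₀ ∸ j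
      guard j agree = cong₂ _∸_ (agree .at 10 (≤ᵇ⇒≤ 11 13 tt)) (agree .at 11 (≤ᵇ⇒≤ 12 13 tt))

    final : List ℕ
    final = regs s mask (S.uncovered mask) size₀ size₀ (S.result₀ (accumulated size₀))

    moves-main : Moves (store 10 `size ⨾ set 11 (lit 0) ⨾ set 12 (lit 0) ⨾ upTo 10 11 (store 12 `accumulate))
      (⟦ storeᴾ 10 `size ⟧ π + (⟦ setP 11 (lit 0) ⟧ π + (⟦ setP 12 (lit 0) ⟧ π + suc size₀ * ⟦ cycleᴾ ⟧ π)))
      (⟦ storeᴾ 10 `size ⟧ π + (⟦ setP 11 (lit 0) ⟧ π + (⟦ setP 12 (lit 0) ⟧ π + ⟦ cycleᴾ ⟧ π)))
      (searched s) (summing size₀)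
    moves-main = moves-⨾ (moves-store 10 `size tt (regs-env s≤Q (cover≤Q s 1≤s) (uncovered≤Q mask) z≤n z≤n z≤n))
      (moves-⨾ (moves-set 11 (lit 0) 0 (λ _ → refl) z≤n) (moves-⨾ (moves-set 12 (lit 0) 0 (λ _ → refl) z≤n) moves-accumulate))

    moves-result : Moves (store 12 `result) (⟦ storeᴾ 12 `result ⟧ π) (⟦ storeᴾ 12 `result ⟧ π) (summing size₀) final
    moves-result = moves-store 12 `result tt (summing-env size₀ size≤Q)

least : ∀ (f : ℕ → ℕ) N → f N ≡ 0 → Σ[ M ∈ ℕ ] M ≤ N × f M ≡ 0 × (∀ j → j < M → f j ≢ 0)
least f N fN≡0 with f 0 ≟ 0
... | yes f0≡0 = 0 , z≤n , f0≡0 , λ j ()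
least f zero    fN≡0 | no f0≢0 = contradiction fN≡0 f0≢0
least f (suc N) fN≡0 | no f0≢0 with least (f ∘ suc) N fN≡0
... | M , M≤N , fM≡0 , below = suc M , s≤s M≤N , fM≡0 , λ { zero _ → f0≢0 ; (suc j) (s≤s j<M) → below j j<M }

-- `c*` will be the size of the cover known from the partition. The mask of the first successful
-- code may be a different one; only the size of the former enters the bounds.
module Answer (H : Hypergraph) (b : Vec ℕ (order H)) (c* N₀ : ℕ) (c*≤n : c* ≤ order H)
  (s₀<2^ : suc N₀ < 2 ^ suc c*)
  (success : Execution.S.uncovered H b (Execution.S.cover H b (suc N₀)) ≡ 0)
  (failure : ∀ j → j < N₀ → Execution.S.uncovered H b (Execution.S.cover H b (suc j)) ≢ 0) where

  open Input H b
  open Execution H b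

  s₀ : ℕ
  s₀ = suc N₀

  s₀≤Q : s₀ ≤ Q
  s₀≤Q = <⇒≤ (<-trans s₀<2^ (≤-<-trans (^-monoʳ-≤ 2 (s≤s c*≤n)) (<E⇒2^<Q 1+n<E)))

  open Main s₀ (s≤s z≤n) s₀≤Q

  strong : Co.Summation.Strong mask
  strong = Se.uncovered⇒strong mask success

  Y : ℕ
  Y = suc β ^ c*

  Y≥1 : 1 ≤ Y
  Y≥1 = m^n>0 (suc β) c*

  Y≤2Y : Y ≤ 2 * Y
  Y≤2Y = m≤m+n Y (Y + 0)

  attempts≤ : s₀ ≤ 2 * Y
  attempts≤ with β ≟ 0
  ... | yes β≡0 = ≤-trans (≤-reflexive (cong suc none)) (≤-trans Y≥1 Y≤2Y)
    where
    none : N₀ ≡ 0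
    none with N₀ ≟ 0
    ... | yes N≡0 = N≡0
    ... | no N≢0 = contradiction (trans (Se.uncovered-exact (S.cover 1)) (cong (_* sumℕ P (λ p → 𝟙[ Se.isOpen (S.cover 1) p ])) β≡0)) (failure 0 (n≢0⇒n>0 N≢0))
  -- Now 2 ≤ B, so the search, whose base is 2, is dominated by the sum, whose base is B.
  ... | no β≢0 = <⇒≤ (<-≤-trans s₀<2^ (*-monoʳ-≤ 2 (^-monoˡ-≤ c* (s≤s (n≢0⇒n>0 β≢0)))))

  -- By `paid`, a mask with more than `c*` vertices would have needed a code of at least 2 ^ (c* +
  -- 1).
  size≤Y : S.Sum.size₀ mask ≤ Y
  size≤Y = subst (_≤ Y) (sym (Co.Summation.size-exact mask)) (^-monoʳ-≤ (suc β) count≤)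
    where
    count≤ : Se.count mask ≤ c*
    count≤ = ≮⇒≥ λ c*<count → <⇒≱ s₀<2^ (≤-trans (^-monoʳ-≤ 2 {suc c*} {Se.count mask} c*<count) (Se.Sound.paid (Se.cover-sound s₀ (s≤s z≤n))))

  summands≤ : suc (S.Sum.size₀ mask) ≤ 2 * Y
  summands≤ = ≤-trans (s≤s size≤Y) (≤-trans (+-monoˡ-≤ Y Y≥1) (+-monoʳ-≤ Y (m≤m+n Y 0)))

  open Residue Q
  open Ryser (suc β) (⁺ t)
  open Formula n m A# b# Co.b<B

  N : ℕ
  N = solutions

  accumulated-≋ : ∀ i → accumulated i ≋ ∑ i (Factorisation.summand β (⁺ t) n m A# b# Co.b<B (Co.Summation.c mask) (S.Sum.owner mask))
  accumulated-≋ zero    = ≋-refl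
  accumulated-≋ (suc i) = ≋-subst refl (sym (∑-last i _)) (≋-mod (≋-+ (accumulated-≋ i) (Co.Summation.summand-≋ mask i)))

  accumulated-ryser : accumulated (S.Sum.size₀ mask) ≋ ryser
  accumulated-ryser = ≋-subst refl (Co.Summation.summation mask strong) (accumulated-≋ (S.Sum.size₀ mask))

  factorials : ℕ
  factorials = prodℕ n (λ v → b# v !)

  factorials≤ : factorials ≤ 2 ^ (β * (β * n))
  factorials≤ = begin
    factorials          ≤⟨ prodℕ-≤ n _ (suc β ^ β) (λ v v<n → ≤-trans (factorial-≤ (b# v) β (b≤β v v<n)) (^-monoʳ-≤ (suc β) (b≤β v v<n))) ⟩
    (suc β ^ β) ^ n     ≡⟨ ^-*-assoc (suc β) β n ⟩
    suc β ^ (β * n)     ≤⟨ ^-monoˡ-≤ (β * n) B≤2^β ⟩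
    (2 ^ β) ^ (β * n)   ≡⟨ ^-*-assoc 2 β (β * n) ⟩
    2 ^ (β * (β * n))   ∎
    where open ≤-Reasoning

  N≤ : N ≤ 2 ^ (β * m)
  N≤ = ≤-trans (countⱽ-≤ m (suc β) _) (≤-trans (^-monoˡ-≤ m B≤2^β) (≤-reflexive (^-*-assoc 2 β m)))

  2^<t : 2 ^ (β * (m + β * n)) < t
  2^<t = ^-monoʳ-< 2 (s≤s (s≤s z≤n)) (subst (β * (m + β * n) <_) (+-comm 1 _) ≤-refl)

  small-product : N * factorials < t
  small-product = ≤-<-trans (*-mono-≤ N≤ factorials≤) (subst (_< t)
    (trans (cong (2 ^_) (*-distribˡ-+ β m (β * n))) (^-distribˡ-+-* 2 (β * m) (β * (β * n)))) 2^<t)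

  factorials<t : factorials < t
  factorials<t = ≤-<-trans factorials≤ (≤-<-trans (^-monoʳ-≤ 2 (*-monoʳ-≤ β (m≤n+m (β * n) m))) 2^<t)

  exponent : ℕ
  exponent = τ * suc (demand I n)

  exponent<E : exponent < E
  exponent<E = ≤-<-trans (*-monoʳ-≤ τ (s≤s (sumℕ-≤ n b# β b≤β))) X<E

  t-power : t ^ suc (demand I n) ≡ 2 ^ exponent
  t-power = ^-*-assoc 2 τ (suc (demand I n))

  Q-factor : Q ≡ t ^ suc (demand I n) * 2 ^ (E ∸ exponent)
  Q-factor = trans (cong (2 ^_) (sym (m+[n∸m]≡n (<⇒≤ exponent<E))))
    (trans (^-distribˡ-+-* 2 exponent (E ∸ exponent)) (cong (_* 2 ^ (E ∸ exponent)) (sym t-power)))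

  instance
    t≢0 : NonZero t
    t≢0 = m^n≢0 2 τ

  open Division I n m β t Q (2 ^ (E ∸ exponent)) b≤β N small-product Q-factor
    (subst (_< Q) (sym t-power) (<E⇒2^<Q exponent<E)) using (result-exact)

  result-≡ : S.result₀ (accumulated (S.Sum.size₀ mask)) ≡ N
  result-≡ = result-exact factorials<t (proj₁ split′) (≋-subst refl (proj₂ split′) accumulated-ryser)
    where split′ = ryser-mod

  -- The last command overwrites a cell of the input array, so the final store is in general not of
  -- the form `⟨ R ⟩` that `Exec` describes.
  Finish : Cmd 2 → List ℕ → ℕ → (t s : ℕ) → Set
  Finish c R v t s = Σ[ σ ∈ Store 2 ] Σ[ t′ ∈ ℕ ] Σ[ s′ ∈ ℕ ]
    Run c ⟨ R ⟩ σ t′ s′ × peek (lookup σ zero) 0 ≡ v × t′ ≤ t × s′ ≤ space₀ + s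

  finish-⨾ : ∀ {c c′ R R′ v t t′ s s′} → Exec c R R′ t s → Finish c′ R′ v t′ s′ → Finish (c ⨾ c′) R v (t + t′) (s + s′)
  finish-⨾ {s = s} {s′} (_ , _ , run , t≤ , s≤) (σ , _ , _ , run′ , value , t≤′ , s≤′) =
    σ , _ , _ , seq run run′ , value , +-mono-≤ t≤ t≤′
      , ⊔-lub (≤-trans s≤ (+-monoʳ-≤ space₀ (m≤m+n s s′))) (≤-trans s≤′ (+-monoʳ-≤ space₀ (m≤n+m s′ s)))

  finish-write : ∀ {R} → At final R → Finish (zero [ lit 0 ]≔ reg 12) R N (⟦ writeᴾ ⟧ π) (⟦ writeᴾ ⟧ π)
  finish-write {R} now = _ , _ , _ , assign , trans (peek-poke-same I 0 _) value , s≤s cost-both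
      , ⊔-lub (≤-trans (+-mono-≤ (space≤ (sane now)) cost-both) (+-monoʳ-≤ space₀ (n≤1+n _)))
              (≤-trans after (m≤m+n space₀ _))
    where
    value : peek R 12 ≡ N
    value = trans (shown now .at 12 ≤-refl) result-≡
    cost-both = +-mono-≤ (cost≤ (sane now) (lit 0)) (cost≤ (sane now) (reg 12))
    I′ = poke I 0 (peek R 12)
    after : space (I′ ∷ R ∷ []) ≤ space₀
    after = begin
      cells I′ + (cells R + 0)                         ≡⟨ cong (cells I′ +_) (+-identityʳ (cells R)) ⟩
      cells I′ + cells R                               ≤⟨ +-mono-≤ (cells≤ I′ M (peek-poke-all (_< 2 ^ M) I 0 (peek R 12) (small (sane now) 12) (λ i → ≤Q⇒<2^M (I≤Q i))))
                                                                   (cells≤ R M (small (sane now))) ⟩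
      length I′ * (1 + M) + length R * (1 + M)         ≤⟨ +-mono-≤ (*-monoˡ-≤ (1 + M) (length-poke I 0 (peek R 12) ≤-refl z<s))
                                                                   (*-monoˡ-≤ (1 + M) (short (sane now))) ⟩
      length I * (1 + M) + 64 * (1 + M)                ≡⟨ *-distribʳ-+ (1 + M) (length I) 64 ⟨
      space₀                                           ∎
      where
      open ≤-Reasoning
      cells : List ℕ → ℕ
      cells a = ListAction.sum (List.map (λ x → 1 + bits x) a)

  -- The doubling loop for Q leaves `E` both in its counter and in its bound, the registers that are
  -- now read as code and mask.
  started : At (regs E E 0 0 0 0) (regs₂ Q t E E)
  started = mkAt (kept reach-setup) (agrees λ l _ → refl)

  whole : Finish (Program.code program) [] N
    (⟦ setupᴾ ⟧ π + ((⟦ setP 7 (lit 1) :+ attemptᴾ ⟧ π + s₀ * ⟦ searchᴾ ⟧ π) +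
      ((⟦ storeᴾ 10 `size ⟧ π + (⟦ setP 11 (lit 0) ⟧ π + (⟦ setP 12 (lit 0) ⟧ π + suc (S.Sum.size₀ mask) * ⟦ cycleᴾ ⟧ π))) +
       (⟦ storeᴾ 12 `result ⟧ π + ⟦ writeᴾ ⟧ π))))
    (⟦ setupᴾ ⟧ π + ((⟦ setP 7 (lit 1) :+ attemptᴾ ⟧ π + ⟦ searchᴾ ⟧ π) +
      ((⟦ storeᴾ 10 `size ⟧ π + (⟦ setP 11 (lit 0) ⟧ π + (⟦ setP 12 (lit 0) ⟧ π + ⟦ cycleᴾ ⟧ π))) +
       (⟦ storeᴾ 12 `result ⟧ π + ⟦ writeᴾ ⟧ π))))
  whole = finish-⨾ (runs reach-setup) (searching (moves-search N₀ s₀≤Q success failure started))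
    where
    writing : ∀ {R t s} → Σ[ R′ ∈ List ℕ ] Exec (store 12 `result) R R′ t s × At final R′ → Finish output R N (t + ⟦ writeᴾ ⟧ π) (s + ⟦ writeᴾ ⟧ π)
    writing (_ , exec , now) = finish-⨾ exec (finish-write now)
    summing′ : ∀ {R t s} → Σ[ R′ ∈ List ℕ ] Exec summation R R′ t s × At (summing (S.Sum.size₀ mask)) R′ →
      Finish (summation ⨾ output) R N (t + (⟦ storeᴾ 12 `result ⟧ π + ⟦ writeᴾ ⟧ π)) (s + (⟦ storeᴾ 12 `result ⟧ π + ⟦ writeᴾ ⟧ π))
    summing′ (_ , exec , now) = finish-⨾ exec (writing (moves-result now))
    searching : ∀ {R t s} → Σ[ R′ ∈ List ℕ ] Exec search R R′ t s × At (searched s₀) R′ → Finish (search ⨾ summation ⨾ output) R N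
      (t + ((⟦ storeᴾ 10 `size ⟧ π + (⟦ setP 11 (lit 0) ⟧ π + (⟦ setP 12 (lit 0) ⟧ π + suc (S.Sum.size₀ mask) * ⟦ cycleᴾ ⟧ π))) +
       (⟦ storeᴾ 12 `result ⟧ π + ⟦ writeᴾ ⟧ π)))
      (s + ((⟦ storeᴾ 10 `size ⟧ π + (⟦ setP 11 (lit 0) ⟧ π + (⟦ setP 12 (lit 0) ⟧ π + ⟦ cycleᴾ ⟧ π))) +
       (⟦ storeᴾ 12 `result ⟧ π + ⟦ writeᴾ ⟧ π)))
    searching (_ , exec , now) = finish-⨾ exec (summing′ (moves-main now))

-- Assembling the bounds

linear : ∀ a b c z x y e r w p q Y → p ≤ 2 * Y → q ≤ 2 * Y → 1 ≤ Y →
  a + ((b + p * c) + ((z + (x + (y + q * e))) + (r + w))) ≤ (a + ((b + 2 * c) + ((z + (x + (y + 2 * e))) + (r + w)))) * Y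
linear a b c z x y e r w p q Y p≤ q≤ 1≤Y = begin
  a + ((b + p * c) + ((z + (x + (y + q * e))) + (r + w)))
    ≤⟨ +-mono-≤ (scale a) (+-mono-≤ (+-mono-≤ (scale b) (*-monoˡ-≤ c p≤))
         (+-mono-≤ (+-mono-≤ (scale z) (+-mono-≤ (scale x) (+-mono-≤ (scale y) (*-monoˡ-≤ e q≤)))) (+-mono-≤ (scale r) (scale w)))) ⟩
  a * Y + ((b * Y + 2 * Y * c) + ((z * Y + (x * Y + (y * Y + 2 * Y * e))) + (r * Y + w * Y)))
    ≡⟨ collect a b c z x y e r w Y ⟩
  (a + ((b + 2 * c) + ((z + (x + (y + 2 * e))) + (r + w)))) * Y ∎
  where
  open ≤-Reasoning
  scale : ∀ a → a ≤ a * Y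
  scale a = m≤m*n a Y {{>-nonZero 1≤Y}}
  collect : ∀ a b c z x y e r w Y → a * Y + ((b * Y + 2 * Y * c) + ((z * Y + (x * Y + (y * Y + 2 * Y * e))) + (r * Y + w * Y)))
    ≡ (a + ((b + 2 * c) + ((z + (x + (y + 2 * e))) + (r + w)))) * Y
  collect = solve-∀

^-distrib-* : ∀ k p y → (p * y) ^ k ≡ p ^ k * y ^ k
^-distrib-* zero    p y = refl
^-distrib-* (suc k) p y = trans (cong (p * y *_) (^-distrib-* k p y)) (regroup p y (p ^ k) (y ^ k))
  where
  regroup : ∀ p y a b → p * y * (a * b) ≡ p * a * (y * b)
  regroup = solve-∀

unit : ∀ a b c z x y e r w →
  a + ((b + c) + ((z + (x + (y + e))) + (r + w))) ≡ a + ((b + 1 * c) + ((z + (x + (y + 1 * e))) + (r + w)))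
unit = solve-∀

Conclusion : Program → Poly 3 → Poly 3 → (k : ℕ) (H : Hypergraph) → Vec ℕ (order H) → Set
Conclusion P p q k H b =
  let parameters = order H ∷ size H ∷ ‖ b ‖∞ ∷ [] in
  ∃[ N ] ∃[ t ] ∃[ s ]
    ((PerfectMatching H b ↔ Fin N)
     × Computes P (encode H b) N t s
     × (t ≤ ⟦ p ⟧ parameters · suc ‖ b ‖∞ ^[1-1/ k ] order H)
     × (s ≤ ⟦ q ⟧ parameters))

module _ (k : ℕ) (H : Hypergraph) (nonempty : EdgesNonempty H) (b : Vec ℕ (order H)) (c* N₀ : ℕ) (c*≤n : c* ≤ order H)
  (c*-bound : c* * k ≤ (k ∸ 1) * order H)
  (s₀<2^ : suc N₀ < 2 ^ suc c*)
  (success : Execution.S.uncovered H b (Execution.S.cover H b (suc N₀)) ≡ 0)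
  (failure : ∀ j → j < N₀ → Execution.S.uncovered H b (Execution.S.cover H b (suc j)) ≢ 0) where

  open Input H b
  open Execution H b
  open Answer H b c* N₀ c*≤n s₀<2^ success failure

  space₀-≡ : ∀ μ → (length I + 64) * (1 + ⟦ μ ⟧ π) ≡ ⟦ (con 2 :+ (nᴾ :+ mᴾ :* nᴾ) :+ con 64) :* (con 1 :+ μ) ⟧ π
  space₀-≡ μ = cong (λ l → (l + 64) * (1 + ⟦ μ ⟧ π)) length-input

  -- The k-th power turns the fractional exponent into the integer `c* * k`, and this is the form in
  -- which the averaging over the parts bounds `c*`.
  power≤ : ∀ {t} p → t ≤ p * Y → t ≤ p · suc ‖ b ‖∞ ^[1-1/ k ] n
  power≤ {t} p t≤ = begin
    t ^ k                                 ≤⟨ ^-monoˡ-≤ k t≤ ⟩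
    (p * Y) ^ k                           ≡⟨ ^-distrib-* k p Y ⟩
    p ^ k * Y ^ k                         ≡⟨ cong (p ^ k *_) (^-*-assoc (suc β) c* k) ⟩
    p ^ k * suc β ^ (c* * k)              ≤⟨ *-monoʳ-≤ (p ^ k) (^-monoʳ-≤ (suc β) c*-bound) ⟩
    p ^ k * suc β ^ ((k ∸ 1) * n)         ∎
    where open ≤-Reasoning

  -- With the actual costs in place of variables the type checker would evaluate them.
  conclude : ∀ (a b′ c z x y e r w : Poly 3) →
    Finish (Program.code program) [] N
      (⟦ a ⟧ π + ((⟦ b′ ⟧ π + s₀ * ⟦ c ⟧ π) + ((⟦ z ⟧ π + (⟦ x ⟧ π + (⟦ y ⟧ π + suc (S.Sum.size₀ (S.cover s₀)) * ⟦ e ⟧ π))) + (⟦ r ⟧ π + ⟦ w ⟧ π))))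
      (⟦ a ⟧ π + ((⟦ b′ ⟧ π + ⟦ c ⟧ π) + ((⟦ z ⟧ π + (⟦ x ⟧ π + (⟦ y ⟧ π + ⟦ e ⟧ π))) + (⟦ r ⟧ π + ⟦ w ⟧ π)))) →
    ∀ (space : Poly 3) → space₀ ≡ ⟦ space ⟧ π →
    Conclusion program (totalᴾ a b′ c z x y e r w (con 2) (con 2)) (space :+ totalᴾ a b′ c z x y e r w (con 1) (con 1)) k H b
  conclude a b′ c z x y e r w (σ , t′ , s′ , run , value , t≤ , s≤) space space≡ =
    N , t′ , s′ , matchings-↔ nonempty (⁺ t) Co.b<B , (σ , run , value)
    , power≤ (⟦ totalᴾ a b′ c z x y e r w (con 2) (con 2) ⟧ π) (≤-trans t≤
        (linear (⟦ a ⟧ π) (⟦ b′ ⟧ π) (⟦ c ⟧ π) (⟦ z ⟧ π) (⟦ x ⟧ π) (⟦ y ⟧ π) (⟦ e ⟧ π) (⟦ r ⟧ π) (⟦ w ⟧ π)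
          s₀ (suc (S.Sum.size₀ (S.cover s₀))) Y attempts≤ summands≤ Y≥1))
    , ≤-trans s≤ (≤-reflexive (cong₂ _+_ space≡
        (unit (⟦ a ⟧ π) (⟦ b′ ⟧ π) (⟦ c ⟧ π) (⟦ z ⟧ π) (⟦ x ⟧ π) (⟦ y ⟧ π) (⟦ e ⟧ π) (⟦ r ⟧ π) (⟦ w ⟧ π))))

  conclusion : Conclusion program timeᴾ memoryᴾ k H b
  conclusion = conclude setupᴾ (setP 7 (lit 1) :+ attemptᴾ) searchᴾ (storeᴾ 10 `size) (setP 11 (lit 0)) (setP 12 (lit 0)) cycleᴾ
    (storeᴾ 12 `result) writeᴾ whole spaceᴾ (space₀-≡ MP)

theorem2 : Σ[ P ∈ Program ] Σ[ p ∈ Poly 3 ] Σ[ q ∈ Poly 3 ]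
    ((k : ℕ) → 1 ≤ k →
    (H : Hypergraph) → KPartite k H → EdgesNonempty H →
    (b : Vec ℕ (order H)) →
    let parameters = order H ∷ size H ∷ ‖ b ‖∞ ∷ [] in
    ∃[ N ] ∃[ t ] ∃[ s ]
    ((PerfectMatching H b ↔ Fin N)
    × Computes P (encode H b) N t s
    × (t ≤ ⟦ p ⟧ parameters · suc ‖ b ‖∞ ^[1-1/ k ] order H)
    × (s ≤ ⟦ q ⟧ parameters)))
theorem2 = program , timeᴾ , memoryᴾ , solve
  where
  solve : ∀ k → 1 ≤ k → ∀ H → KPartite k H → EdgesNonempty H → ∀ b → Conclusion program timeᴾ memoryᴾ k H b
  solve k 1≤k H parts nonempty b = start found
    where
    d : ℕ → Bool
    d = outside 1≤k H parts b
    open Execution H b using (module S; module Se)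
    open Se.Steering d (outside-covers 1≤k H parts b) using (found)
    f : ℕ → ℕ
    f j = S.uncovered (S.cover (suc j))
    stop : ∀ {s} → s < 2 ^ suc (sumℕ (order H) (χ d)) → (Σ[ N ∈ ℕ ] suc N ≤ s × f N ≡ 0 × (∀ j → j < N → f j ≢ 0)) →
           Conclusion program timeᴾ memoryᴾ k H b
    stop s<2^ (N , N<s , fN≡0 , below) = conclusion k H nonempty b (sumℕ (order H) (χ d)) N (rank-≤ (order H) d)
      (outside-count 1≤k H parts b) (≤-<-trans N<s s<2^) fN≡0 below
    -- The program stops at the first successful code, which may precede the one supplied by
    -- steering but inherits its upper bound.
    least-code : ∀ s → 1 ≤ s → S.uncovered (S.cover s) ≡ 0 → Σ[ N ∈ ℕ ] suc N ≤ s × f N ≡ 0 × (∀ j → j < N → f j ≢ 0)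
    least-code (suc s) _ success = let (N , N≤s , rest) = least f s success in N , s≤s N≤s , rest
    start : (Σ[ s ∈ ℕ ] 1 ≤ s × s < 2 ^ suc (sumℕ (order H) (χ d)) × S.uncovered (S.cover s) ≡ 0) →
            Conclusion program timeᴾ memoryᴾ k H b
    start (s , 1≤s , s<2^ , success) = stop s<2^ (least-code s 1≤s success)
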